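{- Let $p<q$ be square-free integers $\ge 2$ with $p\equiv 2\pmod 4$ and $q\equiv 3\pmod 4$, put $r=pq/\gcd(p,q)^2$ and assume $p<q<r$. Let $K=\mathbb{Q}(\sqrt p,\sqrt q)$, $F_1=\mathbb{Q}(\sqrt p)$, $F_2=\mathbb{Q}(\sqrt q)$. Let $m$ be a positive integer such that, for some positive integer $\kappa$, $m\le \min\{\frac{r}{4\lceil \kappa\sqrt r\rceil},\,p,\,q\}$. If $p\ge(\frac m2+4)^2$ and $q\geq \left(\frac m2+4\right)^2$, then not all elements of $m\mathcal{O}_{F_1}^+$ are sums of squares of elements of $\mathcal{O}_K$, and not all elements of $m\mathcal{O}_{F_2}^+$ are sums of squares of elements of $\mathcal{O}_K$.
   Context: For a totally real number field $F$, $\mathcal{O}_F$ is its ring of integers, $\mathcal{O}_F^+$ is the set of totally positive elements of $\mathcal{O}_F$ (all real embeddings positive), and $m\mathcal{O}_F^+=\{m\alpha:\alpha\in\mathcal{O}_F^+\}$. A sum of squares in $\mathcal{O}_K$ is a finite sum $\sum_i\alpha_i^2$ with $\alpha_i\in\mathcal{O}_K$ (any number of summands). -}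

module Defs where

open import Level using (0ℓ)
open import Algebra.Bundles using (CommutativeMonoid; RawRing; CommutativeRing)
open import Algebra.Morphism.Structures using (IsRingMonomorphism)
import Algebra.Definitions.RawSemiring as RawSemiringOps
import Algebra.Properties.CommutativeSemigroup as CommutativeSemigroupProperties
import Algebra.Solver.Ring.NaturalCoefficients.Default as SemiringSolver
open import Data.Fin.Base using (toℕ)
open import Data.Integer.Base as ℤ using (ℤ; +_; -[1+_])
open import Data.Nat.Base as ℕ using (ℕ; suc)
import Data.Nat.Properties as ℕ
open import Data.Nat.Divisibility using (_∣_)
open import Data.Product.Base using (Σ; _,_; _×_; ∃-syntax)
open import Data.Rational.Base as ℚ using (ℚ; 0ℚ; 1ℚ; ½; _/_; ∣_∣)
import Data.Rational.Properties as ℚ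
open import Data.Vec.Functional using (Vector)
open import Relation.Binary.PropositionalEquality using (_≡_; refl; sym; trans; cong; cong₂; subst; module ≡-Reasoning)

SquareFree : ℕ → Set
SquareFree n = ∀ d → d ℕ.* d ∣ n → d ≡ 1

natℚ : ℕ → ℚ
natℚ n = + n / 1

-- ℝ consists of the Cauchy sequences of rationals, with _≈ℝ_ as its equality.

IsCauchy : (ℕ → ℚ) → Set
IsCauchy x = ∀ ε → 0ℚ ℚ.< ε →
  ∃[ N ] (∀ i j → N ℕ.≤ i → N ℕ.≤ j → ∣ x i ℚ.- x j ∣ ℚ.< ε)

record ℝ : Set where
  constructor mkℝ
  field
    seq      : ℕ → ℚ
    isCauchy : IsCauchy seq

open ℝ public

private

  half-pos : ∀ {ε} → 0ℚ ℚ.< ε → 0ℚ ℚ.< ½ ℚ.* ε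
  half-pos {ε} 0<ε = subst (ℚ._< ½ ℚ.* ε) (ℚ.*-zeroʳ ½) (ℚ.*-monoʳ-<-pos ½ 0<ε)

  half+half : ∀ ε → ½ ℚ.* ε ℚ.+ ½ ℚ.* ε ≡ ε
  half+half ε = trans (sym (ℚ.*-distribʳ-+ ε ½ ½)) (ℚ.*-identityˡ ε)

  telescope : ∀ a b c → a ℚ.- c ≡ (a ℚ.- b) ℚ.+ (b ℚ.- c)
  telescope a b c = sym (begin
    (a ℚ.- b) ℚ.+ (b ℚ.- c)          ≡⟨ ℚ.+-assoc a (ℚ.- b) (b ℚ.- c) ⟩
    a ℚ.+ (ℚ.- b ℚ.+ (b ℚ.- c))      ≡⟨ cong (a ℚ.+_) (ℚ.+-assoc (ℚ.- b) b (ℚ.- c)) ⟨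
    a ℚ.+ ((ℚ.- b ℚ.+ b) ℚ.- c)      ≡⟨ cong (λ z → a ℚ.+ (z ℚ.- c)) (ℚ.+-inverseˡ b) ⟩
    a ℚ.+ (0ℚ ℚ.- c)                 ≡⟨ cong (a ℚ.+_) (ℚ.+-identityˡ (ℚ.- c)) ⟩
    a ℚ.- c                          ∎)
    where open ≡-Reasoning

  *-distribˡ-∸ : ∀ a b c → a ℚ.* (b ℚ.- c) ≡ a ℚ.* b ℚ.- a ℚ.* c
  *-distribˡ-∸ a b c = trans (ℚ.*-distribˡ-+ a b (ℚ.- c))
    (cong (a ℚ.* b ℚ.+_) (sym (ℚ.neg-distribʳ-* a c)))

  const-cauchy : ∀ a → IsCauchy (λ _ → a)
  const-cauchy a ε 0<ε = 0 , λ _ _ _ _ →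
    subst (ℚ._< ε) (sym (cong ∣_∣ (ℚ.+-inverseʳ a))) 0<ε

  neg-cauchy : ∀ x → IsCauchy x → IsCauchy (λ n → ℚ.- x n)
  neg-cauchy x cx ε 0<ε with cx ε 0<ε
  ... | N , h = N , λ i j N≤i N≤j →
    subst (ℚ._< ε) (trans (sym (ℚ.∣-p∣≡∣p∣ (x i ℚ.- x j))) (cong ∣_∣ (eq (x i) (x j))))
      (h i j N≤i N≤j)
    where
    eq : ∀ a b → ℚ.- (a ℚ.- b) ≡ ℚ.- a ℚ.- (ℚ.- b)
    eq a b = ℚ.neg-distrib-+ a (ℚ.- b)

  +-cauchy : ∀ x y → IsCauchy x → IsCauchy y → IsCauchy (λ n → x n ℚ.+ y n)
  +-cauchy x y cx cy ε 0<ε with cx _ (half-pos 0<ε) | cy _ (half-pos 0<ε)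
  ... | M , g | N , h = M ℕ.⊔ N , λ i j ≤i ≤j → begin-strict
    ∣ (x i ℚ.+ y i) ℚ.- (x j ℚ.+ y j) ∣      ≡⟨ cong ∣_∣ (eq (x i) (y i) (x j) (y j)) ⟩
    ∣ (x i ℚ.- x j) ℚ.+ (y i ℚ.- y j) ∣      ≤⟨ ℚ.∣p+q∣≤∣p∣+∣q∣ (x i ℚ.- x j) (y i ℚ.- y j) ⟩
    ∣ x i ℚ.- x j ∣ ℚ.+ ∣ y i ℚ.- y j ∣      <⟨ ℚ.+-mono-<
      (g i j (ℕ.m⊔n≤o⇒m≤o M N ≤i) (ℕ.m⊔n≤o⇒m≤o M N ≤j))
      (h i j (ℕ.m⊔n≤o⇒n≤o M N ≤i) (ℕ.m⊔n≤o⇒n≤o M N ≤j)) ⟩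
    ½ ℚ.* ε ℚ.+ ½ ℚ.* ε                      ≡⟨ half+half ε ⟩
    ε                                        ∎
    where
    open ℚ.≤-Reasoning
    open CommutativeSemigroupProperties
      (CommutativeMonoid.commutativeSemigroup ℚ.+-0-commutativeMonoid) using (interchange)
    eq : ∀ a b c d → (a ℚ.+ b) ℚ.- (c ℚ.+ d) ≡ (a ℚ.- c) ℚ.+ (b ℚ.- d)
    eq a b c d = trans (cong ((a ℚ.+ b) ℚ.+_) (ℚ.neg-distrib-+ c d))
      (interchange a b (ℚ.- c) (ℚ.- d))

  0<1 : 0ℚ ℚ.< 1ℚ
  0<1 = ℚ.positive⁻¹ 1ℚ

  bounded : ∀ x → IsCauchy x →
    ∃[ b ] (0ℚ ℚ.≤ b × ∃[ N ] (∀ i → N ℕ.≤ i → ∣ x i ∣ ℚ.≤ b))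
  bounded x cx with cx 1ℚ 0<1
  ... | N , h = ∣ x N ∣ ℚ.+ 1ℚ
    , ℚ.+-mono-≤ (ℚ.0≤∣p∣ (x N)) (ℚ.<⇒≤ 0<1)
    , N
    , λ i N≤i → begin
        ∣ x i ∣                          ≡⟨ cong ∣_∣ (eq (x i) (x N)) ⟩
        ∣ x N ℚ.+ (x i ℚ.- x N) ∣        ≤⟨ ℚ.∣p+q∣≤∣p∣+∣q∣ (x N) (x i ℚ.- x N) ⟩
        ∣ x N ∣ ℚ.+ ∣ x i ℚ.- x N ∣      ≤⟨ ℚ.+-monoʳ-≤ ∣ x N ∣ (ℚ.<⇒≤ (h i N N≤i ℕ.≤-refl)) ⟩
        ∣ x N ∣ ℚ.+ 1ℚ                   ∎
    where
    open ℚ.≤-Reasoning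
    eq : ∀ a b → a ≡ b ℚ.+ (a ℚ.- b)
    eq a b = sym (begin-equality
      b ℚ.+ (a ℚ.- b)         ≡⟨ ℚ.+-comm b (a ℚ.- b) ⟩
      (a ℚ.- b) ℚ.+ b         ≡⟨ ℚ.+-assoc a (ℚ.- b) b ⟩
      a ℚ.+ (ℚ.- b ℚ.+ b)     ≡⟨ cong (a ℚ.+_) (ℚ.+-inverseˡ b) ⟩
      a ℚ.+ 0ℚ                ≡⟨ ℚ.+-identityʳ a ⟩
      a                       ∎)

  split : ∀ ε b → 0ℚ ℚ.< ε → 0ℚ ℚ.≤ b →
    ∃[ δ ] (0ℚ ℚ.< δ × b ℚ.* δ ℚ.< ½ ℚ.* ε)
  split ε b 0<ε 0≤b = δ , ℚ.positive⁻¹ δ , (begin-strict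
    b ℚ.* δ                       <⟨ ℚ.*-monoˡ-<-pos δ b<b+1 ⟩
    c ℚ.* δ                       ≡⟨ ℚ.*-assoc c (ℚ.1/ c) (½ ℚ.* ε) ⟨
    c ℚ.* ℚ.1/ c ℚ.* (½ ℚ.* ε)    ≡⟨ cong (ℚ._* (½ ℚ.* ε)) (ℚ.*-inverseʳ c) ⟩
    1ℚ ℚ.* (½ ℚ.* ε)              ≡⟨ ℚ.*-identityˡ (½ ℚ.* ε) ⟩
    ½ ℚ.* ε                       ∎)
    where
    open ℚ.≤-Reasoning
    c : ℚ
    c = b ℚ.+ 1ℚ
    b<b+1 : b ℚ.< c
    b<b+1 = subst (ℚ._< c) (ℚ.+-identityʳ b) (ℚ.+-monoʳ-< b 0<1)
    instance
      c-pos : ℚ.Positive c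
      c-pos = ℚ.positive (ℚ.≤-<-trans 0≤b b<b+1)
      c≢0 : ℚ.NonZero c
      c≢0 = ℚ.pos⇒nonZero c
      1/c-pos : ℚ.Positive (ℚ.1/ c)
      1/c-pos = ℚ.1/pos⇒pos c
      ε/2-pos : ℚ.Positive (½ ℚ.* ε)
      ε/2-pos = ℚ.positive (half-pos 0<ε)
    δ : ℚ
    δ = ℚ.1/ c ℚ.* (½ ℚ.* ε)
    instance
      δ-pos : ℚ.Positive δ
      δ-pos = ℚ.pos*pos⇒pos (ℚ.1/ c) (½ ℚ.* ε)

  *-bound : ∀ {b δ} a c → ∣ a ∣ ℚ.≤ b → 0ℚ ℚ.≤ b → ∣ c ∣ ℚ.< δ → ∣ a ℚ.* c ∣ ℚ.≤ b ℚ.* δ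
  *-bound {b} {δ} a c ∣a∣≤b 0≤b ∣c∣<δ = begin
    ∣ a ℚ.* c ∣        ≡⟨ ℚ.∣p*q∣≡∣p∣*∣q∣ a c ⟩
    ∣ a ∣ ℚ.* ∣ c ∣    ≤⟨ ℚ.*-monoʳ-≤-nonNeg ∣ c ∣ {{ℚ.∣-∣-nonNeg c}} ∣a∣≤b ⟩
    b ℚ.* ∣ c ∣        ≤⟨ ℚ.*-monoˡ-≤-nonNeg b {{ℚ.nonNegative 0≤b}} (ℚ.<⇒≤ ∣c∣<δ) ⟩
    b ℚ.* δ            ∎
    where open ℚ.≤-Reasoning

  product-diff : ∀ a b c d → a ℚ.* b ℚ.- c ℚ.* d ≡ a ℚ.* (b ℚ.- d) ℚ.+ d ℚ.* (a ℚ.- c)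
  product-diff a b c d = trans (telescope (a ℚ.* b) (a ℚ.* d) (c ℚ.* d))
    (cong₂ ℚ._+_ (sym (*-distribˡ-∸ a b d))
      (trans (cong₂ ℚ._-_ (ℚ.*-comm a d) (ℚ.*-comm c d)) (sym (*-distribˡ-∸ d a c))))

  product-bound : ∀ {β γ δ η} a b c d → 0ℚ ℚ.≤ β → 0ℚ ℚ.≤ γ →
    ∣ a ∣ ℚ.≤ β → ∣ d ∣ ℚ.≤ γ → ∣ b ℚ.- d ∣ ℚ.< δ → ∣ a ℚ.- c ∣ ℚ.< η →
    ∣ a ℚ.* b ℚ.- c ℚ.* d ∣ ℚ.≤ β ℚ.* δ ℚ.+ γ ℚ.* η
  product-bound {β} {γ} {δ} {η} a b c d 0≤β 0≤γ a≤β d≤γ b-d<δ a-c<η = begin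
    ∣ a ℚ.* b ℚ.- c ℚ.* d ∣
      ≡⟨ cong ∣_∣ (product-diff a b c d) ⟩
    ∣ a ℚ.* (b ℚ.- d) ℚ.+ d ℚ.* (a ℚ.- c) ∣
      ≤⟨ ℚ.∣p+q∣≤∣p∣+∣q∣ (a ℚ.* (b ℚ.- d)) (d ℚ.* (a ℚ.- c)) ⟩
    ∣ a ℚ.* (b ℚ.- d) ∣ ℚ.+ ∣ d ℚ.* (a ℚ.- c) ∣
      ≤⟨ ℚ.+-mono-≤ (*-bound a (b ℚ.- d) a≤β 0≤β b-d<δ) (*-bound d (a ℚ.- c) d≤γ 0≤γ a-c<η) ⟩
    β ℚ.* δ ℚ.+ γ ℚ.* η ∎
    where open ℚ.≤-Reasoning

  *-cauchy : ∀ x y → IsCauchy x → IsCauchy y → IsCauchy (λ n → x n ℚ.* y n)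
  *-cauchy x y cx cy ε 0<ε =
    let b , 0≤b , B , x≤b = bounded x cx
        c , 0≤c , C , y≤c = bounded y cy
        δ , 0<δ , bδ<ε/2  = split ε b 0<ε 0≤b
        η , 0<η , cη<ε/2  = split ε c 0<ε 0≤c
        M , g             = cx η 0<η
        N , h             = cy δ 0<δ
    in (B ℕ.⊔ C) ℕ.⊔ (M ℕ.⊔ N) , λ i j ≤i ≤j →
      let BC≤i = ℕ.m⊔n≤o⇒m≤o (B ℕ.⊔ C) (M ℕ.⊔ N) ≤i
          MN≤i = ℕ.m⊔n≤o⇒n≤o (B ℕ.⊔ C) (M ℕ.⊔ N) ≤i
          BC≤j = ℕ.m⊔n≤o⇒m≤o (B ℕ.⊔ C) (M ℕ.⊔ N) ≤j
          MN≤j = ℕ.m⊔n≤o⇒n≤o (B ℕ.⊔ C) (M ℕ.⊔ N) ≤j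
      in ℚ.≤-<-trans
        (product-bound (x i) (y i) (x j) (y j) 0≤b 0≤c
          (x≤b i (ℕ.m⊔n≤o⇒m≤o B C BC≤i))
          (y≤c j (ℕ.m⊔n≤o⇒n≤o B C BC≤j))
          (h i j (ℕ.m⊔n≤o⇒n≤o M N MN≤i) (ℕ.m⊔n≤o⇒n≤o M N MN≤j))
          (g i j (ℕ.m⊔n≤o⇒m≤o M N MN≤i) (ℕ.m⊔n≤o⇒m≤o M N MN≤j)))
        (subst (b ℚ.* δ ℚ.+ c ℚ.* η ℚ.<_) (half+half ε) (ℚ.+-mono-< bδ<ε/2 cη<ε/2))

ratℝ : ℚ → ℝ
ratℝ a = mkℝ (λ _ → a) (const-cauchy a)

infixl 6 _+ℝ_
infixl 7 _*ℝ_
infix  4 _≈ℝ_ _<ℝ_ _≤ℝ_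

_+ℝ_ : ℝ → ℝ → ℝ
x +ℝ y = mkℝ (λ n → seq x n ℚ.+ seq y n) (+-cauchy (seq x) (seq y) (isCauchy x) (isCauchy y))

_*ℝ_ : ℝ → ℝ → ℝ
x *ℝ y = mkℝ (λ n → seq x n ℚ.* seq y n) (*-cauchy (seq x) (seq y) (isCauchy x) (isCauchy y))

-ℝ_ : ℝ → ℝ
-ℝ x = mkℝ (λ n → ℚ.- seq x n) (neg-cauchy (seq x) (isCauchy x))

_≈ℝ_ : ℝ → ℝ → Set
x ≈ℝ y = ∀ ε → 0ℚ ℚ.< ε → ∃[ N ] (∀ n → N ℕ.≤ n → ∣ seq x n ℚ.- seq y n ∣ ℚ.< ε)

_<ℝ_ : ℝ → ℝ → Set
x <ℝ y = ∃[ ε ] (0ℚ ℚ.< ε × ∃[ N ] (∀ n → N ℕ.≤ n → seq x n ℚ.+ ε ℚ.≤ seq y n))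

_≤ℝ_ : ℝ → ℝ → Set
x ≤ℝ y = ∀ ε → 0ℚ ℚ.< ε → ∃[ N ] (∀ n → N ℕ.≤ n → seq x n ℚ.≤ seq y n ℚ.+ ε)

ℝ-rawRing : RawRing 0ℓ 0ℓ
ℝ-rawRing = record
  { Carrier = ℝ
  ; _≈_     = _≈ℝ_
  ; _+_     = _+ℝ_
  ; _*_     = _*ℝ_
  ; -_      = -ℝ_
  ; 0#      = ratℝ 0ℚ
  ; 1#      = ratℝ 1ℚ
  }

IsSqrt : ℝ → ℝ → Set
IsSqrt x s = ratℝ 0ℚ ≤ℝ s × s *ℝ s ≈ℝ x

IsCeiling : ℝ → ℕ → Set
IsCeiling x c = ratℝ (natℚ c ℚ.- 1ℚ) <ℝ x × x ≤ℝ ratℝ (natℚ c)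

module _ (R : CommutativeRing 0ℓ 0ℓ) where

  open CommutativeRing R
  open RawSemiringOps (RawRing.rawSemiring rawRing) using (_^_; sum) renaming (_×_ to _·_)

  fromℤ : ℤ → Carrier
  fromℤ (+ n)    = n · 1#
  fromℤ -[1+ n ] = - (suc n · 1#)

  -- x is a root of the monic polynomial Xᵈ + Σ_{i<d} aᵢ Xⁱ over ℤ.
  IsIntegral : Carrier → Set
  IsIntegral x = ∃[ d ] Σ (Vector ℤ d) λ a →
    x ^ d + sum (λ i → fromℤ (a i) * x ^ toℕ i) ≈ 0#

  -- For R a totally real number field, the σ are the real embeddings of R.
  TotallyPositive : Carrier → Set
  TotallyPositive x = ∀ (σ : Carrier → ℝ) →
    IsRingMonomorphism rawRing ℝ-rawRing σ → ratℝ 0ℚ <ℝ σ x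

  𝒪⁺ : Carrier → Set
  𝒪⁺ x = IsIntegral x × TotallyPositive x

  multiple𝒪⁺ : ℕ → Carrier → Set
  multiple𝒪⁺ m x = ∃[ α ] (𝒪⁺ α × x ≈ m · α)

  IsSumOfIntegralSquares : Carrier → Set
  IsSumOfIntegralSquares x = ∃[ n ] Σ (Vector Carrier n) λ a →
    (∀ i → IsIntegral (a i)) × x ≈ sum (λ i → a i * a i)

infix 5 _+√_

record Surd (A : Set) : Set where
  constructor _+√_
  field
    re : A
    im : A

open Surd public

-- R [X] / (X² - d), where a +√ b is the class of a + b X.  When R is a field
-- in which d is not a square, this is the field R(√d).
infixl 8 _[√_]

_[√_] : CommutativeRing 0ℓ 0ℓ → ℕ → CommutativeRing 0ℓ 0ℓ
R [√ n ] = record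
  { Carrier = Surd A
  ; _≈_     = _≋_
  ; _+_     = λ x y → (re x + re y) +√ (im x + im y)
  ; _*_     = λ x y → (re x * re y + d * (im x * im y)) +√ (re x * im y + im x * re y)
  ; -_      = λ x → (- re x) +√ (- im x)
  ; 0#      = 0# +√ 0#
  ; 1#      = 1# +√ 0#
  ; isCommutativeRing = record
    { isRing = record
      { +-isAbelianGroup = record
        { isGroup = record
          { isMonoid = record
            { isSemigroup = record
              { isMagma = record
                { isEquivalence = record
                  { refl  = ≈-refl , ≈-refl
                  ; sym   = λ (e , f) → ≈-sym e , ≈-sym f
                  ; trans = λ (e , f) (g , h) → ≈-trans e g , ≈-trans f h
                  }
                ; ∙-cong = λ (e , f) (g , h) → +-cong e g , +-cong f h
                }
              ; assoc = λ x y z → +-assoc (re x) (re y) (re z) , +-assoc (im x) (im y) (im z)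
              }
            ; identity = (λ x → +-identityˡ (re x) , +-identityˡ (im x))
                       , (λ x → +-identityʳ (re x) , +-identityʳ (im x))
            }
          ; inverse = (λ x → -‿inverseˡ (re x) , -‿inverseˡ (im x))
                    , (λ x → -‿inverseʳ (re x) , -‿inverseʳ (im x))
          ; ⁻¹-cong = λ (e , f) → -‿cong e , -‿cong f
          }
        ; comm = λ x y → +-comm (re x) (re y) , +-comm (im x) (im y)
        }
      ; *-cong = λ (e , f) (g , h) →
          +-cong (*-cong e g) (*-congˡ (*-cong f h)) , +-cong (*-cong e h) (*-cong f g)
      ; *-assoc = λ (a +√ b) (a′ +√ b′) (a″ +√ b″) →
          solve 7 (λ d a b a′ b′ a″ b″ →
            (a :* a′ :+ d :* (b :* b′)) :* a″ :+ d :* ((a :* b′ :+ b :* a′) :* b″)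
              := a :* (a′ :* a″ :+ d :* (b′ :* b″)) :+ d :* (b :* (a′ :* b″ :+ b′ :* a″)))
            ≈-refl d a b a′ b′ a″ b″
        , solve 7 (λ d a b a′ b′ a″ b″ →
            (a :* a′ :+ d :* (b :* b′)) :* b″ :+ (a :* b′ :+ b :* a′) :* a″
              := a :* (a′ :* b″ :+ b′ :* a″) :+ b :* (a′ :* a″ :+ d :* (b′ :* b″)))
            ≈-refl d a b a′ b′ a″ b″
      ; *-identity = (λ (a +√ b) →
            solve 3 (λ d a b → con 1 :* a :+ d :* (con 0 :* b) := a) ≈-refl d a b
          , solve 2 (λ a b → con 1 :* b :+ con 0 :* a := b) ≈-refl a b)
        , (λ (a +√ b) →
            solve 3 (λ d a b → a :* con 1 :+ d :* (b :* con 0) := a) ≈-refl d a b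
          , solve 2 (λ a b → a :* con 0 :+ b :* con 1 := b) ≈-refl a b)
      ; distrib = (λ (x +√ y) (a +√ b) (a′ +√ b′) →
            solve 7 (λ d x y a b a′ b′ →
              x :* (a :+ a′) :+ d :* (y :* (b :+ b′))
                := (x :* a :+ d :* (y :* b)) :+ (x :* a′ :+ d :* (y :* b′)))
              ≈-refl d x y a b a′ b′
          , solve 6 (λ x y a b a′ b′ →
              x :* (b :+ b′) :+ y :* (a :+ a′) := (x :* b :+ y :* a) :+ (x :* b′ :+ y :* a′))
              ≈-refl x y a b a′ b′)
        , (λ (x +√ y) (a +√ b) (a′ +√ b′) →
            solve 7 (λ d x y a b a′ b′ →
              (a :+ a′) :* x :+ d :* ((b :+ b′) :* y)
                := (a :* x :+ d :* (b :* y)) :+ (a′ :* x :+ d :* (b′ :* y)))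
              ≈-refl d x y a b a′ b′
          , solve 6 (λ x y a b a′ b′ →
              (a :+ a′) :* y :+ (b :+ b′) :* x := (a :* y :+ b :* x) :+ (a′ :* y :+ b′ :* x))
              ≈-refl x y a b a′ b′)
      }
    ; *-comm = λ (a +√ b) (a′ +√ b′) →
          solve 5 (λ d a b a′ b′ → a :* a′ :+ d :* (b :* b′) := a′ :* a :+ d :* (b′ :* b))
            ≈-refl d a b a′ b′
        , solve 4 (λ a b a′ b′ → a :* b′ :+ b :* a′ := a′ :* b :+ b′ :* a) ≈-refl a b a′ b′
    }
  }
  where
  open CommutativeRing R renaming (Carrier to A; refl to ≈-refl; sym to ≈-sym; trans to ≈-trans)
  open RawSemiringOps (RawRing.rawSemiring rawRing) using () renaming (_×_ to _·_)
  open SemiringSolver commutativeSemiring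
  d : A
  d = n · 1#
  _≋_ : Surd A → Surd A → Set
  x ≋ y = re x ≈ re y × im x ≈ im y

-- For square-free p ≠ q, both ≥ 2, none of p, q, p q is a rational square, so
-- ℚ(√ p) and ℚ(√ p ,√ q) below are fields.

ℚ⟨√_⟩ : ℕ → CommutativeRing 0ℓ 0ℓ
ℚ⟨√ n ⟩ = ℚ.+-*-commutativeRing [√ n ]

ℚ⟨√_,√_⟩ : ℕ → ℕ → CommutativeRing 0ℓ 0ℓ
ℚ⟨√ p ,√ q ⟩ = ℚ⟨√ p ⟩ [√ q ]

-- The inclusions of ℚ(√ p) and ℚ(√ q) in ℚ(√ p ,√ q).

ι₁ : Surd ℚ → Surd (Surd ℚ)
ι₁ x = x +√ (0ℚ +√ 0ℚ)

ι₂ : Surd ℚ → Surd (Surd ℚ)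
ι₂ x = (re x +√ 0ℚ) +√ (im x +√ 0ℚ)

{-# OPTIONS --safe #-}
module Submission where

-- Put p = g p′, q = g q′, so that r = p′ q′; the integers of K are the numbers
-- x + z √q + (Y √p + W √r) / 2 with x, z, Y, W ∈ ℤ and Y ≡ W mod 2.  Let F = ℚ(√D)
-- with D ∈ {p , q}.  If m (n + b √D) is a sum of squares, the components in F of
-- these squares give
--   4 m (n + b √D) = Σ (Xᵢ + Yᵢ √D)² + E Σ (Nᵢ + βᵢ √D)
-- with Nᵢ + βᵢ √D ∈ 𝒪_F totally nonnegative and E = q′ (D = p) or E = 2 p′ (D = q).
-- For even m = 2 k let b be the least index with 2 k ⌈b √D⌉ < b (D + k²), and let
-- n = ⌈b √D⌉; for odd m take b = 1.  By minimality N - β √D > n - b √D for every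
-- totally positive N + β √D with 0 < β < b.  Since E > 4 m unless b = 1, no βᵢ is
-- positive, and then the whole second sum vanishes.  What remains is
-- Σ (xᵢ² + D yᵢ²) ≤ m n with 2 Σ xᵢ yᵢ = m b, which is impossible: for odd m by
-- parity, and for even m because, by Cauchy–Schwarz and √D ≥ k + 4, Σ yᵢ² is
-- neither ≥ b nor ≤ b - 1.

open import Defs
open import Level using (0ℓ)
open import Algebra.Bundles using (CommutativeRing; RawRing)
import Algebra.Definitions.RawSemiring as RawSemiringOps
open import Algebra.Morphism.Structures using (IsRingMonomorphism)
import Algebra.Properties.CommutativeSemiring.Exp as CommutativeSemiringExp
import Algebra.Properties.Ring as RingProperties
import Algebra.Properties.Semiring.Exp as SemiringExp
import Algebra.Properties.Semiring.Mult as SemiringMult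
import Algebra.Properties.Semiring.Sum as SemiringSum
import Algebra.Solver.Ring.NaturalCoefficients.Default as SemiringSolver
open import Data.Empty using (⊥; ⊥-elim)
open import Data.Fin.Base using (Fin; zero; suc; toℕ)
open import Data.Fin.Properties using (toℕ<n)
open import Data.Integer.Base as ℤ using (ℤ; +_; -[1+_]; 0ℤ; 1ℤ)
import Data.Integer.DivMod as ℤ
import Data.Integer.Properties as ℤ
open import Data.List.Base using (_∷_; [])
open import Data.Nat.Base as ℕ using (ℕ; zero; suc; s≤s; z≤n)
open import Data.Nat.Coprimality as Coprime using (Coprime)
import Data.Nat.DivMod as ℕ
import Data.Nat.Divisibility as ℕ
open import Data.Nat.GCD as GCD using (gcd)
import Data.Nat.Properties as ℕ
open import Data.Product.Base using (_,_; _×_; ∃-syntax; proj₁; proj₂)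
open import Data.Rational.Base as ℚ using (ℚ; mkℚ; 0ℚ; 1ℚ; ↥_; ↧_; ↧ₙ_)
import Data.Rational.Properties as ℚ
open import Data.Rational.Unnormalised.Base using (mkℚᵘ; *≡*)
import Data.Rational.Unnormalised.Properties as ℚᵘ
open import Data.Sum.Base using (_⊎_; inj₁; inj₂; [_,_]′)
open import Relation.Binary.PropositionalEquality
  using (_≡_; _≢_; refl; sym; trans; cong; cong₂; subst; subst₂; module ≡-Reasoning)
open import Relation.Nullary using (¬_; Dec; yes; no)
open import Relation.Nullary.Decidable using (dec⇒maybe; decidable-stable)
import Tactic.RingSolver as Solver
open import Tactic.RingSolver.Core.AlmostCommutativeRing using (AlmostCommutativeRing; fromCommutativeRing)

-- Write m = 2 k, XX = Σ xᵢ², y = Σ yᵢ². Cauchy-Schwarz gives only XX ≥ k² b² / y, and the minimum 2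
-- k b √D of k² b² / y + D y, attained at y = k b / √D, stays below the available 2 k n. So real
-- inequalities alone refute nothing; the obstruction is that y is an integer. At y = b the
-- expression equals b (D + k²), hence the condition defining b makes y ≥ b too expensive. What
-- remains is y ≤ b - 1, excluded by comparing the ceilings belonging to b - 1, 1 and b; the minimum
-- lies between b - 1 and b. The bound on r enters through c = ⌈κ √r⌉ ≥ √r: from 4 m c ≤ r ≤ c²
-- follows 16 m² ≤ r, hence 4 m < r, and 4 m < q′ because r = p′ q′ < q′². For b = 1 the total 4 m n
-- ≤ 4 m c ≤ r is compared with r directly. No real number occurs in this argument: inequalities
-- with √D are squared, and the embedding √D ↦ -√D is replaced by integer functionals a v - c u with
-- u² ≤ v² D.

module Integers where

  open import Data.Integer.Base hiding (suc)
  open import Data.Integer.Tactic.RingSolver using (solve-∀; solve)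
  open SemiringSum (CommutativeRing.semiring ℤ.+-*-commutativeRing)
    using (sum; sum-cong-≗; *-distribˡ-sum; ∑-distrib-+)

  -- Certificates for integer inequalities.

  nonneg : ∀ n → 0ℤ ≤ + n
  nonneg n = +≤+ z≤n

  0<suc : ∀ {n} → 0ℤ < + suc n
  0<suc = +<+ (s≤s z≤n)

  0≤-+ : ∀ {a b} → 0ℤ ≤ a → 0ℤ ≤ b → 0ℤ ≤ a + b
  0≤-+ = ℤ.+-mono-≤

  0≤-* : ∀ {a b} → 0ℤ ≤ a → 0ℤ ≤ b → 0ℤ ≤ a * b
  0≤-* {+ a} {+ b} _ _ = subst (0ℤ ≤_) (ℤ.pos-* a b) (+≤+ z≤n)

  0≤square : ∀ a → 0ℤ ≤ a * a
  0≤square (+ a)    = 0≤-* {+ a} {+ a} (+≤+ z≤n) (+≤+ z≤n)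
  0≤square -[1+ a ] = +≤+ z≤n

  slack : ∀ {a b} → a ≤ b → 0ℤ ≤ b - a
  slack = ℤ.i≤j⇒0≤j-i

  by : ∀ {e d} → 0ℤ ≤ e → e ≡ d → 0ℤ ≤ d
  by h refl = h

  slack< : ∀ {a b} → a < b → 0ℤ ≤ b - a - 1ℤ
  slack< {a} {b} a<b = by (slack (ℤ.i<j⇒suc[i]≤j a<b)) (lem a b)
    where
    lem : ∀ a b → b - (1ℤ + a) ≡ b - a - 1ℤ
    lem = solve-∀

  unslack : ∀ {a b} → 0ℤ ≤ b - a → a ≤ b
  unslack = ℤ.0≤i-j⇒j≤i

  unslack< : ∀ {a b} → 0ℤ ≤ b - a - 1ℤ → a < b
  unslack< {a} {b} h = ℤ.suc[i]≤j⇒i<j (unslack (by h (lem a b)))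
    where
    lem : ∀ a b → b - a - 1ℤ ≡ b - (1ℤ + a)
    lem = solve-∀

  -- The pattern of most proofs below: nonnegative quantities built from the hypotheses add up to -1
  -- identically, which the ring solver checks. Strict inequalities contribute the needed unit
  -- through `slack<`, so integrality is used throughout.
  refute : ∀ {e} → 0ℤ ≤ e → e ≡ -1ℤ → ⊥
  refute () refl

  ≤-byContradiction : ∀ {a b} → (b < a → ⊥) → a ≤ b
  ≤-byContradiction {a} {b} ¬b<a = ℤ.≮⇒≥ ¬b<a

  square-cancel-≤ : ∀ {a b} → 0ℤ ≤ b → a * a ≤ b * b → a ≤ b
  square-cancel-≤ {a} {b} 0≤b h = ≤-byContradiction λ b<a → refute
    (0≤-+ (slack h) (0≤-+ (0≤-* (slack< b<a) (0≤-+ (0≤-+ 0≤b 0≤b) (slack< b<a)))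
      (0≤-+ (0≤-+ 0≤b 0≤b) (0≤-+ (slack< b<a) (slack< b<a)))))
    (solve (a ∷ b ∷ []))

  *-cancel-0≤ : ∀ {a b} → 0ℤ < a → 0ℤ ≤ a * b → 0ℤ ≤ b
  *-cancel-0≤ {a} {b} 0<a h = ≤-byContradiction λ b<0 → refute
    (0≤-+ (0≤-+ h (0≤-* (slack< 0<a) (slack< b<0))) (0≤-+ (slack< 0<a) (slack< b<0)))
    (solve (a ∷ b ∷ []))

  0≤2 : 0ℤ ≤ + 2
  0≤2 = nonneg 2

  -- Totally nonnegative elements of ℚ(√D) and rational slopes below √D.

  Cone : ℤ → ℤ → ℤ → Set
  Cone D a c = 0ℤ ≤ a × c * c * D ≤ a * a

  -- By squaring, (c u)² ≤ c² v² D ≤ (a v)². The functional a v - c u is an integral substitute for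
  -- the embedding a - c √D: it is nonnegative on the cone whenever the slope u / v is at most √D in
  -- absolute value.
  cone-slope : ∀ {D a c u v} → Cone D a c → 0ℤ ≤ v → u * u ≤ v * v * D → c * u ≤ a * v
  cone-slope {D} {a} {c} {u} {v} (0≤a , h) 0≤v g = square-cancel-≤ (0≤-* 0≤a 0≤v) (unslack
    (by (0≤-+ (0≤-* (slack g) (0≤square c)) (0≤-* (slack h) (0≤square v)))
        (solve (D ∷ a ∷ c ∷ u ∷ v ∷ []))))

  form-cone : ∀ D x y → 0ℤ ≤ D → Cone D (x * x + D * (y * y)) (+ 2 * (x * y))
  form-cone D x y 0≤D = 0≤-+ (0≤square x) (0≤-* 0≤D (0≤square y))
    , unslack (by (0≤square (x * x - D * (y * y))) (solve (D ∷ x ∷ y ∷ [])))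

  sum-nonneg : ∀ {l} (f : Fin l → ℤ) → (∀ i → 0ℤ ≤ f i) → 0ℤ ≤ sum f
  sum-nonneg {zero}  f h = +≤+ z≤n
  sum-nonneg {suc l} f h = 0≤-+ (h zero) (sum-nonneg (λ i → f (suc i)) (λ i → h (suc i)))

  term≤sum : ∀ {l} (f : Fin l → ℤ) → (∀ i → 0ℤ ≤ f i) → ∀ j → f j ≤ sum f
  term≤sum f h zero    = unslack (by (sum-nonneg (λ i → f (suc i)) (λ i → h (suc i))) (lem (f zero) _))
    where
    lem : ∀ a b → b ≡ a + b - a
    lem = solve-∀
  term≤sum f h (suc j) = ℤ.≤-trans (term≤sum (λ i → f (suc i)) (λ i → h (suc i)) j)
    (unslack (by (h zero) (lem (f zero) _)))
    where
    lem : ∀ a b → a ≡ a + b - b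
    lem = solve-∀

  sum-linear : ∀ {l} (f g : Fin l → ℤ) s t → sum (λ i → s * f i + t * g i) ≡ s * sum f + t * sum g
  sum-linear f g s t = trans (∑-distrib-+ (λ i → s * f i) (λ i → t * g i))
    (cong₂ _+_ (sym (*-distribˡ-sum s f)) (sym (*-distribˡ-sum t g)))

  -- n is the ceiling of b √D, and b is the least index at which it drops below
  -- the line of slope (D + k²) / 2k.
  record FirstBelow (D k b n : ℤ) : Set where
    field
      b-pos   : 0ℤ < b
      n-pos   : 0ℤ < n
      lower   : (n - 1ℤ) * (n - 1ℤ) ≤ b * b * D
      upper   : b * b * D < n * n
      below   : + 2 * k * n < b * (D + k * k)
      minimal : ∀ β N → 0ℤ < β → β < b → 0ℤ ≤ N → β * β * D < N * N → β * (D + k * k) ≤ + 2 * k * N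

  -- 4 m (n + b √D) = Σ (Xᵢ + Yᵢ √D)² + E Σ (Nᵢ + βᵢ √D), where Cone says that Nᵢ ± βᵢ √D ≥ 0.
  module Representation {l} (D E m n b : ℤ) (0≤D : 0ℤ ≤ D) (0≤E : 0ℤ ≤ E)
    (X Y N β : Fin l → ℤ) (N-cone : ∀ i → Cone D (N i) (β i))
    (sum-re : sum (λ i → X i * X i + D * (Y i * Y i) + E * N i) ≡ + 4 * m * n)
    (sum-im : sum (λ i → + 2 * (X i * Y i) + E * β i) ≡ + 4 * m * b)
    where

    private
      A : Fin l → ℤ
      A i = X i * X i + D * (Y i * Y i)

    -- The functional of slope u / v is nonnegative on every square and on every E (N + β √D), so a
    -- single summand is at most the total. It is used with slope 0 (`N-bound`), with slope (n - 1)
    -- / b (`re-bound`), and with the slope d / c of a difference of two elements (`Below.absurd`).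
    slope-bound : ∀ {u v} → 0ℤ ≤ v → u * u ≤ v * v * D →
      ∀ j → E * (N j * v - β j * u) ≤ + 4 * m * (n * v - b * u)
    slope-bound {u} {v} 0≤v h j =
      ℤ.≤-trans (unslack (by (a-nonneg j) (lem₁ (A j) (+ 2 * (X j * Y j)) E (N j) (β j) u v)))
      (ℤ.≤-trans (term≤sum f f-nonneg j) (ℤ.≤-reflexive total))
      where
      f : Fin l → ℤ
      f i = v * (A i + E * N i) + (- u) * (+ 2 * (X i * Y i) + E * β i)
      lem₁ : ∀ a c E N β u v → a * v - c * u ≡ v * (a + E * N) + (- u) * (c + E * β) - E * (N * v - β * u)
      lem₁ = solve-∀
      lem₂ : ∀ a c E N β u v → a * v - c * u + E * (N * v - β * u) ≡ v * (a + E * N) + (- u) * (c + E * β)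
      lem₂ = solve-∀
      lem₃ : ∀ m n b u v → v * (+ 4 * m * n) + (- u) * (+ 4 * m * b) ≡ + 4 * m * (n * v - b * u)
      lem₃ = solve-∀
      a-nonneg : ∀ i → 0ℤ ≤ A i * v - (+ 2 * (X i * Y i)) * u
      a-nonneg i = slack (cone-slope {D} {A i} {+ 2 * (X i * Y i)} {u} {v} (form-cone D (X i) (Y i) 0≤D) 0≤v h)
      f-nonneg : ∀ i → 0ℤ ≤ f i
      f-nonneg i = by (0≤-+ (a-nonneg i) (0≤-* 0≤E (slack (cone-slope {D} {N i} {β i} {u} {v} (N-cone i) 0≤v h))))
        (lem₂ (A i) (+ 2 * (X i * Y i)) E (N i) (β i) u v)
      total : sum f ≡ + 4 * m * (n * v - b * u)
      total = trans (sum-linear (λ i → A i + E * N i) (λ i → + 2 * (X i * Y i) + E * β i) v (- u))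
        (trans (cong₂ (λ s t → v * s + (- u) * t) sum-re sum-im) (lem₃ m n b u v))

    N-bound : ∀ j → E * N j ≤ + 4 * m * n
    N-bound j = subst₂ _≤_ (lem₁ E (N j) (β j)) (lem₂ m n b) (slope-bound {0ℤ} {1ℤ} (+≤+ z≤n) (by 0≤D (lem₃ D)) j)
      where
      lem₁ : ∀ E N β → E * (N * 1ℤ - β * 0ℤ) ≡ E * N
      lem₁ = solve-∀
      lem₂ : ∀ m n b → + 4 * m * (n * 1ℤ - b * 0ℤ) ≡ + 4 * m * n
      lem₂ = solve-∀
      lem₃ : ∀ D → D ≡ 1ℤ * 1ℤ * D
      lem₃ = solve-∀

    module _ {k} (0<m : 0ℤ < m) (nonsquare : ∀ β N → 0ℤ < β → β * β * D ≢ N * N)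
      (fb : FirstBelow D k b n) where

      open FirstBelow fb

      -- A summand E (N + β √D) with β > 0 has N < n, as E n is already too large.
      -- Then n - N + (b - β) √D lies above the line of slope (D + k²) / 2k or below
      -- √D; the former is impossible by minimality, and the latter makes
      -- N - β √D > n - b √D, so that E (N - β √D) is too large.
      im-nonpos : + 4 * m < E → ∀ j → β j ≤ 0ℤ
      im-nonpos 4m<E j = ≤-byContradiction λ 0<β →
        n≰N (≤-byContradiction λ N<n → Below.absurd 0<β N<n)
        where
        M B : ℤ
        M = N j
        B = β j
        0≤M : 0ℤ ≤ M
        0≤M = proj₁ (N-cone j)
        n≰N : n ≤ M → ⊥
        n≰N n≤N = refute
          (0≤-+ (slack (N-bound j)) (0≤-+ (0≤-* (slack< 4m<E) 0≤M)
            (0≤-+ (0≤-* (0≤-* (nonneg 4) (ℤ.<⇒≤ 0<m)) (slack n≤N)) (0≤-+ (slack n≤N) (slack< n-pos)))))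
          (lem E m n M)
          where
          lem : ∀ E m n M → (+ 4 * m * n - E * M) + ((E - + 4 * m - 1ℤ) * M
            + (+ 4 * m * (M - n) + ((M - n) + (n - 0ℤ - 1ℤ)))) ≡ -1ℤ
          lem = solve-∀
        module Below (0<β : 0ℤ < B) (N<n : M < n) where
          c d : ℤ
          c = b - B
          d = n - M
          strict : B * B * D < M * M
          strict = ℤ.≤∧≢⇒< (proj₂ (N-cone j)) (nonsquare B M 0<β)
          β<b : B < b
          β<b = ℤ.≰⇒> λ b≤β → refute
            (0≤-+ (0≤-+ (slack< strict) (0≤-* 0≤D (0≤-* (slack b≤β) (0≤-+ (ℤ.<⇒≤ b-pos) (ℤ.<⇒≤ 0<β)))))
              (0≤-+ (slack lower) (0≤-* (slack< N<n) (0≤-+ (slack< N<n) (0≤-+ 0≤M 0≤M)))))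
            (lem D M B b n)
            where
            lem : ∀ D M B b n → ((M * M - B * B * D - 1ℤ) + D * ((B - b) * (b + B)))
              + ((b * b * D - (n - 1ℤ) * (n - 1ℤ)) + (n - M - 1ℤ) * ((n - M - 1ℤ) + (M + M))) ≡ -1ℤ
            lem = solve-∀
          0<c : 0ℤ < c
          0<c = unslack< (by (slack< β<b) (lem b B))
            where
            lem : ∀ b B → b - B - 1ℤ ≡ b - B - 0ℤ - 1ℤ
            lem = solve-∀
          0≤d : 0ℤ ≤ d
          0≤d = slack (ℤ.<⇒≤ N<n)
          c<b : c < b
          c<b = unslack< (by (slack< 0<β) (lem b B))
            where
            lem : ∀ b B → B - 0ℤ - 1ℤ ≡ b - (b - B) - 1ℤ
            lem = solve-∀
          d²≤c²D : d * d ≤ c * c * D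
          d²≤c²D = ≤-byContradiction λ above → refute
            (0≤-+ (slack< below) (0≤-+ (slack (minimal c d 0<c c<b 0≤d above))
              (slack (minimal B M 0<β β<b 0≤M strict))))
            (lem D k b n B M)
            where
            lem : ∀ D k b n B M → (b * (D + k * k) - + 2 * k * n - 1ℤ)
              + ((+ 2 * k * (n - M) - (b - B) * (D + k * k)) + (+ 2 * k * M - B * (D + k * k))) ≡ -1ℤ
            lem = solve-∀
          gap : B * d < M * c
          gap = ℤ.≰⇒> λ Mc≤Bd → refute
            (0≤-+ (0≤-+ (0≤-* (slack Mc≤Bd) (0≤-+ (slack Mc≤Bd) (0≤-+ (0≤-* 0≤M (ℤ.<⇒≤ 0<c)) (0≤-* 0≤M (ℤ.<⇒≤ 0<c)))))
                        (0≤-* (0≤square B) (slack d²≤c²D)))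
                  (0≤-+ (0≤-* (slack< strict) (0≤square c)) (0≤-+ (0≤square (c - 1ℤ))
                    (0≤-+ (slack< 0<c) (slack< 0<c)))))
            (lem D M B c d)
            where
            lem : ∀ D M B c d → (((B * d - M * c) * ((B * d - M * c) + (M * c + M * c))) + B * B * (c * c * D - d * d))
              + ((M * M - B * B * D - 1ℤ) * (c * c) + ((c - 1ℤ) * (c - 1ℤ) + ((c - 0ℤ - 1ℤ) + (c - 0ℤ - 1ℤ)))) ≡ -1ℤ
            lem = solve-∀
          absurd : ⊥
          -- With slope d / c = (n - M) / (b - B) the functional vanishes on the difference of the
          -- two elements, so n c - b d = M c - B d. The bound reads E w ≤ 4 m w with this common
          -- value w, which is positive by `gap`.
          absurd = refute
            (0≤-+ (slack (slope-bound (ℤ.<⇒≤ 0<c) d²≤c²D j))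
              (0≤-+ (0≤-* (slack< 4m<E) (slack (ℤ.<⇒≤ gap))) (slack< gap)))
            (lem E m n b M B)
            where
            lem : ∀ E m n b M B → (+ 4 * m * (n * (b - B) - b * (n - M)) - E * (M * (b - B) - B * (n - M)))
              + ((E - + 4 * m - 1ℤ) * (M * (b - B) - B * (n - M)) + (M * (b - B) - B * (n - M) - 1ℤ)) ≡ -1ℤ
            lem = solve-∀

      -- Take the slope (n - 1) / b, just below √D: the total becomes 4 m b, since n b - b (n - 1) =
      -- b, while β ≤ 0 makes the left side at least E N b.
      re-bound : ∀ j → β j ≤ 0ℤ → E * N j ≤ + 4 * m
      re-bound j β≤0 = unslack (*-cancel-0≤ b-pos
        (by (0≤-+ (slack (slope-bound (ℤ.<⇒≤ b-pos) lower j))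
              (0≤-* 0≤E (0≤-* (slack β≤0) (0≤n-1))))
          (lem E m n b (N j) (β j))))
        where
        0≤n-1 : 0ℤ ≤ n - 0ℤ - 1ℤ
        0≤n-1 = slack< n-pos
        lem : ∀ E m n b M B → (+ 4 * m * (n * b - b * (n - 1ℤ)) - E * (M * b - B * (n - 1ℤ)))
          + E * ((0ℤ - B) * (n - 0ℤ - 1ℤ)) ≡ b * (+ 4 * m - E * M)
        lem = solve-∀

  -- Ceilings of b √D and the existence of the least b.

  floor-sqrt : ∀ x → ∃[ t ] (t ℕ.* t ℕ.≤ x × x ℕ.< suc t ℕ.* suc t)
  floor-sqrt zero    = 0 , z≤n , s≤s z≤n
  floor-sqrt (suc x) with floor-sqrt x
  ... | t , t²≤x , x<s² with suc t ℕ.* suc t ℕ.≤? suc x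
  ...   | yes s²≤sx = suc t , s²≤sx , ℕ.≤-<-trans x<s² (ℕ.*-mono-< (ℕ.n<1+n (suc t)) (ℕ.n<1+n (suc t)))
  ...   | no  s²≰sx = t , ℕ.m≤n⇒m≤1+n t²≤x , ℕ.≰⇒> s²≰sx

  least : {P : ℕ → Set} → (∀ i → Dec (P i)) → ∀ n → P n → ∃[ i ] (P i × (∀ j → j ℕ.< i → ¬ P j))
  least P? zero    p = 0 , p , λ _ ()
  least P? (suc n) p with P? 0
  ... | yes p₀ = 0 , p₀ , λ _ ()
  ... | no ¬p₀ with least (λ i → P? (suc i)) n p
  ...   | i , pᵢ , min = suc i , pᵢ , λ
    { zero    _           → ¬p₀
    ; (suc j) (s≤s j<i) → min j j<i }

  <-≤-total : ∀ a b → a < b ⊎ b ≤ a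
  <-≤-total a b with a ℤ.<? b
  ... | yes a<b = inj₁ a<b
  ... | no  a≮b = inj₂ (ℤ.≮⇒≥ a≮b)

  NonSquare : ℤ → Set
  NonSquare D = ∀ β N → 0ℤ < β → β * β * D ≢ N * N

  record Ceiling (D b n : ℤ) : Set where
    field
      n-pos    : 0ℤ < n
      lower    : (n - 1ℤ) * (n - 1ℤ) < b * b * D
      upper    : b * b * D < n * n

  ceiling : ∀ {D} → 0ℤ ≤ D → NonSquare D → ∀ b → 0ℤ < b → ∃[ n ] Ceiling D b n
  ceiling {D} 0≤D nonsquare b 0<b with floor-sqrt ∣ b * b * D ∣
  ... | t , t²≤x , x<s² = + suc t , record
    { n-pos = 0<suc
    ; lower = ℤ.≤∧≢⇒< (subst (_≤ b * b * D) (trans (ℤ.pos-* t t) (lem (+ t)))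
                (subst (+ (t ℕ.* t) ≤_) x≡ (+≤+ t²≤x)))
                (λ eq → nonsquare b (+ suc t - 1ℤ) 0<b (sym eq))
    ; upper = subst₂ _<_ x≡ (ℤ.pos-* (suc t) (suc t)) (+<+ x<s²)
    }
    where
    x≡ : + ∣ b * b * D ∣ ≡ b * b * D
    x≡ = ℤ.0≤i⇒+∣i∣≡i (0≤-* (0≤square b) 0≤D)
    lem : ∀ t → t * t ≡ (1ℤ + t - 1ℤ) * (1ℤ + t - 1ℤ)
    lem = solve-∀

  ceiling-least : ∀ {D b n N} → Ceiling D b n → 0ℤ ≤ N → b * b * D < N * N → n ≤ N
  ceiling-least {D} {b} {n} {N} c 0≤N b²D<N² = ≤-byContradiction λ N<n → refute
    (0≤-+ (0≤-+ (slack< (Ceiling.lower c)) (slack< b²D<N²))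
      (0≤-+ (0≤-* (slack< N<n) (0≤-+ (slack< N<n) (0≤-+ 0≤N 0≤N))) 0≤1))
    (lem (b * b * D) n N)
    where
    0≤1 : 0ℤ ≤ 1ℤ
    0≤1 = +≤+ z≤n
    lem : ∀ x n N → ((x - (n - 1ℤ) * (n - 1ℤ) - 1ℤ) + (N * N - x - 1ℤ))
      + ((n - N - 1ℤ) * ((n - N - 1ℤ) + (N + N)) + 1ℤ) ≡ -1ℤ
    lem = solve-∀

  module _ {D k : ℤ} (0<k : 0ℤ < k) (k+4≤√D : (k + + 4) * (k + + 4) ≤ D) (nonsquare : NonSquare D) where

    private
      0≤k : 0ℤ ≤ k
      0≤k = ℤ.<⇒≤ 0<k

      0≤D : 0ℤ ≤ D
      0≤D = ℤ.≤-trans (0≤square (k + + 4)) k+4≤√D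

      -- Indexed by b - 1, so that the least index gives b > 0.
      Below : ℕ → Set
      Below i = + 2 * k * proj₁ (ceiling 0≤D nonsquare (+ suc i) 0<suc) < + suc i * (D + k * k)

      -- The search for b stops at k at the latest: D + k² - 2 k √D = (√D - k)² ≥ 16, whereas
      -- rounding k √D up to n costs less than 2 after doubling.
      below-at : ∀ {n} → Ceiling D k n → + 2 * k * n < k * (D + k * k)
      below-at {n} c = ℤ.≰⇒> λ above → refute
        (0≤-+ (0≤-+ (0≤-* (bound above) (0≤-+ (bound above) (0≤-+ small small)))
          (0≤-* (nonneg 4) (slack< (Ceiling.lower c)))) poly)
        (lem D k n)
        where
        bound : k * (D + k * k) ≤ + 2 * k * n → 0ℤ ≤ + 2 * n - (D + k * k)
        bound above = *-cancel-0≤ 0<k (by (slack above) (lem₁ D k n))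
          where
          lem₁ : ∀ D k n → + 2 * k * n - k * (D + k * k) ≡ k * (+ 2 * n - (D + k * k))
          lem₁ = solve-∀
        e : ℤ
        e = D - (k + + 4) * (k + + 4)
        small : 0ℤ ≤ D + k * k - + 2
        small = by (0≤-+ (slack k+4≤√D) (0≤-+ (0≤-* (nonneg 2) (0≤square k)) (0≤-+ (0≤-* (nonneg 8) 0≤k)
          (nonneg 14)))) (lem₁ D k)
          where
          lem₁ : ∀ D k → D - (k + + 4) * (k + + 4) + (+ 2 * (k * k) + (+ 8 * k + + 14)) ≡ D + k * k - + 2
          lem₁ = solve-∀
        poly : 0ℤ ≤ (D + k * k - + 2) * (D + k * k - + 2) - + 4 * (k * k * D) + + 3
        poly = by (0≤-+ (0≤-+ (0≤-* (nonneg 56) (0≤square k)) (0≤-+ (0≤-* (nonneg 224) 0≤k) (nonneg 199)))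
            (0≤-+ (0≤-* (slack k+4≤√D) (0≤-+ (0≤-* (nonneg 16) 0≤k) (nonneg 28))) (0≤square e))) (lem₁ D k)
          where
          lem₁ : ∀ D k → (+ 56 * (k * k) + (+ 224 * k + + 199)) + ((D - (k + + 4) * (k + + 4)) * (+ 16 * k + + 28)
            + (D - (k + + 4) * (k + + 4)) * (D - (k + + 4) * (k + + 4)))
              ≡ (D + k * k - + 2) * (D + k * k - + 2) - + 4 * (k * k * D) + + 3
          lem₁ = solve-∀
        lem : ∀ D k n → (+ 2 * n - (D + k * k)) * ((+ 2 * n - (D + k * k)) + ((D + k * k - + 2) + (D + k * k - + 2)))
          + + 4 * (k * k * D - (n - 1ℤ) * (n - 1ℤ) - 1ℤ) + ((D + k * k - + 2) * (D + k * k - + 2) - + 4 *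
            (k * k * D) + + 3) ≡ -1ℤ
        lem = solve-∀

      positive-suc : ∀ {a} → 0ℤ < a → ∃[ i ] + suc i ≡ a
      positive-suc {+ suc i} _ = i , refl
      positive-suc {+ zero} (+<+ ())

      below-index : ∃[ i ] Below i
      below-index = i , subst (λ b → ∀ n → Ceiling D b n → + 2 * k * n < b * (D + k * k)) (sym i≡)
        (λ n → below-at {n}) _ (proj₂ (ceiling 0≤D nonsquare (+ suc i) 0<suc))
        where
        i : ℕ
        i = proj₁ (positive-suc 0<k)
        i≡ : + suc i ≡ k
        i≡ = proj₂ (positive-suc 0<k)

    first-below : ∃[ b ] ∃[ n ] FirstBelow D k b n
    first-below = + suc i , n , record
      { b-pos   = 0<suc
      ; n-pos   = Ceiling.n-pos c
      ; lower   = ℤ.<⇒≤ (Ceiling.lower c)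
      ; upper   = Ceiling.upper c
      ; below   = proj₁ (proj₂ found)
      ; minimal = minimal
      }
      where
      found : ∃[ i ] (Below i × (∀ j → j ℕ.< i → ¬ Below j))
      found = least {Below} (λ _ → _ ℤ.<? _) (proj₁ below-index) (proj₂ below-index)
      i : ℕ
      i = proj₁ found
      n : ℤ
      n = proj₁ (ceiling 0≤D nonsquare (+ suc i) 0<suc)
      c : Ceiling D (+ suc i) n
      c = proj₂ (ceiling 0≤D nonsquare (+ suc i) 0<suc)
      minimal : ∀ β N → 0ℤ < β → β < + suc i → 0ℤ ≤ N → β * β * D < N * N → β * (D + k * k) ≤ + 2 * k * N
      minimal (+ suc j) N 0<β (+<+ (s≤s j<i)) 0≤N above = ℤ.≤-trans (ℤ.≮⇒≥ (proj₂ (proj₂ found) j j<i))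
        (unslack (by (0≤-* (0≤-* 0≤2 0≤k)
          (slack (ceiling-least (proj₂ (ceiling 0≤D nonsquare (+ suc j) 0<suc)) 0≤N above)))
          (lem k N _)))
        where
        lem : ∀ k N n → + 2 * k * (N - n) ≡ + 2 * k * N - + 2 * k * n
        lem = solve-∀
      minimal (+ zero) N (+<+ ())

  -- No representation of 2 k (n + b √D) by squares with integer coordinates.

  module _ {D k b n : ℤ} (0<k : 0ℤ < k) (k+4≤√D : (k + + 4) * (k + + 4) ≤ D) (nonsquare : NonSquare D)
    (fb : FirstBelow D k b n) where

    open FirstBelow fb

    private
      0≤k : 0ℤ ≤ k
      0≤k = ℤ.<⇒≤ 0<k

      0≤D : 0ℤ ≤ D
      0≤D = ℤ.≤-trans (0≤square (k + + 4)) k+4≤√D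

      k²≤D : 0ℤ ≤ D - k * k
      k²≤D = by (0≤-+ (slack k+4≤√D) (0≤-+ (0≤-* (nonneg 8) 0≤k) (nonneg 16))) (lem D k)
        where
        lem : ∀ D k → (D - (k + + 4) * (k + + 4)) + (+ 8 * k + + 16) ≡ D - k * k
        lem = solve-∀

      ω : ℤ
      ω = b - 1ℤ

    -- This is where the hypothesis k + 4 ≤ √D enters: with j = ⌊ω √D⌋ and
    -- t = ⌊√D⌋, minimality gives n ≤ j + 1 + t, and (j - k ω)² ≤ 2 k ω.
    module Gap (0<ω : 0ℤ < ω) {n₁ nω : ℤ} (c₁ : Ceiling D 1ℤ n₁) (cω : Ceiling D ω nω) where

      t j h v : ℤ
      t = n₁ - 1ℤ
      j = nω - 1ℤ
      h = j - k * ω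
      v = t - k

      0≤ω : 0ℤ ≤ ω
      0≤ω = ℤ.<⇒≤ 0<ω
      0≤t : 0ℤ ≤ t
      0≤t = by (slack< (Ceiling.n-pos c₁)) (lem n₁)
        where
        lem : ∀ a → a - 0ℤ - 1ℤ ≡ a - 1ℤ
        lem = solve-∀

      ω-above : ω * (D + k * k) ≤ + 2 * k * nω
      ω-above = minimal ω nω 0<ω (unslack< (by (nonneg 0) (lem b))) (ℤ.<⇒≤ (Ceiling.n-pos cω)) (Ceiling.upper cω)
        where
        lem : ∀ b → 0ℤ ≡ b - (b - 1ℤ) - 1ℤ
        lem = solve-∀

      1-above : 1ℤ * (D + k * k) ≤ + 2 * k * n₁
      1-above = minimal 1ℤ n₁ 0<suc (unslack< (by (slack< 0<ω) (lem b))) (ℤ.<⇒≤ (Ceiling.n-pos c₁)) (Ceiling.upper c₁)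
        where
        lem : ∀ b → b - 1ℤ - 0ℤ - 1ℤ ≡ b - 1ℤ - 1ℤ
        lem = solve-∀

      -- If n ≥ nω + n₁, the minimality inequalities at ω and at 1 add up to b (D + k²) ≤ 2 k n,
      -- against `below`.
      n-bound : n ≤ j + 1ℤ + t
      n-bound = ≤-byContradiction λ above → refute
        (0≤-+ (0≤-+ (slack< below) (0≤-* (0≤-* 0≤2 0≤k) (slack< above)))
          (0≤-+ (slack ω-above) (slack 1-above)))
        (lem D k b n nω n₁)
        where
        lem : ∀ D k b n x y → ((b * (D + k * k) - + 2 * k * n - 1ℤ) + + 2 * k * (n - (x - 1ℤ + 1ℤ + (y - 1ℤ)) - 1ℤ))
          + ((+ 2 * k * x - (b - 1ℤ) * (D + k * k)) + (+ 2 * k * y - 1ℤ * (D + k * k))) ≡ -1ℤ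
        lem = solve-∀

      -- Complete the square in j² ≤ ω² D ≤ 2 k ω (j + 1) - k² ω².
      h²-bound : 0ℤ ≤ + 2 * k * ω - h * h
      h²-bound = by (0≤-+ (0≤-* 0≤ω (slack ω-above)) (slack (ℤ.<⇒≤ (Ceiling.lower cω)))) (lem D k ω nω)
        where
        lem : ∀ D k ω x → ω * (+ 2 * k * x - ω * (D + k * k)) + (ω * ω * D - (x - 1ℤ) * (x - 1ℤ))
          ≡ + 2 * k * ω - (x - 1ℤ - k * ω) * (x - 1ℤ - k * ω)
        lem = solve-∀

      4≤v : + 4 ≤ v
      4≤v = ≤-byContradiction λ v<4 → refute
        (0≤-+ (0≤-+ (slack k+4≤√D) (slack< (Ceiling.upper c₁)))
          (0≤-* (slack< v<4) (0≤-+ (0≤-+ 0≤k (nonneg 4)) (ℤ.<⇒≤ (Ceiling.n-pos c₁)))))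
        (lem D k n₁)
        where
        lem : ∀ D k x → ((D - (k + + 4) * (k + + 4)) + (x * x - 1ℤ * 1ℤ * D - 1ℤ))
          + (+ 4 - (x - 1ℤ - k) - 1ℤ) * (k + + 4 + x) ≡ -1ℤ
        lem = solve-∀

      -- The floor of ω √D is at least ω times the floor of √D.
      h-bound : ω * v ≤ h
      h-bound = unslack (by (slack ωt≤j) (lem k ω t j))
        where
        lem : ∀ k ω t j → j - ω * t ≡ j - k * ω - ω * (t - k)
        lem = solve-∀
        ωt≤j : ω * t ≤ j
        ωt≤j = ≤-byContradiction λ j<ωt → refute
          (0≤-+ (0≤-+ (slack< (Ceiling.upper cω)) (0≤-* (0≤square ω) (slack (ℤ.<⇒≤ (Ceiling.lower c₁)))))
            (0≤-* (slack< j<ωt) (0≤-+ (0≤-* 0≤ω 0≤t) (ℤ.<⇒≤ (Ceiling.n-pos cω)))))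
          (lem₁ D ω nω t)
          where
          lem₁ : ∀ D ω x t → ((x * x - ω * ω * D - 1ℤ) + ω * ω * (1ℤ * 1ℤ * D - t * t))
            + (ω * t - (x - 1ℤ) - 1ℤ) * (ω * t + x) ≡ -1ℤ
          lem₁ = solve-∀

      0≤v : 0ℤ ≤ v
      0≤v = ℤ.≤-trans (+≤+ z≤n) 4≤v

      ωv-bound : 0ℤ ≤ + 2 * k - ω * (v * v)
      ωv-bound = *-cancel-0≤ 0<ω
        (by (0≤-+ h²-bound (0≤-* (slack h-bound) (0≤-+ (slack h-bound) (0≤-+ (0≤-* 0≤ω 0≤v) (0≤-* 0≤ω 0≤v)))))
        (lem k ω h v))
        where
        lem : ∀ k ω h v → (+ 2 * k * ω - h * h) + (h - ω * v) * ((h - ω * v) + (ω * v + ω * v))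
          ≡ ω * (+ 2 * k - ω * (v * v))
        lem = solve-∀

      -- This is what the constant 4 in (k + 4)² ≤ D buys: v ≥ 4 turns ω v² ≤ 2 k into 16 ω ≤ 2 k.
      -- The estimates `2ωv≤k`, `h<k` and `wide` all rest on it.
      8ω≤k : 0ℤ ≤ k - + 8 * ω
      8ω≤k = *-cancel-0≤ {+ 2} 0<suc
        (by (0≤-+ ωv-bound (0≤-* 0≤ω (0≤-* (slack 4≤v) (0≤-+ 0≤v (nonneg 4))))) (lem k ω v))
        where
        lem : ∀ k ω v → (+ 2 * k - ω * (v * v)) + ω * ((v - + 4) * (v + + 4)) ≡ + 2 * (k - + 8 * ω)
        lem = solve-∀

      2ωv≤k : + 2 * (ω * v) ≤ k
      2ωv≤k = square-cancel-≤ 0≤k (unslack (by (0≤-+ (0≤-* (0≤-* (nonneg 4) 0≤ω) ωv-bound) (0≤-* 0≤k 8ω≤k))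
        (lem k ω v)))
        where
        lem : ∀ k ω v → + 4 * ω * (+ 2 * k - ω * (v * v)) + k * (k - + 8 * ω) ≡ k * k - + 2 * (ω * v) * (+ 2 * (ω * v))
        lem = solve-∀

      h<k : h < k
      h<k = ℤ.≰⇒> λ k≤h → refute
        (0≤-+ (0≤-* (nonneg 4) (0≤-+ h²-bound (0≤-* (slack k≤h) (0≤-+ (slack k≤h) (0≤-+ 0≤k 0≤k)))))
          (0≤-+ (0≤-* 0≤k 8ω≤k) (0≤-+ (0≤-* (nonneg 3) (0≤-* (slack< 0<k) (0≤-+ 0≤k (nonneg 1)))) 0≤2)))
        (lem k ω h)
        where
        lem : ∀ k ω h → + 4 * ((+ 2 * k * ω - h * h) + (h - k) * ((h - k) + (k + k)))
          + (k * (k - + 8 * ω) + (+ 3 * ((k - 0ℤ - 1ℤ) * (k + 1ℤ)) + + 2)) ≡ -1ℤ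
        lem = solve-∀

      -- Equivalently ω ≤ k b / √D: the minimum of k² b² / y + D y is not to the left of y = ω, so
      -- the expression decreases up to ω. It follows from h + 1 ≤ k.
      steep : ω * ω * D ≤ k * k * (b * b)
      steep = unslack (by (0≤-+ (0≤-* 0≤ω (slack ω-above))
          (0≤-* 0≤k (0≤-+ (0≤-* (0≤-* 0≤2 0≤ω) (slack< h<k)) 0≤k))) (lem D k b nω))
        where
        lem : ∀ D k b x → (b - 1ℤ) * (+ 2 * k * x - (b - 1ℤ) * (D + k * k))
          + k * (+ 2 * (b - 1ℤ) * (k - (x - 1ℤ - k * (b - 1ℤ)) - 1ℤ) + k) ≡ k * k * (b * b) - (b - 1ℤ) * (b - 1ℤ) * D
        lem = solve-∀

      wide : 0ℤ ≤ (k - ω * v) * (k - ω * v) - + 2 * k * ω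
      wide = *-cancel-0≤ {+ 4} 0<suc
        (by (0≤-+ (0≤-* 0≤k 8ω≤k) (0≤-* (slack 2ωv≤k) (0≤-+ (0≤-+ 0≤k 0≤k) (slack 2ωv≤k)))) (lem k ω v))
        where
        lem : ∀ k ω v → k * (k - + 8 * ω) + (k - + 2 * (ω * v)) * (k + k + (k - + 2 * (ω * v)))
          ≡ + 4 * ((k - ω * v) * (k - ω * v) - + 2 * k * ω)
        lem = solve-∀

      -- Divided by ω: the value of k² b² / y + D y at y = ω exceeds 2 k n. After n ≤ j + 1 + t and
      -- j² < ω² D, what must be nonnegative is (h² - ω² v²) + ((k - ω v)² - 2 k ω), covered by
      -- `h-bound` and `wide`.
      gap : + 2 * k * n * ω < k * k * (b * b) + ω * ω * D
      gap = ℤ.≰⇒> λ above → refute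
        (0≤-+ (0≤-+ (0≤-+ (slack above) (0≤-* (0≤-* (0≤-* 0≤2 0≤k) 0≤ω) (slack n-bound))) (slack< (Ceiling.lower cω)))
          (0≤-+ (0≤-* (slack h-bound) (0≤-+ (slack h-bound) (0≤-+ (0≤-* 0≤ω 0≤v) (0≤-* 0≤ω 0≤v)))) wide))
        (lem D k b n j t)
        where
        lem : ∀ D k b n j t → ((+ 2 * k * n * (b - 1ℤ) - (k * k * (b * b) + (b - 1ℤ) * (b - 1ℤ) * D))
            + + 2 * k * (b - 1ℤ) * (j + 1ℤ + t - n)) + ((b - 1ℤ) * (b - 1ℤ) * D - j * j - 1ℤ)
          + ((j - k * (b - 1ℤ) - (b - 1ℤ) * (t - k)) * ((j - k * (b - 1ℤ) - (b - 1ℤ) * (t - k))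
              + ((b - 1ℤ) * (t - k) + (b - 1ℤ) * (t - k)))
            + ((k - (b - 1ℤ) * (t - k)) * (k - (b - 1ℤ) * (t - k)) - + 2 * k * (b - 1ℤ))) ≡ -1ℤ
        lem = solve-∀

    -- XX, YY stand for Σ xᵢ², Σ yᵢ², with Σ xᵢ yᵢ = k b.
    no-binary-squares : ∀ {XX YY} → 0ℤ ≤ XX → 0ℤ ≤ YY →
      (∀ s t → 0ℤ ≤ s * s * XX - + 2 * s * t * (k * b) + t * t * YY) →
      XX + D * YY ≤ + 2 * k * n → ⊥
    no-binary-squares {XX} {YY} 0≤XX 0≤YY squares total =
      [ main , (λ ω≤0 → degenerate ω≤0) ]′ (<-≤-total 0ℤ ω)
      where
      YY<b : YY < b
      -- The weights 1, k give XX ≥ 2 k² b - k² YY, the tangent to k² b² / YY at YY = b. As D ≥ k²,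
      -- this makes XX + D YY ≥ b (D + k²) for YY ≥ b.
      YY<b = ℤ.≰⇒> λ b≤YY → refute
        (0≤-+ (0≤-+ (squares 1ℤ k) (slack total)) (0≤-+ (slack< below) (0≤-* (slack b≤YY) k²≤D)))
        (lem D k b n XX YY)
        where
        lem : ∀ D k b n XX YY → ((1ℤ * 1ℤ * XX - + 2 * 1ℤ * k * (k * b) + k * k * YY) + (+ 2 * k * n - (XX + D * YY)))
          + ((b * (D + k * k) - + 2 * k * n - 1ℤ) + (YY - b) * (D - k * k)) ≡ -1ℤ
        lem = solve-∀
      degenerate : ω ≤ 0ℤ → ⊥
      -- Now b = 1 and YY ≤ 0, although the mixed sum k b is positive. The form is then negative at
      -- weights 1, t for any t with 2 t k b > XX; t = XX + 1 is such a weight.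
      degenerate ω≤0 = refute
        (0≤-+ (0≤-+ (squares 1ℤ (XX + 1ℤ)) (0≤-* (0≤square (XX + 1ℤ)) (0≤-+ (slack< YY<b) (slack ω≤0))))
          (0≤-+ 0≤XX (0≤-+ (0≤-* (0≤-* 0≤2 (0≤-+ 0≤XX (nonneg 1)))
            (0≤-+ (slack< 0<k) (0≤-* 0≤k (slack< b-pos)))) (nonneg 1))))
        (lem k b XX YY)
        where
        lem : ∀ k b XX YY → ((1ℤ * 1ℤ * XX - + 2 * 1ℤ * (XX + 1ℤ) * (k * b) + (XX + 1ℤ) * (XX + 1ℤ) * YY)
            + (XX + 1ℤ) * (XX + 1ℤ) * ((b - YY - 1ℤ) + (0ℤ - (b - 1ℤ))))
          + (XX + (+ 2 * (XX + 1ℤ) * ((k - 0ℤ - 1ℤ) + k * (b - 0ℤ - 1ℤ)) + 1ℤ)) ≡ -1ℤ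
        lem = solve-∀
      main : 0ℤ < ω → ⊥
      main 0<ω = refute (0≤-+ (slack< gap) bound) (lem₁ D k b n)
        where
        open Gap 0<ω (proj₂ (ceiling 0≤D nonsquare 1ℤ 0<suc)) (proj₂ (ceiling 0≤D nonsquare ω 0<ω))
        bound : 0ℤ ≤ + 2 * k * n * ω - (k * k * (b * b) + ω * ω * D)
        -- The weights ω, k b give the tangent at YY = ω. The resulting lower bound for XX + D YY is
        -- linear in YY and nonincreasing by `steep`, so on YY ≤ ω it is smallest at YY = ω.
        bound = *-cancel-0≤ 0<ω (by
          (0≤-+ (squares ω (k * b)) (0≤-+ (0≤-* (0≤square ω) (slack total)) (0≤-* (slack steep) (slack< YY<b))))
          (lem D k b n XX YY))
          where
          lem : ∀ D k b n XX YY →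
            ((b - 1ℤ) * (b - 1ℤ) * XX - + 2 * (b - 1ℤ) * (k * b) * (k * b) + (k * b) * (k * b) * YY)
            + ((b - 1ℤ) * (b - 1ℤ) * (+ 2 * k * n - (XX + D * YY))
              + (k * k * (b * b) - (b - 1ℤ) * (b - 1ℤ) * D) * (b - YY - 1ℤ))
            ≡ (b - 1ℤ) * (+ 2 * k * n * (b - 1ℤ) - (k * k * (b * b) + (b - 1ℤ) * (b - 1ℤ) * D))
          lem = solve-∀
        lem₁ : ∀ D k b n → (k * k * (b * b) + (b - 1ℤ) * (b - 1ℤ) * D - + 2 * k * n * (b - 1ℤ) - 1ℤ)
          + (+ 2 * k * n * (b - 1ℤ) - (k * k * (b * b) + (b - 1ℤ) * (b - 1ℤ) * D)) ≡ -1ℤ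
        lem₁ = solve-∀

  -- The multiplied element n + b √D, uniformly in the parity of m.

  record Admissible (D m b n : ℤ) : Set where
    field
      0<b     : 0ℤ < b
      0<n     : 0ℤ < n
      n-1<b√D : (n - 1ℤ) * (n - 1ℤ) < b * b * D
      b√D<n   : b * b * D < n * n
      binary  : ∀ {l} (x y : Fin l → ℤ) →
                sum (λ i → x i * x i + D * (y i * y i)) ≤ m * n → + 2 * sum (λ i → x i * y i) ≡ m * b → ⊥
      -- Two ways to dispose of summands outside F: for b = 1 the total 4 m n is at most r,
      -- otherwise the minimality of b is available.
      first   : b ≡ 1ℤ ⊎ (∃[ k ] (m ≡ + 2 * k × 1ℤ < b × FirstBelow D k b n))

  -- Cauchy-Schwarz as Σ (s xᵢ - t yᵢ)² ≥ 0. The weights stay free, so that `no-binary-squares` can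
  -- choose integer tangents and avoid division.
  sum-square : ∀ {l} (x y : Fin l → ℤ) s t →
    0ℤ ≤ s * s * sum (λ i → x i * x i) - + 2 * s * t * sum (λ i → x i * y i) + t * t * sum (λ i → y i * y i)
  sum-square x y s t = by (sum-nonneg (λ i → (s * x i - t * y i) * (s * x i - t * y i)) (λ i →
    0≤square (s * x i - t * y i)))
    (trans (sum-cong-≗ (λ i → lem s t (x i) (y i)))
    (trans (sum-linear (λ i → s * (x i * x i) + (- (+ 2 * t)) * (x i * y i)) (λ i → y i * y i) s (t * t))
    (trans (cong (λ a → s * a + t * t * sum (λ i → y i * y i)) (sum-linear (λ i → x i * x i) (λ i →
      x i * y i) s (- (+ 2 * t))))
      (lem₂ s t _ _ _))))
    where
    lem : ∀ s t x y → (s * x - t * y) * (s * x - t * y) ≡ s * (s * (x * x) + (- (+ 2 * t)) * (x * y)) + t * t * (y * y)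
    lem = solve-∀
    lem₂ : ∀ s t a b c → s * (s * a + (- (+ 2 * t)) * b) + t * t * c ≡ s * s * a - + 2 * s * t * b + t * t * c
    lem₂ = solve-∀

  even-or-odd : ∀ m → (∃[ k ] m ≡ + 2 * k) ⊎ (∃[ k ] m ≡ + 2 * k + 1ℤ)
  even-or-odd m with m ℤ.%ℕ 2 | ℤ.n%ℕd<d m 2 | ℤ.a≡a%ℕn+[a/ℕn]*n m 2
  ... | 0 | _ | eq = inj₁ (m ℤ./ℕ 2 , trans eq (lem (m ℤ./ℕ 2)))
    where
    lem : ∀ a → 0ℤ + a * + 2 ≡ + 2 * a
    lem = solve-∀
  ... | 1 | _ | eq = inj₂ (m ℤ./ℕ 2 , trans eq (lem (m ℤ./ℕ 2)))
    where
    lem : ∀ a → 1ℤ + a * + 2 ≡ + 2 * a + 1ℤ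
    lem = solve-∀
  ... | suc (suc _) | s≤s (s≤s ()) | _

  even≢odd : ∀ a b → + 2 * a ≢ + 2 * b + 1ℤ
  even≢odd a b eq =
    [ (λ b<a → refute (0≤-+ (0≤-* 0≤2 (slack< b<a)) (slack (ℤ.≤-reflexive eq))) (lem₁ a b))
    , (λ a≤b → refute (0≤-+ (0≤-* 0≤2 (slack a≤b)) (slack (ℤ.≤-reflexive (sym eq)))) (lem₂ a b)) ]′
    (<-≤-total b a)
    where
    lem₁ : ∀ a b → + 2 * (a - b - 1ℤ) + (+ 2 * b + 1ℤ - + 2 * a) ≡ -1ℤ
    lem₁ = solve-∀
    lem₂ : ∀ a b → + 2 * (b - a) + (+ 2 * a - (+ 2 * b + 1ℤ)) ≡ -1ℤ
    lem₂ = solve-∀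

  admissible : ∀ {D m} → 0ℤ < m → (m + + 8) * (m + + 8) ≤ + 4 * D → NonSquare D → ∃[ b ] ∃[ n ] Admissible D m b n
  admissible {D} {m} 0<m big nonsquare = [ even , odd ]′ (even-or-odd m)
    where
    0≤D : 0ℤ ≤ D
    0≤D = *-cancel-0≤ {+ 4} 0<suc (ℤ.≤-trans (0≤square (m + + 8)) big)

    even : (∃[ k ] m ≡ + 2 * k) → ∃[ b ] ∃[ n ] Admissible D m b n
    even (k , refl) = b , n , record
      { 0<b     = b-pos
      ; 0<n     = n-pos
      ; n-1<b√D = ℤ.≤∧≢⇒< lower (λ eq → nonsquare b (n - 1ℤ) b-pos (sym eq))
      ; b√D<n   = upper
      ; binary  = λ x y re im → no-binary-squares 0<k k+4≤√D nonsquare fb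
          (sum-nonneg (λ i → x i * x i) (λ i → 0≤square (x i)))
          (sum-nonneg (λ i → y i * y i) (λ i → 0≤square (y i)))
          (λ s t → by (sum-square x y s t) (cong (λ a →
            s * s * sum (λ i → x i * x i) - + 2 * s * t * a + t * t * sum (λ i → y i * y i))
            (halve (trans im (ℤ.*-assoc (+ 2) k b)))))
          (subst (_≤ + 2 * k * n) (re-split x y) re)
      ; first   = [ (λ 1<b → inj₂ (k , refl , 1<b , fb))
                  , (λ b≤1 → inj₁ (ℤ.≤-antisym b≤1 (ℤ.i<j⇒suc[i]≤j b-pos))) ]′ (<-≤-total 1ℤ b)
      }
      where
      halve : ∀ {a c} → + 2 * a ≡ + 2 * c → a ≡ c
      halve = ℤ.*-cancelˡ-≡ (+ 2) _ _
      0<k : 0ℤ < k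
      0<k = ℤ.*-cancelˡ-<-nonNeg {0ℤ} {k} (+ 2) 0<m
      k+4≤√D : (k + + 4) * (k + + 4) ≤ D
      k+4≤√D = unslack (*-cancel-0≤ {+ 4} 0<suc (by (slack big) (lem D k)))
        where
        lem : ∀ D k → + 4 * D - (+ 2 * k + + 8) * (+ 2 * k + + 8) ≡ + 4 * (D - (k + + 4) * (k + + 4))
        lem = solve-∀
      selected : ∃[ b ] ∃[ n ] FirstBelow D k b n
      selected = first-below 0<k k+4≤√D nonsquare
      b n : ℤ
      b = proj₁ selected
      n = proj₁ (proj₂ selected)
      fb : FirstBelow D k b n
      fb = proj₂ (proj₂ selected)
      open FirstBelow fb
      re-split : ∀ {l} (x y : Fin l → ℤ) → sum (λ i → x i * x i + D * (y i * y i))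
        ≡ sum (λ i → x i * x i) + D * sum (λ i → y i * y i)
      re-split x y = trans (∑-distrib-+ (λ i → x i * x i) (λ i → D * (y i * y i)))
        (cong (λ a → sum (λ i → x i * x i) + a) (sym (*-distribˡ-sum D (λ i → y i * y i))))

    odd : (∃[ k ] m ≡ + 2 * k + 1ℤ) → ∃[ b ] ∃[ n ] Admissible D m b n
    odd (k , m≡) = 1ℤ , n , record
      { 0<b     = 0<suc
      ; 0<n     = Ceiling.n-pos c
      ; n-1<b√D = Ceiling.lower c
      ; b√D<n   = Ceiling.upper c
      ; binary  = λ x y _ im → even≢odd _ k (trans im (trans (ℤ.*-identityʳ m) m≡))
      ; first   = inj₁ refl
      }
      where
      n : ℤ
      n = proj₁ (ceiling 0≤D nonsquare 1ℤ 0<suc)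
      c : Ceiling D 1ℤ n
      c = proj₂ (ceiling 0≤D nonsquare 1ℤ 0<suc)

  -- From squares in K to squares in F: the vanishing of all Wᵢ.

  0<square : ∀ {a} → a ≢ 0ℤ → 0ℤ < a * a
  0<square {a} a≢0 = ℤ.≤∧≢⇒< (0≤square a) λ eq → a≢0 ([ (λ z → z) , (λ z → z) ]′ (ℤ.i*j≡0⇒i≡0∨j≡0 a (sym eq)))

  sum-mono : ∀ {l} {f g : Fin l → ℤ} → (∀ i → f i ≤ g i) → sum f ≤ sum g
  sum-mono {zero}  h = ℤ.≤-refl
  sum-mono {suc l} h = ℤ.+-mono-≤ (h zero) (sum-mono (λ i → h (suc i)))

  -- The summands below are the squares of xᵢ + zᵢ √q + (Yᵢ √p + Wᵢ √r) / 2, where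
  -- p = g p′, q = g q′ and r = p′ q′; their coordinates are multiplied by 4.
  module Core {g p′ q′ m c : ℤ} (0<g : 0ℤ < g) (0<p′ : 0ℤ < p′) (p′<q′ : p′ < q′) (0<m : 0ℤ < m)
    (0<c : 0ℤ < c) (4mc≤r : + 4 * m * c ≤ p′ * q′) (r≤c² : p′ * q′ ≤ c * c)
    (q<r : g * q′ < p′ * q′)
    where

    private
      0<q′ : 0ℤ < q′
      0<q′ = ℤ.<-trans 0<p′ p′<q′
      0≤r : 0ℤ ≤ p′ * q′
      0≤r = 0≤-* (ℤ.<⇒≤ 0<p′) (ℤ.<⇒≤ 0<q′)
      4m≤c : + 4 * m ≤ c
      4m≤c = unslack (*-cancel-0≤ 0<c (by (0≤-+ (slack 4mc≤r) (slack r≤c²)) (lem m c (p′ * q′))))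
        where
        lem : ∀ m c r → (r - + 4 * m * c) + (c * c - r) ≡ c * (c - + 4 * m)
        lem = solve-∀
      16m²≤r : + 16 * (m * m) ≤ p′ * q′
      16m²≤r = unslack (by (0≤-+ (slack 4mc≤r) (0≤-* (0≤-* (nonneg 4) (ℤ.<⇒≤ 0<m)) (slack 4m≤c))) (lem m c (p′ * q′)))
        where
        lem : ∀ m c r → (r - + 4 * m * c) + + 4 * m * (c - + 4 * m) ≡ r - + 16 * (m * m)
        lem = solve-∀
      4m<r : + 4 * m < p′ * q′
      4m<r = unslack< (by (0≤-+ (slack 16m²≤r) (0≤-+ (0≤-* (nonneg 16) (0≤square (m - 1ℤ)))
        (0≤-+ (0≤-* (nonneg 28) (slack< 0<m)) (nonneg 11)))) (lem m (p′ * q′)))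
        where
        lem : ∀ m r → (r - + 16 * (m * m)) + (+ 16 * ((m - 1ℤ) * (m - 1ℤ)) + (+ 28 * (m - 0ℤ - 1ℤ) + + 11))
          ≡ r - + 4 * m - 1ℤ
        lem = solve-∀

    -- For b = 1, where n = ⌈√D⌉ ≤ c.
    module _ {D n : ℤ} (D<r : D < p′ * q′) (n-1<√D : (n - 1ℤ) * (n - 1ℤ) < 1ℤ * 1ℤ * D) (0<n : 0ℤ < n) where

      n≤c : n ≤ c
      n≤c = ≤-byContradiction λ c<n → refute
        (0≤-+ (0≤-+ (slack D<r′) (slack< n-1<√D))
          (0≤-+ (slack r≤c²) (0≤-* (slack< c<n) (0≤-+ (slack< c<n) (0≤-+ (ℤ.<⇒≤ 0<c) (ℤ.<⇒≤ 0<c))))))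
        (lem D n c (p′ * q′))
        where
        D<r′ : D ≤ p′ * q′
        D<r′ = ℤ.<⇒≤ D<r
        lem : ∀ D n c r → ((r - D) + (1ℤ * 1ℤ * D - (n - 1ℤ) * (n - 1ℤ) - 1ℤ))
          + ((c * c - r) + (n - c - 1ℤ) * ((n - c - 1ℤ) + (c + c))) ≡ -1ℤ
        lem = solve-∀

      total≤r : + 4 * m * n ≤ p′ * q′
      total≤r = ℤ.≤-trans (unslack (by (0≤-* (0≤-* (nonneg 4) (ℤ.<⇒≤ 0<m)) (slack n≤c)) (lem m n c))) 4mc≤r
        where
        lem : ∀ m n c → + 4 * m * (c - n) ≡ + 4 * m * c - + 4 * m * n
        lem = solve-∀

    -- A nonzero even W has W² ≥ 4, and an odd W forces Y odd, so that p Y² is positive. Both cases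
    -- are covered at once: Y² + W² = 2 `half` is even and positive, hence at least 2.
    parity-bound : ∀ {p W Y e} → 0ℤ < p → Y ≡ W + + 2 * e → W ≢ 0ℤ → p′ * q′ < p * (Y * Y) + p′ * q′ * (W * W)
    parity-bound {p} {W} {Y} {e} 0<p refl W≢0 = unslack<
      (by (0≤-+ (0≤-+ (0≤-* (slack< 0<p) (0≤square Y)) (0≤-* (slack< 0<r) (slack< 0<W²)))
            (0≤-* 0≤2 (slack< 0<half))) (lem p (p′ * q′) W e))
      where
      0<r : 0ℤ < p′ * q′
      0<r = ℤ.≤-<-trans (0≤-* (nonneg 4) (ℤ.<⇒≤ 0<m)) 4m<r
      0<W² : 0ℤ < W * W
      0<W² = 0<square W≢0
      half : ℤ
      half = W * W + + 2 * W * e + + 2 * (e * e)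
      0<half : 0ℤ < half
      0<half = ℤ.≰⇒> λ half≤0 → refute
        (0≤-+ (slack< 0<W²) (0≤-+ (0≤-* 0≤2 (slack half≤0)) (0≤square (W + + 2 * e)))) (lem₁ W e)
        where
        lem₁ : ∀ W e → (W * W - 0ℤ - 1ℤ) + (+ 2 * (0ℤ - (W * W + + 2 * W * e + + 2 * (e * e))) + (W + + 2 * e) *
          (W + + 2 * e)) ≡ -1ℤ
        lem₁ = solve-∀
      lem : ∀ p r W e → ((p - 0ℤ - 1ℤ) * ((W + + 2 * e) * (W + + 2 * e)) + (r - 0ℤ - 1ℤ) * (W * W - 0ℤ - 1ℤ))
        + + 2 * (W * W + + 2 * W * e + + 2 * (e * e) - 0ℤ - 1ℤ)
          ≡ p * ((W + + 2 * e) * (W + + 2 * e)) + r * (W * W) - r - 1ℤ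
      lem = solve-∀
    private
      -- 16 m² ≤ p′ q′ < q′².
      4m<q′ : + 4 * m < q′
      4m<q′ = ℤ.≰⇒> λ q′≤4m → refute
        (0≤-+ (0≤-+ (slack 16m²≤r) (0≤-* (slack q′≤4m) (0≤-+ (0≤-* (nonneg 4) (ℤ.<⇒≤ 0<m)) (ℤ.<⇒≤ 0<q′))))
          (0≤-+ (0≤-* (slack< p′<q′) (ℤ.<⇒≤ 0<q′)) (slack< 0<q′)))
        (lem m p′ q′)
        where
        lem : ∀ m p q → ((p * q - + 16 * (m * m)) + (+ 4 * m - q) * (+ 4 * m + q))
          + ((q - p - 1ℤ) * q + (q - 0ℤ - 1ℤ)) ≡ -1ℤ
        lem = solve-∀

      p<q : g * p′ < g * q′
      p<q = unslack< (by (0≤-+ (slack< 0<g) (0≤-* (ℤ.<⇒≤ 0<g) (slack< p′<q′))) (lem g p′ q′))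
        where
        lem : ∀ g p q → (g - 0ℤ - 1ℤ) + g * (q - p - 1ℤ) ≡ g * q - g * p - 1ℤ
        lem = solve-∀

      0<p : 0ℤ < g * p′
      0<p = unslack< (by (0≤-+ (slack< 0<g) (0≤-* (ℤ.<⇒≤ 0<g) (slack< 0<p′))) (lem g p′))
        where
        lem : ∀ g p → (g - 0ℤ - 1ℤ) + g * (p - 0ℤ - 1ℤ) ≡ g * p - 0ℤ - 1ℤ
        lem = solve-∀

      0≤4 : 0ℤ ≤ + 4
      0≤4 = +≤+ z≤n

      cancel-4 : ∀ {a b} → + 4 * a ≤ + 4 * b → a ≤ b
      cancel-4 = ℤ.*-cancelˡ-≤-pos _ _ (+ 4)

    module First {l} {b n : ℤ} (nonsquare : NonSquare (g * p′)) (admissible : Admissible (g * p′) m b n)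
      (x Y z W e : Fin l → ℤ) (Y≡W : ∀ i → Y i ≡ W i + + 2 * e i)
      (re : sum (λ i → + 4 * (x i * x i) + g * p′ * (Y i * Y i) + (+ 4 * (g * q′ * (z i * z i)) + p′ * q′ *
        (W i * W i))) ≡ + 4 * m * n)
      (im : sum (λ i → + 4 * (x i * Y i) + + 4 * (q′ * (z i * W i))) ≡ + 4 * m * b)
      where

      open Admissible admissible

      private
        -- Since √q √r = q′ √p, the component outside ℚ(√p) satisfies (2 z √q + W √r)² = q′ (`norm`
        -- + `twist` √p). The discriminant needed for the cone is again a square, (4 g z² - p′ W²)².
        norm twist : Fin l → ℤ
        norm i = + 4 * (g * (z i * z i)) + p′ * (W i * W i)
        twist i = + 4 * (z i * W i)

        norm-cone : ∀ i → Cone (g * p′) (norm i) (twist i)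
        norm-cone i = 0≤-+ (0≤-* 0≤4 (0≤-* (ℤ.<⇒≤ 0<g) (0≤square (z i)))) (0≤-* (ℤ.<⇒≤ 0<p′) (0≤square (W i)))
          , unslack (by (0≤square (+ 4 * (g * (z i * z i)) - p′ * (W i * W i))) (lem g p′ (z i) (W i)))
          where
          lem : ∀ g p z W → (+ 4 * (g * (z * z)) - p * (W * W)) * (+ 4 * (g * (z * z)) - p * (W * W))
            ≡ (+ 4 * (g * (z * z)) + p * (W * W)) * (+ 4 * (g * (z * z)) + p * (W * W))
              - + 4 * (z * W) * (+ 4 * (z * W)) * (g * p)
          lem = solve-∀

        re′ : sum (λ i → + 2 * x i * (+ 2 * x i) + g * p′ * (Y i * Y i) + q′ * norm i) ≡ + 4 * m * n
        re′ = trans (sum-cong-≗ (λ i → lem g p′ q′ (x i) (Y i) (z i) (W i))) re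
          where
          lem : ∀ g p q x Y z W → + 2 * x * (+ 2 * x) + g * p * (Y * Y) + q * (+ 4 * (g * (z * z)) + p * (W * W))
            ≡ + 4 * (x * x) + g * p * (Y * Y) + (+ 4 * (g * q * (z * z)) + p * q * (W * W))
          lem = solve-∀

        im′ : sum (λ i → + 2 * (+ 2 * x i * Y i) + q′ * twist i) ≡ + 4 * m * b
        im′ = trans (sum-cong-≗ (λ i → lem q′ (x i) (Y i) (z i) (W i))) im
          where
          lem : ∀ q x Y z W → + 2 * (+ 2 * x * Y) + q * (+ 4 * (z * W)) ≡ + 4 * (x * Y) + + 4 * (q * (z * W))
          lem = solve-∀

        open Representation (g * p′) q′ m n b (ℤ.<⇒≤ 0<p) (ℤ.<⇒≤ 0<q′) (λ i → + 2 * x i) Y norm twist norm-cone re′ im′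

        X² Y² Z² W² : Fin l → ℤ
        X² i = + 4 * (x i * x i)
        Y² i = g * p′ * (Y i * Y i)
        Z² i = + 4 * (g * q′ * (z i * z i))
        W² i = p′ * q′ * (W i * W i)
        term : Fin l → ℤ
        term i = X² i + Y² i + (Z² i + W² i)
        0≤X : ∀ i → 0ℤ ≤ X² i
        0≤X i = 0≤-* 0≤4 (0≤square (x i))
        0≤Y : ∀ i → 0ℤ ≤ Y² i
        0≤Y i = 0≤-* (ℤ.<⇒≤ 0<p) (0≤square (Y i))
        0≤Z : ∀ i → 0ℤ ≤ Z² i
        0≤Z i = 0≤-* 0≤4 (0≤-* (0≤-* (ℤ.<⇒≤ 0<g) (ℤ.<⇒≤ 0<q′)) (0≤square (z i)))
        0≤W : ∀ i → 0ℤ ≤ W² i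
        0≤W i = 0≤-* 0≤r (0≤square (W i))

        norm-small : + 4 * m < p′ * q′ → ∀ z W → 0ℤ < W * W → 0ℤ ≤ + 4 * (g * q′ * (z * z)) →
          q′ * (+ 4 * (g * (z * z)) + p′ * (W * W)) ≤ + 4 * m → ⊥
        norm-small r-large z W 0<W² 0≤Z bound = refute
          (0≤-+ (0≤-+ (slack bound) (slack< r-large)) (0≤-+ 0≤Z (0≤-* 0≤r (slack< 0<W²))))
          (lem m g p′ q′ z W)
          where
          lem : ∀ m g p q z W → ((+ 4 * m - q * (+ 4 * (g * (z * z)) + p * (W * W))) + (p * q - + 4 * m - 1ℤ))
            + (+ 4 * (g * q * (z * z)) + p * q * (W * W - 0ℤ - 1ℤ)) ≡ -1ℤ
          lem = solve-∀

        later : ∀ {k} → FirstBelow (g * p′) k b n → ∀ j → W j ≢ 0ℤ → ⊥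
        later {k} fb j W≢0 = norm-small 4m<r (z j) (W j) (0<square {W j} W≢0) (0≤Z j) small
          where
          twist≤0 : twist j ≤ 0ℤ
          twist≤0 = im-nonpos {k} 0<m nonsquare fb 4m<q′ j
          small : q′ * norm j ≤ + 4 * m
          small = re-bound {k} 0<m nonsquare fb j twist≤0

        at-one : b ≡ 1ℤ → ∀ j → W j ≢ 0ℤ → ⊥
        at-one b≡1 j W≢0 = ℤ.<⇒≱ large (ℤ.≤-trans (ℤ.≤-trans part whole) total)
          where
          large : p′ * q′ < Y² j + W² j
          large = parity-bound {g * p′} {W j} {Y j} {e j} 0<p (Y≡W j) W≢0
          lem : ∀ X Y Z W → X + Z ≡ X + Y + (Z + W) - (Y + W)
          lem = solve-∀
          part : Y² j + W² j ≤ term j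
          part = unslack {Y² j + W² j} {term j} (by (0≤-+ (0≤X j) (0≤Z j)) (lem (X² j) (Y² j) (Z² j) (W² j)))
          whole : term j ≤ sum term
          whole = term≤sum term (λ i → 0≤-+ (0≤-+ (0≤X i) (0≤Y i)) (0≤-+ (0≤Z i) (0≤W i))) j
          n-1<√D : (n - 1ℤ) * (n - 1ℤ) < 1ℤ * 1ℤ * (g * p′)
          n-1<√D = subst (λ b → (n - 1ℤ) * (n - 1ℤ) < b * b * (g * p′)) b≡1 n-1<b√D
          total : sum term ≤ p′ * q′
          total = subst (_≤ p′ * q′) (sym re) (total≤r {g * p′} {n} (ℤ.<-trans p<q q<r) n-1<√D 0<n)

        W≢0⇒⊥ : ∀ j → W j ≢ 0ℤ → ⊥
        W≢0⇒⊥ = [ at-one , (λ (k , _ , _ , fb) → later {k} fb) ]′ first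

        W≡0 : ∀ i → W i ≡ 0ℤ
        W≡0 i = decidable-stable (W i ℤ.≟ 0ℤ) (W≢0⇒⊥ i)

        Y≡2e : ∀ i → Y i ≡ + 2 * e i
        Y≡2e i = trans (Y≡W i) (trans (cong (_+ + 2 * e i) (W≡0 i)) (ℤ.+-identityˡ _))

        -- With W = 0 the zᵢ disappear from the coefficient of √p, while in the rational coordinate
        -- they contribute nonnegative terms that may be dropped. This is why an inequality suffices
        -- here and an equation is kept in `binary-im`.
        binary-re : + 4 * sum (λ i → x i * x i + g * p′ * (e i * e i)) ≤ + 4 * (m * n)
        binary-re = ℤ.≤-trans (ℤ.≤-reflexive (*-distribˡ-sum (+ 4) (λ i → x i * x i + g * p′ * (e i * e i))))
          (ℤ.≤-trans (sum-mono {f = λ i → + 4 * (x i * x i + g * p′ * (e i * e i))} {term} term-bound)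
            (ℤ.≤-reflexive (trans re (ℤ.*-assoc (+ 4) m n))))
          where
          lem : ∀ g p x e Z W →
            Z + W ≡ + 4 * (x * x) + g * p * (+ 2 * e * (+ 2 * e)) + (Z + W) - + 4 * (x * x + g * p * (e * e))
          lem = solve-∀
          pointwise : ∀ i → Z² i + W² i
            ≡ term i - + 4 * (x i * x i + g * p′ * (e i * e i))
          pointwise i = trans (lem g p′ (x i) (e i) (Z² i) (W² i))
            (cong (λ Y → + 4 * (x i * x i) + g * p′ * (Y * Y) + (Z² i + W² i) - + 4 *
              (x i * x i + g * p′ * (e i * e i)))
              (sym (Y≡2e i)))
          term-bound : ∀ i → + 4 * (x i * x i + g * p′ * (e i * e i)) ≤ term i
          term-bound i = unslack {+ 4 * (x i * x i + g * p′ * (e i * e i))} {term i} (by (0≤-+ (0≤Z i) (0≤W i))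
            (pointwise i))

        binary-im : + 4 * (+ 2 * sum (λ i → x i * e i)) ≡ + 4 * (m * b)
        binary-im = trans (lem₁ _) (trans (*-distribˡ-sum (+ 8) (λ i → x i * e i))
          (trans (sum-cong-≗ pointwise) (trans im (ℤ.*-assoc (+ 4) m b))))
          where
          lem₁ : ∀ a → + 4 * (+ 2 * a) ≡ + 8 * a
          lem₁ = solve-∀
          lem : ∀ q x e z → + 8 * (x * e) ≡ + 4 * (x * (+ 2 * e)) + + 4 * (q * (z * 0ℤ))
          lem = solve-∀
          pointwise : ∀ i → + 8 * (x i * e i) ≡ + 4 * (x i * Y i) + + 4 * (q′ * (z i * W i))
          pointwise i = trans (lem q′ (x i) (e i) (z i))
            (cong₂ (λ Y W → + 4 * (x i * Y) + + 4 * (q′ * (z i * W))) (sym (Y≡2e i)) (sym (W≡0 i)))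

      absurd : ⊥
      absurd = binary x e (cancel-4 {sum (λ i → x i * x i + g * p′ * (e i * e i))} {m * n} binary-re)
        (ℤ.*-cancelˡ-≡ (+ 4) (+ 2 * sum (λ i → x i * e i)) (m * b) binary-im)

    -- The half of g Y² + q′ W² is an integer since g, q′ are odd and Y ≡ W mod 2.
    module Second {l} {b n g₁ q₁ : ℤ} (g-odd : g ≡ + 2 * g₁ + 1ℤ) (q′-odd : q′ ≡ + 2 * q₁ + 1ℤ)
      (p-large : (m + + 8) * (m + + 8) ≤ + 4 * (g * p′))
      (nonsquare : NonSquare (g * q′)) (admissible : Admissible (g * q′) m b n)
      (x Y z W e : Fin l → ℤ) (Y≡W : ∀ i → Y i ≡ W i + + 2 * e i)
      (re : sum (λ i → + 4 * (x i * x i) + g * p′ * (Y i * Y i) + (+ 4 * (g * q′ * (z i * z i)) + p′ * q′ *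
        (W i * W i))) ≡ + 4 * m * n)
      (im : sum (λ i → + 8 * (x i * z i) + + 2 * (p′ * (Y i * W i))) ≡ + 4 * m * b)
      where

      open Admissible admissible

      private
        0<q : 0ℤ < g * q′
        0<q = ℤ.<-trans 0<p p<q

        -- Here √p √r = p′ √q, so (Y √p + W √r)² = 2 p′ (`norm` + `twist` √q), where W² + `half` is
        -- (Y² + W²) / 2. Extracting the 2 matters: p′ is the smaller cofactor, and the scale to be
        -- compared with 4 m becomes 2 p′.
        half norm twist : Fin l → ℤ
        half i = + 2 * (W i * e i) + + 2 * (e i * e i)
        norm i = g₁ * (Y i * Y i) + q₁ * (W i * W i) + W i * W i + half i
        twist i = Y i * W i

        double : ∀ i → + 2 * norm i ≡ g * (Y i * Y i) + q′ * (W i * W i)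
        double i = trans (cong (λ Y → + 2 * (g₁ * (Y * Y) + q₁ * (W i * W i) + W i * W i + half i)) (Y≡W i))
          (trans (lem g₁ q₁ (W i) (e i))
            (cong₃′ (sym (Y≡W i)) (sym g-odd) (sym q′-odd)))
          where
          lem : ∀ g₁ q₁ W e → + 2 * (g₁ * ((W + + 2 * e) * (W + + 2 * e)) + q₁ * (W * W) + W * W +
            (+ 2 * (W * e) + + 2 * (e * e)))
            ≡ (+ 2 * g₁ + 1ℤ) * ((W + + 2 * e) * (W + + 2 * e)) + (+ 2 * q₁ + 1ℤ) * (W * W)
          lem = solve-∀
          cong₃′ : ∀ {Y Y′ g g′ q q″} → Y ≡ Y′ → g ≡ g′ → q ≡ q″ →
            g * (Y * Y) + q * (W i * W i) ≡ g′ * (Y′ * Y′) + q″ * (W i * W i)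
          cong₃′ refl refl refl = refl

        norm-cone : ∀ i → Cone (g * q′) (norm i) (twist i)
        norm-cone i = *-cancel-0≤ {+ 2} 0<suc (subst (0ℤ ≤_) (sym (double i)) (0≤-+ 0≤gY 0≤qW))
          , unslack (*-cancel-0≤ {+ 4} 0<suc (by (0≤square (g * (Y i * Y i) - q′ * (W i * W i)))
              (trans (lem₁ g q′ (Y i) (W i)) (trans (cong (λ a →
                a * a - + 4 * (Y i * W i * (Y i * W i) * (g * q′))) (sym (double i)))
                (lem₂ (norm i) (twist i) (g * q′))))))
          where
          0≤gY : 0ℤ ≤ g * (Y i * Y i)
          0≤gY = 0≤-* (ℤ.<⇒≤ 0<g) (0≤square (Y i))
          0≤qW : 0ℤ ≤ q′ * (W i * W i)
          0≤qW = 0≤-* (ℤ.<⇒≤ 0<q′) (0≤square (W i))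
          lem₁ : ∀ g q Y W → (g * (Y * Y) - q * (W * W)) * (g * (Y * Y) - q * (W * W))
            ≡ (g * (Y * Y) + q * (W * W)) * (g * (Y * Y) + q * (W * W)) - + 4 * (Y * W * (Y * W) * (g * q))
          lem₁ = solve-∀
          lem₂ : ∀ N T D → + 2 * N * (+ 2 * N) - + 4 * (T * T * D) ≡ + 4 * (N * N - T * T * D)
          lem₂ = solve-∀

        re′ : sum (λ i → + 2 * x i * (+ 2 * x i) + g * q′ * (+ 2 * z i * (+ 2 * z i)) + + 2 * p′ * norm i) ≡ + 4 * m * n
        re′ = trans (sum-cong-≗ pointwise) re
          where
          lem₁ : ∀ g p q x z N → + 2 * x * (+ 2 * x) + g * q * (+ 2 * z * (+ 2 * z)) + + 2 * p * N
            ≡ + 4 * (x * x) + + 4 * (g * q * (z * z)) + p * (+ 2 * N)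
          lem₁ = solve-∀
          lem₂ : ∀ g p q x Y z W → + 4 * (x * x) + + 4 * (g * q * (z * z)) + p * (g * (Y * Y) + q * (W * W))
            ≡ + 4 * (x * x) + g * p * (Y * Y) + (+ 4 * (g * q * (z * z)) + p * q * (W * W))
          lem₂ = solve-∀
          pointwise : ∀ i → + 2 * x i * (+ 2 * x i) + g * q′ * (+ 2 * z i * (+ 2 * z i)) + + 2 * p′ * norm i
            ≡ + 4 * (x i * x i) + g * p′ * (Y i * Y i) + (+ 4 * (g * q′ * (z i * z i)) + p′ * q′ * (W i * W i))
          pointwise i = trans (lem₁ g p′ q′ (x i) (z i) (norm i))
            (trans (cong (λ a → + 4 * (x i * x i) + + 4 * (g * q′ * (z i * z i)) + p′ * a) (double i))
              (lem₂ g p′ q′ (x i) (Y i) (z i) (W i)))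

        im′ : sum (λ i → + 2 * (+ 2 * x i * (+ 2 * z i)) + + 2 * p′ * twist i) ≡ + 4 * m * b
        im′ = trans (sum-cong-≗ (λ i → lem p′ (x i) (Y i) (z i) (W i))) im
          where
          lem : ∀ p x Y z W → + 2 * (+ 2 * x * (+ 2 * z)) + + 2 * p * (Y * W) ≡ + 8 * (x * z) + + 2 * (p * (Y * W))
          lem = solve-∀

        open Representation (g * q′) (+ 2 * p′) m n b (ℤ.<⇒≤ 0<q) (0≤-* 0≤2 (ℤ.<⇒≤ 0<p′))
          (λ i → + 2 * x i) (λ i → + 2 * z i) norm twist norm-cone re′ im′

        X² Y² Z² W² term : Fin l → ℤ
        X² i = + 4 * (x i * x i)
        Y² i = g * p′ * (Y i * Y i)
        Z² i = + 4 * (g * q′ * (z i * z i))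
        W² i = p′ * q′ * (W i * W i)
        term i = X² i + Y² i + (Z² i + W² i)
        0≤X : ∀ i → 0ℤ ≤ X² i
        0≤X i = 0≤-* 0≤4 (0≤square (x i))
        0≤Y : ∀ i → 0ℤ ≤ Y² i
        0≤Y i = 0≤-* (ℤ.<⇒≤ 0<p) (0≤square (Y i))
        0≤Z : ∀ i → 0ℤ ≤ Z² i
        0≤Z i = 0≤-* 0≤4 (0≤-* (0≤-* (ℤ.<⇒≤ 0<g) (ℤ.<⇒≤ 0<q′)) (0≤square (z i)))
        0≤W : ∀ i → 0ℤ ≤ W² i
        0≤W i = 0≤-* 0≤r (0≤square (W i))

        -- Otherwise q > 4 (k + 4)², so that already b = 1 would satisfy the
        -- condition defining b.
        scale-large : ∀ {k} → m ≡ + 2 * k → 1ℤ < b → FirstBelow (g * q′) k b n → + 4 * m < + 2 * p′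
        scale-large {k} m≡2k 1<b fb = ℤ.≰⇒> λ small → absurd′ (p′≤4k small)
          where
          0<k : 0ℤ < k
          0<k = ℤ.*-cancelˡ-<-nonNeg {0ℤ} {k} (+ 2) (subst (0ℤ <_) m≡2k 0<m)
          0≤k : 0ℤ ≤ k
          0≤k = ℤ.<⇒≤ 0<k
          p′≤4k : + 2 * p′ ≤ + 4 * m → p′ ≤ + 4 * k
          p′≤4k h = unslack (*-cancel-0≤ {+ 2} 0<suc (by (slack h)
            (trans (cong (λ m → + 4 * m - + 2 * p′) m≡2k) (lem p′ k))))
            where
            lem : ∀ p k → + 4 * (+ 2 * k) - + 2 * p ≡ + 2 * (+ 4 * k - p)
            lem = solve-∀
          r-bound : 0ℤ ≤ p′ * q′ - + 64 * (k * k)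
          r-bound = by (slack 16m²≤r) (trans (cong (λ m → p′ * q′ - + 16 * (m * m)) m≡2k) (lem (p′ * q′) k))
            where
            lem : ∀ r k → r - + 16 * (+ 2 * k * (+ 2 * k)) ≡ r - + 64 * (k * k)
            lem = solve-∀
          p-bound : 0ℤ ≤ g * p′ - (k + + 4) * (k + + 4)
          p-bound = *-cancel-0≤ {+ 4} 0<suc (by (slack p-large)
            (trans (cong (λ m → + 4 * (g * p′) - (m + + 8) * (m + + 8)) m≡2k) (lem (g * p′) k)))
            where
            lem : ∀ p k → + 4 * p - (+ 2 * k + + 8) * (+ 2 * k + + 8) ≡ + 4 * (p - (k + + 4) * (k + + 4))
            lem = solve-∀
          found : ∃[ n₁ ] Ceiling (g * q′) 1ℤ n₁
          found = ceiling (ℤ.<⇒≤ 0<q) nonsquare 1ℤ 0<suc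
          n₁ : ℤ
          n₁ = proj₁ found
          above : 1ℤ * (g * q′ + k * k) ≤ + 2 * k * n₁
          above = FirstBelow.minimal fb 1ℤ n₁ 0<suc 1<b (ℤ.<⇒≤ (Ceiling.n-pos (proj₂ found)))
            (Ceiling.upper (proj₂ found))
          -- From q p′² = p r with p′ ≤ 4 k, r ≥ 64 k² and p ≥ (k + 4)².
          q-bound : p′ ≤ + 4 * k → 0ℤ ≤ g * q′ - + 4 * ((k + + 4) * (k + + 4))
          q-bound h = *-cancel-0≤ (0<square {k} (λ k≡0 → ℤ.<-irrefl (sym k≡0) 0<k)) (*-cancel-0≤ {+ 16} 0<suc
            (by (0≤-+ (0≤-* (ℤ.<⇒≤ 0<q) (0≤-* (slack h) (0≤-+ (0≤-* 0≤4 0≤k) (ℤ.<⇒≤ 0<p′))))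
                  (0≤-+ (0≤-* r-bound (ℤ.<⇒≤ 0<p)) (0≤-* (0≤-* (nonneg 64) (0≤square k)) p-bound)))
                (lem g p′ q′ k)))
            where
            lem : ∀ g p q k → g * q * ((+ 4 * k - p) * (+ 4 * k + p))
              + ((p * q - + 64 * (k * k)) * (g * p) + + 64 * (k * k) * (g * p - (k + + 4) * (k + + 4)))
              ≡ + 16 * (k * k * (g * q - + 4 * ((k + + 4) * (k + + 4))))
            lem = solve-∀
          absurd′ : p′ ≤ + 4 * k → ⊥
          absurd′ h = refute
            (0≤-+ (0≤-+ (slack above) (slack< (Ceiling.lower (proj₂ found))))
              (0≤-+ (0≤-* (slack< n₁-large) (0≤-+ (slack< n₁-large) (0≤-+ (0≤-* 0≤2 0≤k) (nonneg 16))))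
                (0≤-+ (0≤square k) (0≤-+ (0≤-* (nonneg 14) 0≤k) (nonneg 64)))))
            (lem (g * q′) k n₁)
            where
            n₁-large : + 2 * (k + + 4) < n₁
            n₁-large = ℤ.≰⇒> λ n₁-small → refute
              (0≤-+ (0≤-+ (q-bound h) (slack< (Ceiling.upper (proj₂ found))))
                (0≤-* (slack n₁-small) (0≤-+ (0≤-* 0≤2 (0≤-+ 0≤k 0≤4)) (ℤ.<⇒≤ (Ceiling.n-pos (proj₂ found))))))
              (lem₁ (g * q′) k n₁)
              where
              lem₁ : ∀ D k x → ((D - + 4 * ((k + + 4) * (k + + 4))) + (x * x - 1ℤ * 1ℤ * D - 1ℤ))
                + (+ 2 * (k + + 4) - x) * (+ 2 * (k + + 4) + x) ≡ -1ℤ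
              lem₁ = solve-∀
            lem : ∀ D k x → ((+ 2 * k * x - 1ℤ * (D + k * k)) + (1ℤ * 1ℤ * D - (x - 1ℤ) * (x - 1ℤ) - 1ℤ))
              + ((x - + 2 * (k + + 4) - 1ℤ) * ((x - + 2 * (k + + 4) - 1ℤ) + (+ 2 * k + + 16))
                + (k * k + (+ 14 * k + + 64))) ≡ -1ℤ
            lem = solve-∀

        later : ∀ {k} → m ≡ + 2 * k → 1ℤ < b → FirstBelow (g * q′) k b n → ∀ j → W j ≢ 0ℤ → ⊥
        later {k} m≡2k 1<b fb j W≢0 = refute
          (0≤-+ (0≤-+ (slack small) (slack< 4m<r)) (0≤-+ (0≤Y j) (0≤-* 0≤r (slack< 0<W²))))
          (trans (cong (λ a → (+ 4 * m - p′ * a + (p′ * q′ - + 4 * m - 1ℤ)) +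
            (Y² j + p′ * q′ * (W j * W j - 0ℤ - 1ℤ))) (double j))
            (lem m g p′ q′ (Y j) (W j)))
          where
          0<W² : 0ℤ < W j * W j
          0<W² = 0<square {W j} W≢0
          small′ : + 2 * p′ * norm j ≤ + 4 * m
          small′ = re-bound {k} 0<m nonsquare fb j (im-nonpos {k} 0<m nonsquare fb (scale-large m≡2k 1<b fb) j)
          lem₁ : ∀ p N → + 2 * p * N ≡ p * (+ 2 * N)
          lem₁ = solve-∀
          small : p′ * (+ 2 * norm j) ≤ + 4 * m
          small = subst (_≤ + 4 * m) (lem₁ p′ (norm j)) small′
          lem : ∀ m g p q Y W → (+ 4 * m - p * (g * (Y * Y) + q * (W * W)) + (p * q - + 4 * m - 1ℤ))
            + (g * p * (Y * Y) + p * q * (W * W - 0ℤ - 1ℤ)) ≡ -1ℤ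
          lem = solve-∀

        at-one : b ≡ 1ℤ → ∀ j → W j ≢ 0ℤ → ⊥
        at-one b≡1 j W≢0 = ℤ.<⇒≱ large (ℤ.≤-trans (ℤ.≤-trans part whole) total)
          where
          large : p′ * q′ < Y² j + W² j
          large = parity-bound {g * p′} {W j} {Y j} {e j} 0<p (Y≡W j) W≢0
          lem : ∀ X Y Z W → X + Z ≡ X + Y + (Z + W) - (Y + W)
          lem = solve-∀
          part : Y² j + W² j ≤ term j
          part = unslack {Y² j + W² j} {term j} (by (0≤-+ (0≤X j) (0≤Z j)) (lem (X² j) (Y² j) (Z² j) (W² j)))
          whole : term j ≤ sum term
          whole = term≤sum term (λ i → 0≤-+ (0≤-+ (0≤X i) (0≤Y i)) (0≤-+ (0≤Z i) (0≤W i))) j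
          n-1<√D : (n - 1ℤ) * (n - 1ℤ) < 1ℤ * 1ℤ * (g * q′)
          n-1<√D = subst (λ b → (n - 1ℤ) * (n - 1ℤ) < b * b * (g * q′)) b≡1 n-1<b√D
          total : sum term ≤ p′ * q′
          total = subst (_≤ p′ * q′) (sym re) (total≤r {g * q′} {n} q<r n-1<√D 0<n)

        W≡0 : ∀ i → W i ≡ 0ℤ
        W≡0 i = decidable-stable (W i ℤ.≟ 0ℤ)
          ([ at-one , (λ (k , m≡2k , 1<b , fb) → later {k} m≡2k 1<b fb) ]′ first i)

        binary-re : + 4 * sum (λ i → x i * x i + g * q′ * (z i * z i)) ≤ + 4 * (m * n)
        binary-re = ℤ.≤-trans (ℤ.≤-reflexive (*-distribˡ-sum (+ 4) (λ i → x i * x i + g * q′ * (z i * z i))))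
          (ℤ.≤-trans (sum-mono {f = λ i → + 4 * (x i * x i + g * q′ * (z i * z i))} {term} term-bound)
            (ℤ.≤-reflexive (trans re (ℤ.*-assoc (+ 4) m n))))
          where
          lem : ∀ D x Y z W → Y + W ≡ + 4 * (x * x) + Y + (+ 4 * (D * (z * z)) + W) - + 4 * (x * x + D * (z * z))
          lem = solve-∀
          term-bound : ∀ i → + 4 * (x i * x i + g * q′ * (z i * z i)) ≤ term i
          term-bound i = unslack {+ 4 * (x i * x i + g * q′ * (z i * z i))} {term i}
            (by (0≤-+ (0≤Y i) (0≤W i)) (lem (g * q′) (x i) (Y² i) (z i) (W² i)))

        binary-im : + 4 * (+ 2 * sum (λ i → x i * z i)) ≡ + 4 * (m * b)
        binary-im = trans (lem₁ (sum (λ i → x i * z i))) (trans (*-distribˡ-sum (+ 8) (λ i → x i * z i))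
          (trans (sum-cong-≗ pointwise) (trans im (ℤ.*-assoc (+ 4) m b))))
          where
          lem₁ : ∀ a → + 4 * (+ 2 * a) ≡ + 8 * a
          lem₁ = solve-∀
          lem : ∀ p x Y z → + 8 * (x * z) ≡ + 8 * (x * z) + + 2 * (p * (Y * 0ℤ))
          lem = solve-∀
          pointwise : ∀ i → + 8 * (x i * z i) ≡ + 8 * (x i * z i) + + 2 * (p′ * (Y i * W i))
          pointwise i = trans (lem p′ (x i) (Y i) (z i))
            (cong (λ W → + 8 * (x i * z i) + + 2 * (p′ * (Y i * W))) (sym (W≡0 i)))

      absurd : ⊥
      absurd = binary x z (cancel-4 {sum (λ i → x i * x i + g * q′ * (z i * z i))} {m * n} binary-re)
        (ℤ.*-cancelˡ-≡ (+ 4) (+ 2 * sum (λ i → x i * z i)) (m * b) binary-im)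

-- Integers among the rationals, and denominators.

module IntegersInRationals where

  open import Data.Rational.Base using (_/_)
  open import Data.Integer.Tactic.RingSolver using (solve-∀)

  ℚ-ring : AlmostCommutativeRing 0ℓ 0ℓ
  ℚ-ring = fromCommutativeRing ℚ.+-*-commutativeRing (λ x → dec⇒maybe (0ℚ ℚ.≟ x))

  ι : ℤ → ℚ
  ι z = z / 1

  intℚ : ℤ → ℚ
  intℚ z = mkℚ z 0 (Coprime.sym (Coprime.1-coprimeTo ℤ.∣ z ∣))

  -- The quotient z / 1 is normalised by a gcd that does not compute for a variable z. `intℚ` is
  -- already in lowest terms, so sums and products of such numbers unfold.
  ι-normal : ∀ z → ι z ≡ intℚ z
  ι-normal z = ℚ.↥p/↧p≡p (intℚ z)

  ι-+ : ∀ a b → ι (a ℤ.+ b) ≡ ι a ℚ.+ ι b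
  ι-+ a b = trans (cong ι (lem a b)) (sym (cong₂ ℚ._+_ (ι-normal a) (ι-normal b)))
    where
    lem : ∀ a b → a ℤ.+ b ≡ a ℤ.* 1ℤ ℤ.+ b ℤ.* 1ℤ
    lem = solve-∀

  ι-* : ∀ a b → ι (a ℤ.* b) ≡ ι a ℚ.* ι b
  ι-* a b = sym (cong₂ ℚ._*_ (ι-normal a) (ι-normal b))

  ι-neg : ∀ a → ι (ℤ.- a) ≡ ℚ.- ι a
  ι-neg a = trans (ι-normal (ℤ.- a)) (trans (lem a) (cong ℚ.-_ (sym (ι-normal a))))
    where
    lem : ∀ a → intℚ (ℤ.- a) ≡ ℚ.- intℚ a
    lem (+ zero)     = refl
    lem ℤ.+[1+ _ ]   = refl
    lem (ℤ.-[1+ _ ]) = refl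

  ι-injective : ∀ {a b} → ι a ≡ ι b → a ≡ b
  ι-injective {a} {b} eq = cong ↥_ (trans (sym (ι-normal a)) (trans eq (ι-normal b)))

  clear-denominator : ∀ h → h ℚ.* ι (↧ h) ≡ ι (↥ h)
  clear-denominator h@record{} = trans (cong (h ℚ.*_) (ι-normal (↧ h))) (trans
    (ℚ.toℚᵘ-injective {_} {intℚ (↥ h)} (ℚᵘ.≃-trans (ℚ.toℚᵘ-homo-* h (intℚ (↧ h))) (*≡* (lem (↥ h) (↧ h)))))
    (sym (ι-normal (↥ h))))
    where
    lem : ∀ u v → u ℤ.* v ℤ.* 1ℤ ≡ u ℤ.* (v ℤ.* 1ℤ)
    lem = solve-∀

  IsInteger : ℚ → Set
  IsInteger h = ∃[ z ] h ≡ ι z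

  IsInteger-+ : ∀ {a b} → IsInteger a → IsInteger b → IsInteger (a ℚ.+ b)
  IsInteger-+ (z , refl) (w , refl) = z ℤ.+ w , sym (ι-+ z w)

  IsInteger-* : ∀ {a b} → IsInteger a → IsInteger b → IsInteger (a ℚ.* b)
  IsInteger-* (z , refl) (w , refl) = z ℤ.* w , sym (ι-* z w)

  IsInteger-neg : ∀ {a} → IsInteger a → IsInteger (ℚ.- a)
  IsInteger-neg (z , refl) = ℤ.- z , sym (ι-neg z)

  unit-denominator : ∀ h → ↧ₙ h ≡ 1 → IsInteger h
  unit-denominator h eq = ↥ h , trans (lem h) (trans (cong (λ v → h ℚ.* ι (+ v)) (sym eq)) (clear-denominator h))
    where
    lem : ∀ h → h ≡ h ℚ.* 1ℚ
    lem h = sym (ℚ.*-identityʳ h)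

  coprime-↥↧ : ∀ h → Coprime (↧ₙ h) ℤ.∣ ↥ h ∣
  coprime-↥↧ (mkℚ _ _ c) = Coprime.sym (Coprime.recompute c)

  coprime-*ʳ : ∀ {a b c} → Coprime a b → Coprime a c → Coprime a (b ℕ.* c)
  coprime-*ʳ {a} {b} {c} ab ac {d} (d∣a , d∣bc) = ac (d∣a , Coprime.coprime-divisor d⊥b d∣bc)
    where
    d⊥b : Coprime d b
    d⊥b (e∣d , e∣b) = ab (ℕ.∣-trans e∣d d∣a , e∣b)

  coprime-^ : ∀ {a b} → Coprime a b → ∀ i j → Coprime (a ℕ.^ i) (b ℕ.^ j)
  coprime-^ {a} {b} a⊥b i zero    = Coprime.sym (Coprime.1-coprimeTo (a ℕ.^ i))
  coprime-^ {a} {b} a⊥b i (suc j) = coprime-*ʳ (Coprime.sym (aux i)) (coprime-^ a⊥b i j)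
    where
    aux : ∀ i → Coprime b (a ℕ.^ i)
    aux zero    = Coprime.sym (Coprime.1-coprimeTo b)
    aux (suc i) = coprime-*ʳ (Coprime.sym a⊥b) (aux i)

  j<v^j : ∀ {v} → 1 ℕ.< v → ∀ j → j ℕ.< v ℕ.^ j
  j<v^j 1<v zero = s≤s z≤n
  j<v^j {v} 1<v (suc j) = ℕ.≤-trans (s≤s (j<v^j 1<v j)) (ℕ.≤-trans (ℕ.m<m+n (v ℕ.^ j) 0<v^j)
    (ℕ.≤-trans (ℕ.≤-reflexive (cong (v ℕ.^ j ℕ.+_) (sym (ℕ.+-identityʳ _)))) (ℕ.*-monoˡ-≤ (v ℕ.^ j) 1<v)))
    where
    0<v^j : 0 ℕ.< v ℕ.^ j
    0<v^j = ℕ.≤-<-trans z≤n (j<v^j 1<v j)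

  -- The powers of h have a common denominator M only if the denominator of h
  -- is 1, since all of its powers divide M.
  bounded-powers⇒int : ∀ h M (f : ℕ → ℚ) → f 0 ≡ 1ℚ → (∀ j → f (suc j) ≡ h ℚ.* f j) →
    (∀ j → IsInteger (ι (+ suc M) ℚ.* f j)) → IsInteger h
  bounded-powers⇒int h M f f0 fs bounded = unit-denominator h (v≡1 (↧ₙ h) refl)
    where
    u v : ℤ
    u = ↥ h
    v = ↧ h
    power : ∀ j → f j ℚ.* ι (v ℤ.^ j) ≡ ι (u ℤ.^ j)
    power zero    = trans (cong (ℚ._* 1ℚ) f0) refl
    power (suc j) = trans (cong₂ ℚ._*_ (fs j) (ι-* v (v ℤ.^ j))) (trans (lem h (f j) (ι v) (ι (v ℤ.^ j)))
      (trans (cong₂ ℚ._*_ (clear-denominator h) (power j)) (sym (ι-* u (u ℤ.^ j)))))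
      where
      lem : ∀ h f v w → h ℚ.* f ℚ.* (v ℚ.* w) ≡ h ℚ.* v ℚ.* (f ℚ.* w)
      lem = Solver.solve-∀ ℚ-ring
    abs-^ : ∀ a j → ℤ.∣ a ℤ.^ j ∣ ≡ ℤ.∣ a ∣ ℕ.^ j
    abs-^ a zero    = refl
    abs-^ a (suc j) = trans (ℤ.abs-* a (a ℤ.^ j)) (cong (ℤ.∣ a ∣ ℕ.*_) (abs-^ a j))
    divides : ∀ j → ↧ₙ h ℕ.^ j ℕ.∣ suc M
    divides j with bounded j
    ... | z , eq = Coprime.coprime-divisor (coprime-^ (coprime-↥↧ h) j j)
      (ℕ.divides ℤ.∣ z ∣ (trans (ℕ.*-comm (ℤ.∣ u ∣ ℕ.^ j) (suc M)) (trans (cong (suc M ℕ.*_) (sym (abs-^ u j)))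
        (trans (sym (ℤ.abs-* (+ suc M) (u ℤ.^ j))) (trans (cong ℤ.∣_∣ (sym zv≡Mu))
          (trans (ℤ.abs-* z (v ℤ.^ j)) (cong (ℤ.∣ z ∣ ℕ.*_) (abs-^ v j))))))))
      where
      zv≡Mu : z ℤ.* v ℤ.^ j ≡ + suc M ℤ.* u ℤ.^ j
      zv≡Mu = ι-injective (trans (ι-* z (v ℤ.^ j)) (trans (cong (ℚ._* ι (v ℤ.^ j)) (sym eq))
        (trans (ℚ.*-assoc (ι (+ suc M)) (f j) (ι (v ℤ.^ j))) (trans (cong (ι (+ suc M) ℚ.*_) (power j))
          (sym (ι-* (+ suc M) (u ℤ.^ j)))))))
    v≡1 : ∀ v → ↧ₙ h ≡ v → v ≡ 1
    v≡1 zero          ()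
    v≡1 (suc zero)    _  = refl
    -- For v ≥ 2 the power v^(M + 1) exceeds M + 1, which it would have to divide.
    v≡1 v@(suc (suc _)) eq = ⊥-elim (ℕ.<⇒≱ (j<v^j {v} (s≤s (s≤s z≤n)) (suc M))
      (ℕ.∣⇒≤ (subst (λ v → v ℕ.^ suc M ℕ.∣ suc M) eq (divides (suc M)))))

-- Integrality in ℚ(√D) for D ≡ 2, 3 mod 4.

module QuadraticIntegers where

  open import Data.Integer.Base hiding (suc)
  open import Data.Integer.Tactic.RingSolver using (solve-∀)
  open Integers
  open IntegersInRationals

  -- For h = u / v in lowest terms v² divides D u², hence D.
  squarefree⇒int : ∀ {D} → SquareFree D → ∀ h → IsInteger (ι (+ D) ℚ.* (h ℚ.* h)) → IsInteger h
  squarefree⇒int {D} squarefree h (z , eq) = unit-denominator h (squarefree (↧ₙ h) (Coprime.coprime-divisor coprime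
    (ℕ.divides ℤ.∣ z ∣ (trans (ℕ.*-comm (ℤ.∣ u ∣ ℕ.* ℤ.∣ u ∣) D) (trans (cong (D ℕ.*_) (sym (ℤ.abs-* u u)))
      (trans (sym (ℤ.abs-* (+ D) (u * u))) (trans (cong ℤ.∣_∣ (sym zv²≡Du²))
        (trans (ℤ.abs-* z (v * v)) (cong (ℤ.∣ z ∣ ℕ.*_) (ℤ.abs-* v v))))))))))
    where
    u v : ℤ
    u = ↥ h
    v = ↧ h
    coprime : Coprime (↧ₙ h ℕ.* ↧ₙ h) (ℤ.∣ u ∣ ℕ.* ℤ.∣ u ∣)
    coprime = subst₂ Coprime (lem (↧ₙ h)) (lem ℤ.∣ u ∣) (coprime-^ (coprime-↥↧ h) 2 2)
      where
      lem : ∀ a → a ℕ.^ 2 ≡ a ℕ.* a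
      lem a = cong (a ℕ.*_) (ℕ.*-identityʳ a)
    zv²≡Du² : z * (v * v) ≡ + D * (u * u)
    zv²≡Du² = ι-injective (trans (ι-* z (v * v)) (trans (cong₂ ℚ._*_ (sym eq) (ι-* v v))
      (trans (lem (ι (+ D)) h (ι v))
        (trans (cong (ι (+ D) ℚ.*_) (trans (cong₂ ℚ._*_ (clear-denominator h) (clear-denominator h)) (sym (ι-* u u))))
        (sym (ι-* (+ D) (u * u)))))))
      where
      lem : ∀ D h v → D ℚ.* (h ℚ.* h) ℚ.* (v ℚ.* v) ≡ D ℚ.* ((h ℚ.* v) ℚ.* (h ℚ.* v))
      lem = Solver.solve-∀ ℚ-ring

  TwoOrThreeMod4 : ℤ → Set
  TwoOrThreeMod4 D = ∃[ d ] (D ≡ + 4 * d + + 2 ⊎ D ≡ + 4 * d + + 3)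

  mod-4 : ∀ {D} r → D ℕ.% 4 ≡ r → ∃[ d ] + D ≡ + 4 * d + + r
  mod-4 {D} r eq = + (D ℕ./ 4) , trans (cong +_ (trans (ℕ.m≡m%n+[m/n]*n D 4) (cong (ℕ._+ D ℕ./ 4 ℕ.* 4) eq)))
    (trans (cong (λ a → + r + a) (ℤ.pos-* (D ℕ./ 4) 4)) (lem (+ r) (+ (D ℕ./ 4))))
    where
    lem : ∀ r d → r + d * + 4 ≡ + 4 * d + r
    lem = solve-∀

  4*x≢ : ∀ x c → + 4 * x ≡ c → .{{_ : ℕ.NonZero ∣ c ∣}} → 4 ℕ.≤ ∣ c ∣
  4*x≢ x c refl = ℕ.∣⇒≤ (ℕ.divides ∣ x ∣ (trans (ℤ.abs-* (+ 4) x) (ℕ.*-comm 4 ∣ x ∣)))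

  not-4* : ∀ {E w} K c → E ≡ + 4 * w → E - + 4 * K ≡ c → .{{_ : ℕ.NonZero ∣ c ∣}} → ∣ c ∣ ℕ.< 4 → ⊥
  not-4* {E} {w} K c eq eq′ c<4 =
    ℕ.<⇒≱ c<4 (4*x≢ (w - K) c (trans (lem w K) (trans (cong (λ a → a - + 4 * K) (sym eq)) eq′)))
    where
    lem : ∀ w K → + 4 * (w - K) ≡ + 4 * w - + 4 * K
    lem = solve-∀

  -- Squares are 0 or 1 mod 4, and for D ≡ 2, 3 the form a² - D b² is 0 mod 4 only at even
  -- arguments. This yields both the irrationality of √D, by descent, and the absence of
  -- half-integers in the ring of integers.
  both-even : ∀ {D a b w} → TwoOrThreeMod4 D → a * a - D * (b * b) ≡ + 4 * w →
    (∃[ k ] a ≡ + 2 * k) × (∃[ k ] b ≡ + 2 * k)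
  both-even {D} {a} {b} {w} D23 eq = cases D23 (even-or-odd a) (even-or-odd b) eq
    where
    cases : ∀ {D a b} → TwoOrThreeMod4 D → (∃[ k ] a ≡ + 2 * k) ⊎ (∃[ k ] a ≡ + 2 * k + 1ℤ) →
      (∃[ k ] b ≡ + 2 * k) ⊎ (∃[ k ] b ≡ + 2 * k + 1ℤ) → a * a - D * (b * b) ≡ + 4 * w →
      (∃[ k ] a ≡ + 2 * k) × (∃[ k ] b ≡ + 2 * k)
    cases _ (inj₁ x) (inj₁ y) _ = x , y
    cases {D} _ (inj₂ (x , refl)) (inj₁ (y , refl)) eq =
      ⊥-elim (not-4* (x * x + x - D * (y * y)) 1ℤ eq (lem D x y) (s≤s (s≤s z≤n)))
      where
      lem : ∀ D x y → (+ 2 * x + 1ℤ) * (+ 2 * x + 1ℤ) - D * (+ 2 * y * (+ 2 * y)) - + 4 * (x * x + x - D * (y * y)) ≡ 1ℤ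
      lem = solve-∀
    cases (d , inj₁ refl) (inj₁ (x , refl)) (inj₂ (y , refl)) eq =
      ⊥-elim (not-4* (x * x - d * ((+ 2 * y + 1ℤ) * (+ 2 * y + 1ℤ)) - + 2 * (y * y + y)) (- + 2) eq (lem d x y)
        (s≤s (s≤s (s≤s z≤n))))
      where
      lem : ∀ d x y → + 2 * x * (+ 2 * x) - (+ 4 * d + + 2) * ((+ 2 * y + 1ℤ) * (+ 2 * y + 1ℤ))
        - + 4 * (x * x - d * ((+ 2 * y + 1ℤ) * (+ 2 * y + 1ℤ)) - + 2 * (y * y + y)) ≡ - + 2
      lem = solve-∀
    cases (d , inj₂ refl) (inj₁ (x , refl)) (inj₂ (y , refl)) eq =
      ⊥-elim (not-4* (x * x - d * ((+ 2 * y + 1ℤ) * (+ 2 * y + 1ℤ)) - + 3 * (y * y + y)) (- + 3) eq (lem d x y)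
        (s≤s (s≤s (s≤s (s≤s z≤n)))))
      where
      lem : ∀ d x y → + 2 * x * (+ 2 * x) - (+ 4 * d + + 3) * ((+ 2 * y + 1ℤ) * (+ 2 * y + 1ℤ))
        - + 4 * (x * x - d * ((+ 2 * y + 1ℤ) * (+ 2 * y + 1ℤ)) - + 3 * (y * y + y)) ≡ - + 3
      lem = solve-∀
    cases (d , inj₁ refl) (inj₂ (x , refl)) (inj₂ (y , refl)) eq =
      ⊥-elim (not-4* (x * x + x - d * ((+ 2 * y + 1ℤ) * (+ 2 * y + 1ℤ)) - + 2 * (y * y + y)) (- + 1) eq
        (lem d x y) (s≤s (s≤s z≤n)))
      where
      lem : ∀ d x y → (+ 2 * x + 1ℤ) * (+ 2 * x + 1ℤ) - (+ 4 * d + + 2) * ((+ 2 * y + 1ℤ) * (+ 2 * y + 1ℤ))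
        - + 4 * (x * x + x - d * ((+ 2 * y + 1ℤ) * (+ 2 * y + 1ℤ)) - + 2 * (y * y + y)) ≡ - + 1
      lem = solve-∀
    cases (d , inj₂ refl) (inj₂ (x , refl)) (inj₂ (y , refl)) eq =
      ⊥-elim (not-4* (x * x + x - d * ((+ 2 * y + 1ℤ) * (+ 2 * y + 1ℤ)) - + 3 * (y * y + y)) (- + 2) eq
        (lem d x y) (s≤s (s≤s (s≤s z≤n))))
      where
      lem : ∀ d x y → (+ 2 * x + 1ℤ) * (+ 2 * x + 1ℤ) - (+ 4 * d + + 3) * ((+ 2 * y + 1ℤ) * (+ 2 * y + 1ℤ))
        - + 4 * (x * x + x - d * ((+ 2 * y + 1ℤ) * (+ 2 * y + 1ℤ)) - + 3 * (y * y + y)) ≡ - + 2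
      lem = solve-∀

  -- Infinite descent: a solution of β² D = N² has both entries even, and halving gives a smaller
  -- one. The natural number n bounding β is the measure.
  nonsquare : ∀ {D} → TwoOrThreeMod4 D → NonSquare D
  nonsquare {D} D23 (+ n) N 0<β eq = descend n N (+ n) ℤ.≤-refl 0<β eq
    where
    descend : ∀ n N β → β ≤ + n → 0ℤ < β → β * β * D ≢ N * N
    descend zero    N β β≤n 0<β eq = ℤ.<⇒≱ 0<β β≤n
    descend (suc n) N β β≤n 0<β eq with both-even {D} {N} {β} {0ℤ} D23 (trans (cong (_- D * (β * β)) (sym eq))
      (lem D β))
      where
      lem : ∀ D β → β * β * D - D * (β * β) ≡ + 4 * 0ℤ
      lem = solve-∀
    ... | (N′ , refl) , (β′ , refl) = descend n N′ β′ β′≤n 0<β′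
      (ℤ.*-cancelˡ-≡ (+ 4) _ _ (trans (lem₁ D β′) (trans eq (lem₂ N′))))
      where
      lem₁ : ∀ D β → + 4 * (β * β * D) ≡ + 2 * β * (+ 2 * β) * D
      lem₁ = solve-∀
      lem₂ : ∀ N → + 2 * N * (+ 2 * N) ≡ + 4 * (N * N)
      lem₂ = solve-∀
      lem₃ : ∀ n β → (1ℤ + n - + 2 * β) + (β - 0ℤ - 1ℤ) ≡ n - β
      lem₃ = solve-∀
      0<β′ : 0ℤ < β′
      0<β′ = ℤ.*-cancelˡ-<-nonNeg {0ℤ} {β′} (+ 2) 0<β
      β′≤n : β′ ≤ + n
      β′≤n = unslack (by (0≤-+ (slack β≤n) (slack< 0<β′)) (lem₃ (+ n) β′))
  nonsquare D23 -[1+ _ ] N ()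

  -- Trace and norm suffice: D (2 t)² = (2 s)² - 4 (s² - D t²) is an integer, so 2 t is one as D is
  -- square-free, and `both-even` removes the factor 2 from 2 s and 2 t.
  quadratic-integer : ∀ {D} → SquareFree D → TwoOrThreeMod4 (+ D) → ∀ s t →
    IsInteger (ι (+ 2) ℚ.* s) → IsInteger (s ℚ.* s ℚ.- ι (+ D) ℚ.* (t ℚ.* t)) → IsInteger s × IsInteger t
  quadratic-integer {D} squarefree D23 s t (a , a≡) (w , w≡) = halve a≡ (proj₁ evens) , halve b≡ (proj₂ evens)
    where
    2t-int : IsInteger (ι (+ 2) ℚ.* t)
    2t-int = squarefree⇒int squarefree (ι (+ 2) ℚ.* t)
      (subst IsInteger (lem (ι (+ D)) (ι (+ 2)) s t) (IsInteger-+ (IsInteger-* (a , a≡) (a , a≡))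
        (IsInteger-neg (IsInteger-* (IsInteger-* (+ 2 , refl) (+ 2 , refl)) (w , w≡)))))
      where
      lem : ∀ D k s t → k ℚ.* s ℚ.* (k ℚ.* s) ℚ.+ (ℚ.- (k ℚ.* k ℚ.* (s ℚ.* s ℚ.- D ℚ.* (t ℚ.* t))))
        ≡ D ℚ.* (k ℚ.* t ℚ.* (k ℚ.* t))
      lem = Solver.solve-∀ ℚ-ring
    b : ℤ
    b = proj₁ 2t-int
    b≡ : ι (+ 2) ℚ.* t ≡ ι b
    b≡ = proj₂ 2t-int
    relation : a * a - + D * (b * b) ≡ + 4 * w
    relation = ι-injective (trans (ι-+ (a * a) (- (+ D * (b * b))))
      (trans (cong₂ ℚ._+_ (ι-* a a) (trans (ι-neg (+ D * (b * b)))
      (cong ℚ.-_ (trans (ι-* (+ D) (b * b)) (cong (ι (+ D) ℚ.*_) (ι-* b b))))))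
      (trans (cong₂ (λ a b → a ℚ.* a ℚ.+ (ℚ.- (ι (+ D) ℚ.* (b ℚ.* b)))) (sym a≡) (sym b≡))
        (trans (lem (ι (+ D)) (ι (+ 2)) s t) (trans (cong₂ ℚ._*_ (sym (ι-* (+ 2) (+ 2))) w≡) (sym (ι-* (+ 4) w)))))))
      where
      lem : ∀ D k s t → k ℚ.* s ℚ.* (k ℚ.* s) ℚ.+ (ℚ.- (D ℚ.* (k ℚ.* t ℚ.* (k ℚ.* t))))
        ≡ k ℚ.* k ℚ.* (s ℚ.* s ℚ.- D ℚ.* (t ℚ.* t))
      lem = Solver.solve-∀ ℚ-ring
    evens : (∃[ k ] a ≡ + 2 * k) × (∃[ k ] b ≡ + 2 * k)
    evens = both-even {+ D} {a} {b} {w} D23 relation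
    cancel-2 : ∀ h → ℚ.½ ℚ.* (ι (+ 2) ℚ.* h) ≡ h
    cancel-2 h = trans (sym (ℚ.*-assoc ℚ.½ (ι (+ 2)) h)) (ℚ.*-identityˡ h)
    halve : ∀ {h a} → ι (+ 2) ℚ.* h ≡ ι a → (∃[ k ] a ≡ + 2 * k) → IsInteger h
    halve {h} eq (k , refl) =
      k , trans (sym (cancel-2 h)) (trans (cong (ℚ.½ ℚ.*_) (trans eq (ι-* (+ 2) k))) (cancel-2 (ι k)))

-- An element is almost integral over a subring L when its powers have a common
-- denominator.  Unlike integrality, this passes to sums and products without
-- any elimination theory, and it still forces rational numbers to be integers.
module AlmostIntegral (R : CommutativeRing 0ℓ 0ℓ) where

  open CommutativeRing R hiding (zero) renaming (refl to ≈-refl; sym to ≈-sym; trans to ≈-trans)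

  record IsSubring (L : Carrier → Set) : Set where
    field
      L-resp : ∀ {x y} → x ≈ y → L x → L y
      L-1    : L 1#
      L-+    : ∀ {x y} → L x → L y → L (x + y)
      L-*    : ∀ {x y} → L x → L y → L (x * y)
      L-neg  : ∀ {x} → L x → L (- x)

  module Over {L : Carrier → Set} (subring : IsSubring L) where

    open IsSubring subring
    open RawSemiringOps (RawRing.rawSemiring rawRing) using (_^_; sum) renaming (_×_ to _·_)
    open SemiringSolver commutativeSemiring
    open SemiringExp semiring using (^-homo-*)
    open CommutativeSemiringExp commutativeSemiring using (^-distrib-*)
    open SemiringMult semiring using (×1-homo-*)

    L-0 : L 0#
    L-0 = L-resp (-‿inverseʳ 1#) (L-+ L-1 (L-neg L-1))

    L-· : ∀ n → L (n · 1#)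
    L-· zero    = L-0
    L-· (suc n) = L-+ L-1 (L-· n)

    L-fromℤ : ∀ z → L (fromℤ R z)
    L-fromℤ (+ n)    = L-· n
    L-fromℤ -[1+ n ] = L-neg (L-· (suc n))

    L-^ : ∀ {x} → L x → ∀ n → L (x ^ n)
    L-^ Lx zero    = L-1
    L-^ Lx (suc n) = L-* Lx (L-^ Lx n)

    IsScalar : Carrier → Set
    IsScalar s = ∃[ N ] s ≈ suc N · 1#

    scalar-L : ∀ {s} → IsScalar s → L s
    scalar-L (N , eq) = L-resp (≈-sym eq) (L-· (suc N))

    scalar-* : ∀ {s t} → IsScalar s → IsScalar t → IsScalar (s * t)
    scalar-* (M , eq) (N , eq′) = N ℕ.+ M ℕ.* suc N , ≈-trans (*-cong eq eq′) (≈-sym (×1-homo-* (suc M) (suc N)))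

    scalar-^ : ∀ {s} → IsScalar s → ∀ n → IsScalar (s ^ n)
    scalar-^ s zero    = 0 , ≈-sym (+-identityʳ 1#)
    scalar-^ s (suc n) = scalar-* s (scalar-^ s n)

    IsAlmostIntegral : Carrier → Set
    IsAlmostIntegral x = ∃[ s ] (IsScalar s × (∀ j → L (s * x ^ j)))

    almost-* : ∀ {x y} → IsAlmostIntegral x → IsAlmostIntegral y → IsAlmostIntegral (x * y)
    almost-* {x} {y} (s , ss , f) (t , tt , g) = s * t , scalar-* ss tt , λ j →
      L-resp (≈-trans (solve 4 (λ s t a b → (s :* a) :* (t :* b) := (s :* t) :* (a :* b)) ≈-refl s t (x ^ j) (y ^ j))
                    (*-congˡ (≈-sym (^-distrib-* x y j)))) (L-* (f j) (g j))

    almost-+ : ∀ {x y} → IsAlmostIntegral x → IsAlmostIntegral y → IsAlmostIntegral (x + y)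
    almost-+ {x} {y} (s , ss , f) (t , tt , g) = s * t , scalar-* ss tt , λ l →
      L-resp (*-congˡ (≈-trans (*-congʳ (*-identityˡ 1#)) (*-identityˡ _))) (mixed l 0 0)
      where
      -- The extra factor xⁱ yʲ makes the induction on l work in place of the binomial theorem:
      -- splitting off one x + y raises either i or j.
      mixed : ∀ l i j → L (s * t * (x ^ i * y ^ j * (x + y) ^ l))
      mixed zero    i j = L-resp (solve 4 (λ s t a b →
        (s :* a) :* (t :* b) := (s :* t) :* (a :* b :* con 1)) ≈-refl s t (x ^ i) (y ^ j))
        (L-* (f i) (g j))
      mixed (suc l) i j = L-resp
        (solve 7 (λ s t x y a b c →
          (s :* t) :* ((x :* a) :* b :* c) :+ (s :* t) :* (a :* (y :* b) :* c) := (s :* t) :*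
          (a :* b :* ((x :+ y) :* c)))
          ≈-refl s t x y (x ^ i) (y ^ j) ((x + y) ^ l))
        (L-+ (mixed l (suc i) j) (mixed l i (suc j)))

    almost-resp : ∀ {x y} → x ≈ y → IsAlmostIntegral x → IsAlmostIntegral y
    almost-resp {x} {y} x≈y (s , ss , f) = s , ss , λ j → L-resp (*-congˡ (^-cong j)) (f j)
      where
      ^-cong : ∀ j → x ^ j ≈ y ^ j
      ^-cong zero    = ≈-refl
      ^-cong (suc j) = *-cong x≈y (^-cong j)

    almost-image : ∀ (τ : Carrier → Carrier) → (∀ {x y} → x ≈ y → τ x ≈ τ y) → τ 1# ≈ 1# → τ 0# ≈ 0# →
      (∀ x y → τ (x + y) ≈ τ x + τ y) → (∀ x y → τ (x * y) ≈ τ x * τ y) → (∀ {x} → L x → L (τ x)) →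
      ∀ {x} → IsAlmostIntegral x → IsAlmostIntegral (τ x)
    almost-image τ τ-cong τ-1 τ-0 τ-+ τ-* τ-L {x} (s , (N , eq) , f) = s , (N , eq) , λ j →
      L-resp (≈-trans (τ-* s (x ^ j)) (*-cong (≈-trans (τ-cong eq) (≈-trans (τ-· (suc N)) (≈-sym eq))) (τ-^ j)))
        (τ-L (f j))
      where
      τ-· : ∀ n → τ (n · 1#) ≈ n · 1#
      τ-· zero    = τ-0
      τ-· (suc n) = ≈-trans (τ-+ 1# (n · 1#)) (+-cong τ-1 (τ-· n))
      τ-^ : ∀ j → τ (x ^ j) ≈ τ x ^ j
      τ-^ zero    = τ-1
      τ-^ (suc j) = ≈-trans (τ-* x (x ^ j)) (*-congˡ (τ-^ j))

    module _ (denominator : ∀ x → ∃[ s ] (IsScalar s × L (s * x))) where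

      -- If s x lies in L, then s^d clears the denominators of all powers: up to x^d because s^d xⁱ
      -- = s^(d - i) (s x)ⁱ, and beyond because the monic equation expresses x^d through lower
      -- powers with coefficients in L.
      integral⇒almost : ∀ {x} → IsIntegral R x → IsAlmostIntegral x
      integral⇒almost {x} (d , a , root) = s ^ d , scalar-^ ss d , λ j →
        subst (λ i → L (s ^ d * x ^ i)) (ℕ.+-identityʳ j) (step j 0 z≤n)
        where
        s : Carrier
        s = proj₁ (denominator x)
        ss : IsScalar s
        ss = proj₁ (proj₂ (denominator x))
        L-sx : L (s * x)
        L-sx = proj₂ (proj₂ (denominator x))
        tail : Carrier
        tail = sum (λ i → fromℤ R (a i) * x ^ toℕ i)
        x^d : x ^ d ≈ - tail
        x^d = ≈-trans (≈-sym (+-identityʳ _)) (≈-trans (+-congˡ (≈-sym (-‿inverseʳ tail)))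
          (≈-trans (≈-sym (+-assoc _ _ _))
          (≈-trans (+-congʳ root) (+-identityˡ _))))
        L-sum : ∀ c {n} (f : Fin n → Carrier) → (∀ i → L (c * f i)) → L (c * sum f)
        L-sum c {zero}  f h = L-resp (≈-sym (zeroʳ c)) L-0
        L-sum c {suc n} f h = L-resp (≈-sym (distribˡ c _ _)) (L-+ (h zero) (L-sum c (λ i → f (suc i)) (λ i →
          h (suc i))))
        -- The exponent is split as j + i with i ≤ d so that the recursion is structural in j: for i
        -- < d a unit moves from j to i, and at i = d the equation is applied, whose terms have
        -- exponents j + (i + 1) with i < d.
        step : ∀ j i → i ℕ.≤ d → L (s ^ d * x ^ (j ℕ.+ i))
        step zero i i≤d = L-resp
          (≈-trans (*-congˡ (^-distrib-* s x i)) (≈-trans (solve 3 (λ u v w →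
            u :* (v :* w) := (v :* u) :* w) ≈-refl (s ^ (d ℕ.∸ i)) (s ^ i) (x ^ i))
            (*-congʳ (≈-trans (≈-sym (^-homo-* s i (d ℕ.∸ i))) (reflexive (cong (s ^_) (ℕ.m+[n∸m]≡n i≤d)))))))
          (L-* (L-^ (scalar-L ss) (d ℕ.∸ i)) (L-^ L-sx i))
        step (suc j) i i≤d = [ (λ i<d → subst (λ k → L (s ^ d * x ^ k)) (ℕ.+-suc j i) (step j (suc i) i<d))
                             , (λ i≡d → subst (λ i →
                               L (s ^ d * x ^ (suc j ℕ.+ i))) (sym i≡d) top) ]′ (ℕ.m≤n⇒m<n∨m≡n i≤d)
          where
          c : Carrier
          c = s ^ d * x ^ suc j
          open RingProperties ring using (-‿distribʳ-*)
          top : L (s ^ d * x ^ (suc j ℕ.+ d))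
          top = L-resp (≈-trans (-‿distribʳ-* c tail) (≈-trans (*-congˡ (≈-sym x^d)) (≈-trans (*-assoc _ _ _)
            (*-congˡ (≈-sym (^-homo-* x (suc j) d))))))
            (L-neg (L-sum c (λ i → fromℤ R (a i) * x ^ toℕ i) (λ i → L-resp
              (≈-trans (solve 4 (λ u v w z →
                w :* (u :* (v :* z)) := (u :* v) :* (w :* z)) ≈-refl (s ^ d) (x ^ suc j) (fromℤ R (a i)) (x ^ toℕ i))
                ≈-refl)
              (L-* (L-fromℤ (a i)) (L-resp (*-congˡ (^-homo-* x (suc j) (toℕ i)))
                (subst (λ k → L (s ^ d * x ^ k)) (ℕ.+-suc j (toℕ i)) (step j (suc (toℕ i)) (toℕ<n i))))))))

-- The biquadratic field K and the coordinates of its integers.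

module NumberFields where

  open import Data.Rational.Base using (0ℚ; 1ℚ; ½; _/_; _⊓_; _+_; _*_; -_; _-_; _≤_; _<_; ∣_∣)
  open import Tactic.RingSolver using (solve-∀)
  open import Data.Integer.Tactic.RingSolver using () renaming (solve-∀ to ℤsolve-∀)
  open import Data.Nat.Tactic.RingSolver using () renaming (solve-∀ to ℕsolve-∀)
  open SemiringSum (CommutativeRing.semiring ℤ.+-*-commutativeRing) using (sum)
  open Integers using (even-or-odd; even≢odd; NonSquare; Admissible; admissible; module Core)
  open IntegersInRationals
  open QuadraticIntegers

  open RawSemiringOps (RawRing.rawSemiring (CommutativeRing.rawRing ℚ.+-*-commutativeRing)) using () renaming
    (_×_ to _·ℚ_)

  ·1≡ι : ∀ n → n ·ℚ 1ℚ ≡ ι (+ n)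
  ·1≡ι zero    = refl
  ·1≡ι (suc n) = trans (cong (λ a → 1ℚ + a) (·1≡ι n)) (sym (ι-+ (+ 1) (+ n)))

  module Quadratic (n : ℕ) where

    F : CommutativeRing 0ℓ 0ℓ
    F = ℚ⟨√ n ⟩

    open RawSemiringOps (RawRing.rawSemiring (CommutativeRing.rawRing F)) using () renaming (_×_ to _·F_) public

    ·F1 : ∀ n → re (n ·F (1ℚ +√ 0ℚ)) ≡ ι (+ n) × im (n ·F (1ℚ +√ 0ℚ)) ≡ 0ℚ
    ·F1 zero    = refl , refl
    ·F1 (suc n) = trans (cong (λ a → 1ℚ + a) (proj₁ (·F1 n))) (sym (ι-+ (+ 1) (+ n))) , trans (cong (λ a →
      0ℚ + a) (proj₂ (·F1 n))) refl

  module Field (p q : ℕ) where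

    open Quadratic p

    K : CommutativeRing 0ℓ 0ℓ
    K = ℚ⟨√ p ,√ q ⟩

    module K = CommutativeRing K
    open RawSemiringOps (RawRing.rawSemiring K.rawRing) using () renaming (_×_ to _·K_; _^_ to _^K_)

    P Q : ℚ
    P = ι (+ p)
    Q = ι (+ q)

    pattern ⟪_,_,_,_⟫ a b c d = (a +√ b) +√ (c +√ d)

    ·K1 : ∀ n → (n ·K K.1#) K.≈ ⟪ ι (+ n) , 0ℚ , 0ℚ , 0ℚ ⟫
    ·K1 zero    = (refl , refl) , (refl , refl)
    ·K1 (suc n) = let (e₁ , e₂) , (e₃ , e₄) = ·K1 n in
      (trans (cong (λ a → 1ℚ + a) e₁) (sym (ι-+ (+ 1) (+ n))) , cong (λ a → 0ℚ + a) e₂) , (cong (λ a →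
        0ℚ + a) e₃ , cong (λ a → 0ℚ + a) e₄)

    infixl 7 _⊛_
    -- The multiplication table in the basis 1, √p, √q, √p √q, with rational constants `P` and `Q`
    -- where the ring K has multiples of its unit, which do not reduce.
    _⊛_ : K.Carrier → K.Carrier → K.Carrier
    ⟪ a , b , c , d ⟫ ⊛ ⟪ a′ , b′ , c′ , d′ ⟫ = ⟪
      a * a′ + P * (b * b′) + Q * (c * c′) + P * Q * (d * d′) ,
      a * b′ + b * a′ + Q * (c * d′ + d * c′) ,
      a * c′ + c * a′ + P * (b * d′ + d * b′) ,
      a * d′ + d * a′ + (b * c′ + c * b′) ⟫

    *≈⊛ : ∀ x y → (x K.* y) K.≈ (x ⊛ y)
    *≈⊛ ⟪ a , b , c , d ⟫ ⟪ a′ , b′ , c′ , d′ ⟫ =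
      ( trans (cong₃ (λ P r i → a * a′ + P * (b * b′) + (r * (c * c′ + P * (d * d′)) + P * (i * (c * d′ + d * c′)))))
          (lem₁ P Q a b c d a′ b′ c′ d′)
      , trans (cong₃ (λ P r i → a * b′ + b * a′ + (r * (c * d′ + d * c′) + i * (c * c′ + P * (d * d′)))))
          (lem₂ P Q a b c d a′ b′ c′ d′)) ,
      ( trans (cong (λ P → a * c′ + P * (b * d′) + (c * a′ + P * (d * b′))) (·1≡ι p))
          (lem₃ P a b c d a′ b′ c′ d′)
      , lem₄ a b c d a′ b′ c′ d′)
      where
      cong₃ : ∀ (f : ℚ → ℚ → ℚ → ℚ) → f (p ·ℚ 1ℚ) (re (q ·F (1ℚ +√ 0ℚ))) (im (q ·F (1ℚ +√ 0ℚ))) ≡ f P Q 0ℚ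
      cong₃ f = trans (cong (λ x →
        f x (re (q ·F (1ℚ +√ 0ℚ))) (im (q ·F (1ℚ +√ 0ℚ)))) (·1≡ι p)) (cong₂ (f P) (proj₁ (·F1 q)) (proj₂ (·F1 q)))
      lem₁ : ∀ P Q a b c d a′ b′ c′ d′ →
        a * a′ + P * (b * b′) + (Q * (c * c′ + P * (d * d′)) + P * (0ℚ * (c * d′ + d * c′)))
        ≡ a * a′ + P * (b * b′) + Q * (c * c′) + P * Q * (d * d′)
      lem₁ = solve-∀ ℚ-ring
      lem₂ : ∀ P Q a b c d a′ b′ c′ d′ → a * b′ + b * a′ + (Q * (c * d′ + d * c′) + 0ℚ * (c * c′ + P * (d * d′)))
        ≡ a * b′ + b * a′ + Q * (c * d′ + d * c′)
      lem₂ = solve-∀ ℚ-ring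
      lem₃ : ∀ P a b c d a′ b′ c′ d′ →
        a * c′ + P * (b * d′) + (c * a′ + P * (d * b′)) ≡ a * c′ + c * a′ + P * (b * d′ + d * b′)
      lem₃ = solve-∀ ℚ-ring
      lem₄ : ∀ a b c d a′ b′ c′ d′ → a * d′ + b * c′ + (c * b′ + d * a′) ≡ a * d′ + d * a′ + (b * c′ + c * b′)
      lem₄ = solve-∀ ℚ-ring

    open AlmostIntegral K public

    -- The order ℤ[√p, √q]. Every element of K has a positive integer multiple in it, which is all
    -- that is asked of a lattice of denominators.
    L : K.Carrier → Set
    L ⟪ a , b , c , d ⟫ = (IsInteger a × IsInteger b) × (IsInteger c × IsInteger d)

    L-resp : ∀ {x y} → x K.≈ y → L x → L y
    L-resp ((e₁ , e₂) , (e₃ , e₄)) ((i₁ , i₂) , (i₃ , i₄)) =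
      (subst IsInteger e₁ i₁ , subst IsInteger e₂ i₂) , (subst IsInteger e₃ i₃ , subst IsInteger e₄ i₄)

    0-int : IsInteger 0ℚ
    0-int = + 0 , refl

    P-int : IsInteger P
    P-int = + p , refl

    Q-int : IsInteger Q
    Q-int = + q , refl

    L-* : ∀ {x y} → L x → L y → L (x K.* y)
    L-* {x} {y} ((a , b) , (c , d)) ((a′ , b′) , (c′ , d′)) = L-resp (K.sym (*≈⊛ x y))
      ( ( IsInteger-+ (IsInteger-+ (IsInteger-+ (IsInteger-* a a′) (IsInteger-* P-int (IsInteger-* b b′)))
        (IsInteger-* Q-int (IsInteger-* c c′))) (IsInteger-* (IsInteger-* P-int Q-int) (IsInteger-* d d′))
        , IsInteger-+ (IsInteger-+ (IsInteger-* a b′) (IsInteger-* b a′))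
          (IsInteger-* Q-int (IsInteger-+ (IsInteger-* c d′) (IsInteger-* d c′))))
      , ( IsInteger-+ (IsInteger-+ (IsInteger-* a c′) (IsInteger-* c a′))
        (IsInteger-* P-int (IsInteger-+ (IsInteger-* b d′) (IsInteger-* d b′)))
        , IsInteger-+ (IsInteger-+ (IsInteger-* a d′) (IsInteger-* d a′)) (IsInteger-+ (IsInteger-* b c′)
          (IsInteger-* c b′))))

    subring : IsSubring L
    subring = record
      { L-resp = λ {x} {y} → L-resp {x} {y}
      ; L-1    = ((+ 1 , refl) , 0-int) , (0-int , 0-int)
      ; L-+    = λ ((a , b) , (c , d)) ((a′ , b′) , (c′ , d′)) →
        (IsInteger-+ a a′ , IsInteger-+ b b′) , (IsInteger-+ c c′ , IsInteger-+ d d′)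
      ; L-*    = λ {x} {y} → L-* {x} {y}
      ; L-neg  = λ ((a , b) , (c , d)) → (IsInteger-neg a , IsInteger-neg b) , (IsInteger-neg c , IsInteger-neg d)
      }

    open Over subring public

    -- The automorphism √q ↦ -√q maps L to itself, so it keeps common denominators of powers.
    -- `almost-conjugate₂` does the same with √p ↦ -√p.
    almost-conjugate₁ : ∀ {a b c d} → IsAlmostIntegral ⟪ a , b , c , d ⟫ → IsAlmostIntegral ⟪ a , b , - c , - d ⟫
    almost-conjugate₁ = almost-image τ
      (λ ((e₁ , e₂) , (e₃ , e₄)) → (e₁ , e₂) , (cong -_ e₃ , cong -_ e₄))
      K.refl K.refl
      (λ x y → (refl , refl) , (ℚ.neg-distrib-+ (re (im x)) (re (im y)) , ℚ.neg-distrib-+ (im (im x)) (im (im y))))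
      (λ x y → K.trans (cong-τ (*≈⊛ x y)) (K.trans (τ-⊛ x y) (K.sym (*≈⊛ (τ x) (τ y)))))
      (λ ((a , b) , (c , d)) → (a , b) , (IsInteger-neg c , IsInteger-neg d))
      where
      τ : K.Carrier → K.Carrier
      τ ⟪ a , b , c , d ⟫ = ⟪ a , b , - c , - d ⟫
      cong-τ : ∀ {x y} → x K.≈ y → τ x K.≈ τ y
      cong-τ ((e₁ , e₂) , (e₃ , e₄)) = (e₁ , e₂) , (cong -_ e₃ , cong -_ e₄)
      τ-⊛ : ∀ x y → τ (x ⊛ y) K.≈ (τ x ⊛ τ y)
      τ-⊛ ⟪ a , b , c , d ⟫ ⟪ a′ , b′ , c′ , d′ ⟫ =
        (lem₁ P Q a b c d a′ b′ c′ d′ , lem₂ Q a b c d a′ b′ c′ d′) ,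
          (lem₃ P a b c d a′ b′ c′ d′ , lem₄ a b c d a′ b′ c′ d′)
        where
        lem₁ : ∀ P Q a b c d a′ b′ c′ d′ → a * a′ + P * (b * b′) + Q * (c * c′) + P * Q * (d * d′)
          ≡ a * a′ + P * (b * b′) + Q * (- c * - c′) + P * Q * (- d * - d′)
        lem₁ = solve-∀ ℚ-ring
        lem₂ : ∀ Q a b c d a′ b′ c′ d′ →
          a * b′ + b * a′ + Q * (c * d′ + d * c′) ≡ a * b′ + b * a′ + Q * (- c * - d′ + - d * - c′)
        lem₂ = solve-∀ ℚ-ring
        lem₃ : ∀ P a b c d a′ b′ c′ d′ →
          - (a * c′ + c * a′ + P * (b * d′ + d * b′)) ≡ a * - c′ + - c * a′ + P * (b * - d′ + - d * b′)
        lem₃ = solve-∀ ℚ-ring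
        lem₄ : ∀ a b c d a′ b′ c′ d′ →
          - (a * d′ + d * a′ + (b * c′ + c * b′)) ≡ a * - d′ + - d * a′ + (b * - c′ + - c * b′)
        lem₄ = solve-∀ ℚ-ring

    almost-conjugate₂ : ∀ {a b c d} → IsAlmostIntegral ⟪ a , b , c , d ⟫ → IsAlmostIntegral ⟪ a , - b , c , - d ⟫
    almost-conjugate₂ = almost-image τ cong-τ
      K.refl K.refl
      (λ x y → (refl , ℚ.neg-distrib-+ (im (re x)) (im (re y))) , (refl , ℚ.neg-distrib-+ (im (im x)) (im (im y))))
      (λ x y → K.trans (cong-τ (*≈⊛ x y)) (K.trans (τ-⊛ x y) (K.sym (*≈⊛ (τ x) (τ y)))))
      (λ ((a , b) , (c , d)) → (a , IsInteger-neg b) , (c , IsInteger-neg d))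
      where
      τ : K.Carrier → K.Carrier
      τ ⟪ a , b , c , d ⟫ = ⟪ a , - b , c , - d ⟫
      cong-τ : ∀ {x y} → x K.≈ y → τ x K.≈ τ y
      cong-τ ((e₁ , e₂) , (e₃ , e₄)) = (e₁ , cong -_ e₂) , (e₃ , cong -_ e₄)
      τ-⊛ : ∀ x y → τ (x ⊛ y) K.≈ (τ x ⊛ τ y)
      τ-⊛ ⟪ a , b , c , d ⟫ ⟪ a′ , b′ , c′ , d′ ⟫ =
        (lem₁ P Q a b c d a′ b′ c′ d′ , lem₂ Q a b c d a′ b′ c′ d′) ,
          (lem₃ P a b c d a′ b′ c′ d′ , lem₄ a b c d a′ b′ c′ d′)
        where
        lem₁ : ∀ P Q a b c d a′ b′ c′ d′ → a * a′ + P * (b * b′) + Q * (c * c′) + P * Q * (d * d′)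
          ≡ a * a′ + P * (- b * - b′) + Q * (c * c′) + P * Q * (- d * - d′)
        lem₁ = solve-∀ ℚ-ring
        lem₂ : ∀ Q a b c d a′ b′ c′ d′ →
          - (a * b′ + b * a′ + Q * (c * d′ + d * c′)) ≡ a * - b′ + - b * a′ + Q * (c * - d′ + - d * c′)
        lem₂ = solve-∀ ℚ-ring
        lem₃ : ∀ P a b c d a′ b′ c′ d′ →
          a * c′ + c * a′ + P * (b * d′ + d * b′) ≡ a * c′ + c * a′ + P * (- b * - d′ + - d * - b′)
        lem₃ = solve-∀ ℚ-ring
        lem₄ : ∀ a b c d a′ b′ c′ d′ →
          - (a * d′ + d * a′ + (b * c′ + c * b′)) ≡ a * - d′ + - d * a′ + (- b * c′ + c * - b′)
        lem₄ = solve-∀ ℚ-ring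

    rational-* : ∀ h x → (⟪ h , 0ℚ , 0ℚ , 0ℚ ⟫ K.* x) K.≈ ⟪ h * re (re x) , h * im (re x) , h * re
      (im x) , h * im (im x) ⟫
    rational-* h x@(⟪ a , b , c , d ⟫) = K.trans (*≈⊛ ⟪ h , 0ℚ , 0ℚ , 0ℚ ⟫ x)
      ((lem₁ P Q h a b c d , lem₂ Q h a b c d) , (lem₃ P h a b c d , lem₄ h a b c d))
      where
      lem₁ : ∀ P Q h a b c d → h * a + P * (0ℚ * b) + Q * (0ℚ * c) + P * Q * (0ℚ * d) ≡ h * a
      lem₁ = solve-∀ ℚ-ring
      lem₂ : ∀ Q h a b c d → h * b + 0ℚ * a + Q * (0ℚ * d + 0ℚ * c) ≡ h * b
      lem₂ = solve-∀ ℚ-ring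
      lem₃ : ∀ P h a b c d → h * c + 0ℚ * a + P * (0ℚ * d + 0ℚ * b) ≡ h * c
      lem₃ = solve-∀ ℚ-ring
      lem₄ : ∀ h a b c d → h * d + 0ℚ * a + (0ℚ * c + 0ℚ * b) ≡ h * d
      lem₄ = solve-∀ ℚ-ring

    scalar-coordinates : ∀ n x → ((n ·K K.1#) K.* x)
      K.≈ ⟪ ι (+ n) * re (re x) , ι (+ n) * im (re x) , ι (+ n) * re (im x) , ι (+ n) * im (im x) ⟫
    scalar-coordinates n x = K.trans (K.*-congʳ {x} (·K1 n)) (rational-* (ι (+ n)) x)

    denominator : ∀ x → ∃[ s ] (IsScalar s × L (s K.* x))
    denominator x@(⟪ a , b , c , d ⟫) = N ·K K.1# , (ℕ.pred N , K.refl) , L-resp (K.sym (scalar-coordinates N x))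
      ( ( clear a (↧ b ℤ.* (↧ c ℤ.* ↧ d)) (lem₁ (↧ a) (↧ b) (↧ c) (↧ d)) , clear b (↧ a ℤ.* (↧ c ℤ.* ↧ d))
        (lem₂ (↧ a) (↧ b) (↧ c) (↧ d)) )
      , ( clear c (↧ a ℤ.* (↧ b ℤ.* ↧ d)) (lem₃ (↧ a) (↧ b) (↧ c) (↧ d)) , clear d (↧ a ℤ.* (↧ b ℤ.* ↧ c))
        (lem₄ (↧ a) (↧ b) (↧ c) (↧ d)) ) )
      where
      N : ℕ
      N = ↧ₙ a ℕ.* (↧ₙ b ℕ.* (↧ₙ c ℕ.* ↧ₙ d))
      N≡ : + N ≡ ↧ a ℤ.* (↧ b ℤ.* (↧ c ℤ.* ↧ d))
      N≡ = trans (ℤ.pos-* (↧ₙ a) (↧ₙ b ℕ.* (↧ₙ c ℕ.* ↧ₙ d)))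
        (cong (↧ a ℤ.*_) (trans (ℤ.pos-* (↧ₙ b) (↧ₙ c ℕ.* ↧ₙ d)) (cong (↧ b ℤ.*_) (ℤ.pos-* (↧ₙ c) (↧ₙ d)))))
      clear : ∀ h u → ↧ a ℤ.* (↧ b ℤ.* (↧ c ℤ.* ↧ d)) ≡ u ℤ.* ↧ h → IsInteger (ι (+ N) * h)
      clear h u eq = u ℤ.* ↥ h , trans (cong (λ z → ι z * h) (trans N≡ eq)) (trans (cong (_* h) (ι-* u (↧ h)))
        (trans (ℚ.*-assoc (ι u) (ι (↧ h)) h)
          (trans (cong (ι u *_) (trans (ℚ.*-comm (ι (↧ h)) h) (clear-denominator h))) (sym (ι-* u (↥ h))))))
      lem₁ : ∀ a b c d → a ℤ.* (b ℤ.* (c ℤ.* d)) ≡ (b ℤ.* (c ℤ.* d)) ℤ.* a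
      lem₁ = ℤsolve-∀
      lem₂ : ∀ a b c d → a ℤ.* (b ℤ.* (c ℤ.* d)) ≡ (a ℤ.* (c ℤ.* d)) ℤ.* b
      lem₂ = ℤsolve-∀
      lem₃ : ∀ a b c d → a ℤ.* (b ℤ.* (c ℤ.* d)) ≡ (a ℤ.* (b ℤ.* d)) ℤ.* c
      lem₃ = ℤsolve-∀
      lem₄ : ∀ a b c d → a ℤ.* (b ℤ.* (c ℤ.* d)) ≡ (a ℤ.* (b ℤ.* c)) ℤ.* d
      lem₄ = ℤsolve-∀

    almost-rational⇒int : ∀ {h} → IsAlmostIntegral ⟪ h , 0ℚ , 0ℚ , 0ℚ ⟫ → IsInteger h
    almost-rational⇒int {h} (s , (N , s≈) , f) = bounded-powers⇒int h N power refl (λ _ → refl) λ j →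
      proj₁ (proj₁ (L-resp (K.trans (K.*-cong s≈ (power-coordinates j))
        (scalar-coordinates (suc N) ⟪ power j , 0ℚ , 0ℚ , 0ℚ ⟫)) (f j)))
      where
      power : ℕ → ℚ
      power zero    = 1ℚ
      power (suc j) = h * power j
      power-coordinates : ∀ j → (⟪ h , 0ℚ , 0ℚ , 0ℚ ⟫ ^K j) K.≈ ⟪ power j , 0ℚ , 0ℚ , 0ℚ ⟫
      power-coordinates zero    = K.refl
      power-coordinates (suc j) = K.trans (K.*-congˡ {⟪ h , 0ℚ , 0ℚ , 0ℚ ⟫} (power-coordinates j))
        (K.trans (rational-* h ⟪ power j , 0ℚ , 0ℚ , 0ℚ ⟫) ((refl , ℚ.*-zeroʳ h) , (ℚ.*-zeroʳ h , ℚ.*-zeroʳ h)))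

  -- With a = A/2, b = B/2, c = C/2 and d √p√q = (E/2) √r, the conditions on the
  -- relative norm to ℚ(√p) force A, C to be even and B ≡ E mod 2.
  module Parity {p q r q′ A B C E w₁ w₂ : ℤ} {p₀ q₀ r₀ u : ℤ}
    (p≡ : p ≡ + 4 ℤ.* p₀ ℤ.+ + 2) (q≡ : q ≡ + 4 ℤ.* q₀ ℤ.+ + 3) (r≡ : r ≡ + 4 ℤ.* r₀ ℤ.+ + 2) (q′≡ : q′
      ≡ + 2 ℤ.* u ℤ.+ 1ℤ)
    (norm-re : A ℤ.* A ℤ.+ p ℤ.* (B ℤ.* B) ℤ.- q ℤ.* (C ℤ.* C) ℤ.- r ℤ.* (E ℤ.* E) ≡ + 4 ℤ.* w₁)
    (norm-im : A ℤ.* B ℤ.- q′ ℤ.* (C ℤ.* E) ≡ + 2 ℤ.* w₂)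
    where

    private
      Even Odd : ℤ → Set
      Even a = ∃[ k ] a ≡ + 2 ℤ.* k
      Odd a = ∃[ k ] a ≡ + 2 ℤ.* k ℤ.+ 1ℤ

      SquareMod4 : ℤ → ℤ → Set
      SquareMod4 a ε = ∃[ s ] a ℤ.* a ≡ + 4 ℤ.* s ℤ.+ ε

      even-square : ∀ {a} → Even a → SquareMod4 a (+ 0)
      even-square (k , refl) = k ℤ.* k , lem k
        where
        lem : ∀ k → + 2 ℤ.* k ℤ.* (+ 2 ℤ.* k) ≡ + 4 ℤ.* (k ℤ.* k) ℤ.+ + 0
        lem = ℤsolve-∀

      odd-square : ∀ {a} → Odd a → SquareMod4 a (+ 1)
      odd-square (k , refl) = k ℤ.* k ℤ.+ k , lem k
        where
        lem : ∀ k → (+ 2 ℤ.* k ℤ.+ 1ℤ) ℤ.* (+ 2 ℤ.* k ℤ.+ 1ℤ) ≡ + 4 ℤ.* (k ℤ.* k ℤ.+ k) ℤ.+ + 1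
        lem = ℤsolve-∀

      -- As p ≡ r ≡ 2 and q ≡ -1 mod 4, the form in `norm-re` is A² + 2 B² + C² - 2 E² mod 4, a
      -- number depending only on the parities.
      mod-4-absurd : ∀ {α β γ ε} → SquareMod4 A α → SquareMod4 B β → SquareMod4 C γ → SquareMod4 E ε →
        let c = α ℤ.+ + 2 ℤ.* β ℤ.+ γ ℤ.- + 2 ℤ.* ε in .{{_ : ℕ.NonZero ℤ.∣ c ∣}} → ℤ.∣ c ∣ ℕ.< 4 → ⊥
      mod-4-absurd {α} {β} {γ} {ε} (a , A²) (b , B²) (c , C²) (e , E²) =
        not-4* (a ℤ.+ p ℤ.* b ℤ.+ p₀ ℤ.* β ℤ.- q ℤ.* c ℤ.- (q₀ ℤ.+ 1ℤ) ℤ.* γ ℤ.- r ℤ.* e ℤ.- r₀ ℤ.* ε)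
          (α ℤ.+ + 2 ℤ.* β ℤ.+ γ ℤ.- + 2 ℤ.* ε) norm-re
          (trans (cong₂ (λ A² B² → A² ℤ.+ p ℤ.* B² ℤ.- q ℤ.* (C ℤ.* C) ℤ.- r ℤ.* (E ℤ.* E) ℤ.- + 4 ℤ.* K p q r) A² B²)
            (trans (cong₂ (λ C² E² →
              + 4 ℤ.* a ℤ.+ α ℤ.+ p ℤ.* (+ 4 ℤ.* b ℤ.+ β) ℤ.- q ℤ.* C² ℤ.- r ℤ.* E² ℤ.- + 4 ℤ.* K p q r) C² E²)
              (trans (step p≡ q≡ r≡) (lem a b c e α β γ ε p₀ q₀ r₀))))
        where
        K : ℤ → ℤ → ℤ → ℤ
        K p q r = a ℤ.+ p ℤ.* b ℤ.+ p₀ ℤ.* β ℤ.- q ℤ.* c ℤ.- (q₀ ℤ.+ 1ℤ) ℤ.* γ ℤ.- r ℤ.* e ℤ.- r₀ ℤ.* ε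
        W : ℤ → ℤ → ℤ → ℤ
        W p q r = + 4 ℤ.* a ℤ.+ α ℤ.+ p ℤ.* (+ 4 ℤ.* b ℤ.+ β) ℤ.- q ℤ.* (+ 4 ℤ.* c ℤ.+ γ) ℤ.- r ℤ.*
          (+ 4 ℤ.* e ℤ.+ ε) ℤ.- + 4 ℤ.* K p q r
        step : ∀ {p p′ q q′ r r′} → p ≡ p′ → q ≡ q′ → r ≡ r′ → W p q r ≡ W p′ q′ r′
        step refl refl refl = refl
        lem : ∀ a b c e α β γ ε p₀ q₀ r₀ →
          + 4 ℤ.* a ℤ.+ α ℤ.+ (+ 4 ℤ.* p₀ ℤ.+ + 2) ℤ.* (+ 4 ℤ.* b ℤ.+ β) ℤ.- (+ 4 ℤ.* q₀ ℤ.+ + 3) ℤ.* (+ 4 ℤ.* c ℤ.+ γ)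
            ℤ.- (+ 4 ℤ.* r₀ ℤ.+ + 2) ℤ.* (+ 4 ℤ.* e ℤ.+ ε)
            ℤ.- + 4 ℤ.* (a ℤ.+ (+ 4 ℤ.* p₀ ℤ.+ + 2) ℤ.* b ℤ.+ p₀ ℤ.* β ℤ.- (+ 4 ℤ.* q₀ ℤ.+ + 3) ℤ.* c ℤ.-
              (q₀ ℤ.+ 1ℤ) ℤ.* γ ℤ.- (+ 4 ℤ.* r₀ ℤ.+ + 2) ℤ.* e ℤ.- r₀ ℤ.* ε)
          ≡ α ℤ.+ + 2 ℤ.* β ℤ.+ γ ℤ.- + 2 ℤ.* ε
        lem = ℤsolve-∀

      same-even : Even B → Even E → ∃[ e ] B ≡ E ℤ.+ + 2 ℤ.* e
      same-even (k , B≡) (l , E≡) = k ℤ.- l , trans B≡ (trans (lem k l) (cong (λ E → E ℤ.+ + 2 ℤ.* (k ℤ.- l)) (sym E≡)))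
        where
        lem : ∀ k l → + 2 ℤ.* k ≡ + 2 ℤ.* l ℤ.+ + 2 ℤ.* (k ℤ.- l)
        lem = ℤsolve-∀

      same-odd : Odd B → Odd E → ∃[ e ] B ≡ E ℤ.+ + 2 ℤ.* e
      same-odd (k , B≡) (l , E≡) = k ℤ.- l , trans B≡ (trans (lem k l) (cong (λ E → E ℤ.+ + 2 ℤ.* (k ℤ.- l)) (sym E≡)))
        where
        lem : ∀ k l → + 2 ℤ.* k ℤ.+ 1ℤ ≡ + 2 ℤ.* l ℤ.+ 1ℤ ℤ.+ + 2 ℤ.* (k ℤ.- l)
        lem = ℤsolve-∀

      1<4 : 1 ℕ.< 4
      1<4 = s≤s (s≤s z≤n)
      2<4 : 2 ℕ.< 4
      2<4 = s≤s (s≤s (s≤s z≤n))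
      3<4 : 3 ℕ.< 4
      3<4 = s≤s (s≤s (s≤s (s≤s z≤n)))

      -- The two parity patterns that survive `norm-re`: A, C odd and exactly one of B, E odd. Then
      -- A B - q′ C E is odd because q′ is, against `norm-im`.
      odd-difference : ∀ {w a b c e : ℤ} → Odd a → Odd c → (Even b × Odd e) ⊎ (Odd b × Even e) →
        a ℤ.* b ℤ.- (+ 2 ℤ.* u ℤ.+ 1ℤ) ℤ.* (c ℤ.* e) ≢ + 2 ℤ.* w
      odd-difference {w} (x , refl) (z , refl) (inj₁ ((y , refl) , (d , refl))) eq = even≢odd w
        ((+ 2 ℤ.* x ℤ.+ 1ℤ) ℤ.* y ℤ.- (u ℤ.* ((+ 2 ℤ.* z ℤ.+ 1ℤ) ℤ.* (+ 2 ℤ.* d ℤ.+ 1ℤ)) ℤ.+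
          (z ℤ.* (+ 2 ℤ.* d ℤ.+ 1ℤ) ℤ.+ d ℤ.+ 1ℤ)))
        (trans (sym eq) (lem x y z d u))
        where
        lem : ∀ x y z d u → (+ 2 ℤ.* x ℤ.+ 1ℤ) ℤ.* (+ 2 ℤ.* y) ℤ.- (+ 2 ℤ.* u ℤ.+ 1ℤ) ℤ.*
          ((+ 2 ℤ.* z ℤ.+ 1ℤ) ℤ.* (+ 2 ℤ.* d ℤ.+ 1ℤ))
          ≡ + 2 ℤ.* ((+ 2 ℤ.* x ℤ.+ 1ℤ) ℤ.* y ℤ.- (u ℤ.* ((+ 2 ℤ.* z ℤ.+ 1ℤ) ℤ.* (+ 2 ℤ.* d ℤ.+ 1ℤ)) ℤ.+
            (z ℤ.* (+ 2 ℤ.* d ℤ.+ 1ℤ) ℤ.+ d ℤ.+ 1ℤ))) ℤ.+ 1ℤ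
        lem = ℤsolve-∀
      odd-difference {w} (x , refl) (z , refl) (inj₂ ((y , refl) , (d , refl))) eq = even≢odd w
        (x ℤ.* (+ 2 ℤ.* y ℤ.+ 1ℤ) ℤ.+ y ℤ.- (+ 2 ℤ.* u ℤ.+ 1ℤ) ℤ.* ((+ 2 ℤ.* z ℤ.+ 1ℤ) ℤ.* d))
        (trans (sym eq) (lem x y z d u))
        where
        lem : ∀ x y z d u → (+ 2 ℤ.* x ℤ.+ 1ℤ) ℤ.* (+ 2 ℤ.* y ℤ.+ 1ℤ) ℤ.- (+ 2 ℤ.* u ℤ.+ 1ℤ) ℤ.*
          ((+ 2 ℤ.* z ℤ.+ 1ℤ) ℤ.* (+ 2 ℤ.* d))
          ≡ + 2 ℤ.* (x ℤ.* (+ 2 ℤ.* y ℤ.+ 1ℤ) ℤ.+ y ℤ.- (+ 2 ℤ.* u ℤ.+ 1ℤ) ℤ.* ((+ 2 ℤ.* z ℤ.+ 1ℤ) ℤ.* d)) ℤ.+ 1ℤ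
        lem = ℤsolve-∀

      norm-im′ : A ℤ.* B ℤ.- (+ 2 ℤ.* u ℤ.+ 1ℤ) ℤ.* (C ℤ.* E) ≡ + 2 ℤ.* w₂
      norm-im′ = trans (cong (λ q → A ℤ.* B ℤ.- q ℤ.* (C ℤ.* E)) (sym q′≡)) norm-im

    conclusion : Even A × Even C × (∃[ e ] B ≡ E ℤ.+ + 2 ℤ.* e)
    conclusion = cases (even-or-odd A) (even-or-odd C) (even-or-odd B) (even-or-odd E)
      where
      cases : Even A ⊎ Odd A → Even C ⊎ Odd C → Even B ⊎ Odd B → Even E ⊎ Odd E →
        Even A × Even C × (∃[ e ] B ≡ E ℤ.+ + 2 ℤ.* e)
      cases (inj₁ A) (inj₁ C) (inj₁ B) (inj₁ E) = A , C , same-even B E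
      cases (inj₁ A) (inj₁ C) (inj₂ B) (inj₂ E) = A , C , same-odd B E
      cases (inj₁ A) (inj₁ C) (inj₁ B) (inj₂ E) =
        ⊥-elim (mod-4-absurd (even-square A) (even-square B) (even-square C) (odd-square E) 2<4)
      cases (inj₁ A) (inj₁ C) (inj₂ B) (inj₁ E) =
        ⊥-elim (mod-4-absurd (even-square A) (odd-square B) (even-square C) (even-square E) 2<4)
      cases (inj₁ A) (inj₂ C) (inj₁ B) (inj₁ E) =
        ⊥-elim (mod-4-absurd (even-square A) (even-square B) (odd-square C) (even-square E) 1<4)
      cases (inj₁ A) (inj₂ C) (inj₁ B) (inj₂ E) =
        ⊥-elim (mod-4-absurd (even-square A) (even-square B) (odd-square C) (odd-square E) 1<4)
      cases (inj₁ A) (inj₂ C) (inj₂ B) (inj₁ E) =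
        ⊥-elim (mod-4-absurd (even-square A) (odd-square B) (odd-square C) (even-square E) 3<4)
      cases (inj₁ A) (inj₂ C) (inj₂ B) (inj₂ E) =
        ⊥-elim (mod-4-absurd (even-square A) (odd-square B) (odd-square C) (odd-square E) 1<4)
      cases (inj₂ A) (inj₁ C) (inj₁ B) (inj₁ E) =
        ⊥-elim (mod-4-absurd (odd-square A) (even-square B) (even-square C) (even-square E) 1<4)
      cases (inj₂ A) (inj₁ C) (inj₁ B) (inj₂ E) =
        ⊥-elim (mod-4-absurd (odd-square A) (even-square B) (even-square C) (odd-square E) 1<4)
      cases (inj₂ A) (inj₁ C) (inj₂ B) (inj₁ E) =
        ⊥-elim (mod-4-absurd (odd-square A) (odd-square B) (even-square C) (even-square E) 3<4)
      cases (inj₂ A) (inj₁ C) (inj₂ B) (inj₂ E) =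
        ⊥-elim (mod-4-absurd (odd-square A) (odd-square B) (even-square C) (odd-square E) 1<4)
      cases (inj₂ A) (inj₂ C) (inj₁ B) (inj₁ E) =
        ⊥-elim (mod-4-absurd (odd-square A) (even-square B) (odd-square C) (even-square E) 2<4)
      cases (inj₂ A) (inj₂ C) (inj₂ B) (inj₂ E) =
        ⊥-elim (mod-4-absurd (odd-square A) (odd-square B) (odd-square C) (odd-square E) 2<4)
      cases (inj₂ A) (inj₂ C) (inj₁ B) (inj₂ E) = ⊥-elim (odd-difference {w₂} A C (inj₁ (B , E)) norm-im′)
      cases (inj₂ A) (inj₂ C) (inj₂ B) (inj₁ E) = ⊥-elim (odd-difference {w₂} A C (inj₂ (B , E)) norm-im′)

  ι-sub : ∀ a b → ι (a ℤ.- b) ≡ ι a - ι b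
  ι-sub a b = trans (ι-+ a (ℤ.- b)) (cong (λ c → ι a + c) (ι-neg b))

  ι-*² : ∀ p a → ι (p ℤ.* (a ℤ.* a)) ≡ ι p * (ι a * ι a)
  ι-*² p a = trans (ι-* p (a ℤ.* a)) (cong (λ c → ι p * c) (ι-* a a))

  ι-form : ∀ A p B q C r E → ι (A ℤ.* A ℤ.+ p ℤ.* (B ℤ.* B) ℤ.- q ℤ.* (C ℤ.* C) ℤ.- r ℤ.* (E ℤ.* E))
    ≡ ι A * ι A + ι p * (ι B * ι B) - ι q * (ι C * ι C) - ι r * (ι E * ι E)
  ι-form A p B q C r E = trans (ι-sub (A ℤ.* A ℤ.+ p ℤ.* (B ℤ.* B) ℤ.- q ℤ.* (C ℤ.* C)) (r ℤ.* (E ℤ.* E)))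
    (cong₂ _-_ (trans (ι-sub (A ℤ.* A ℤ.+ p ℤ.* (B ℤ.* B)) (q ℤ.* (C ℤ.* C)))
      (cong₂ _-_ (trans (ι-+ (A ℤ.* A) (p ℤ.* (B ℤ.* B))) (cong₂ _+_ (ι-* A A) (ι-*² p B))) (ι-*² q C))) (ι-*² r E))

  double-int : ∀ {h k} → ι (+ 2) * h ≡ ι (+ 2 ℤ.* k) → h ≡ ι k
  double-int {h} {k} eq = trans (sym (cancel-2 h)) (trans (cong (ℚ.½ *_) (trans eq (ι-* (+ 2) k))) (cancel-2 (ι k)))
    where
    cancel-2 : ∀ h → ℚ.½ * (ι (+ 2) * h) ≡ h
    cancel-2 h = trans (sym (ℚ.*-assoc ℚ.½ (ι (+ 2)) h)) (ℚ.*-identityˡ h)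

  module Integral {p q g p′ q′ : ℕ} (p≡ : p ≡ g ℕ.* p′) (q≡ : q ≡ g ℕ.* q′)
    (p-squarefree : SquareFree p) (q-squarefree : SquareFree q) (r-squarefree : SquareFree (p′ ℕ.* q′))
    {p₀ q₀ r₀ u : ℤ} (p-mod : + p ≡ + 4 ℤ.* p₀ ℤ.+ + 2) (q-mod : + q ≡ + 4 ℤ.* q₀ ℤ.+ + 3)
    (r-mod : + (p′ ℕ.* q′) ≡ + 4 ℤ.* r₀ ℤ.+ + 2) (q′-odd : + q′ ≡ + 2 ℤ.* u ℤ.+ 1ℤ)
    where

    open Field p q public

    G R Q′ : ℚ
    G = ι (+ g)
    R = ι (+ (p′ ℕ.* q′))
    Q′ = ι (+ q′)

    P≡ : P ≡ G * ι (+ p′)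
    P≡ = trans (cong (λ a → ι (+ a)) p≡) (trans (cong ι (ℤ.pos-* g p′)) (ι-* (+ g) (+ p′)))

    Q≡ : Q ≡ G * Q′
    Q≡ = trans (cong (λ a → ι (+ a)) q≡) (trans (cong ι (ℤ.pos-* g q′)) (ι-* (+ g) (+ q′)))

    R≡ : R ≡ ι (+ p′) * Q′
    R≡ = trans (cong ι (ℤ.pos-* p′ q′)) (ι-* (+ p′) (+ q′))

    PQ≡ : P * Q ≡ R * (G * G)
    PQ≡ = trans (cong₂ _*_ P≡ Q≡) (trans (lem G (ι (+ p′)) Q′) (cong (_* (G * G)) (sym R≡)))
      where
      lem : ∀ G p q → G * p * (G * q) ≡ p * q * (G * G)
      lem = solve-∀ ℚ-ring

    -- The fourth coordinate d of x belongs to √p √q = g √r, so the coefficient of √r is g d. The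
    -- coefficients of √p and √r may be half-integers and are recorded doubled.
    record Coordinates (x : K.Carrier) : Set where
      field
        X Y Z W e : ℤ
        X≡  : re (re x) ≡ ι X
        Y≡  : ι (+ 2) * im (re x) ≡ ι Y
        Z≡  : re (im x) ≡ ι Z
        W≡  : ι (+ 2) * (G * im (im x)) ≡ ι W
        Y≡W : Y ≡ W ℤ.+ + 2 ℤ.* e

    private
      2* : ∀ a → a + a ≡ ι (+ 2) * a
      2* = solve-∀ ℚ-ring

      cancel : ∀ a → a + - a ≡ 0ℚ
      cancel = ℚ.+-inverseʳ

      -- The sum and the product of an element of ℚ(√p) and its conjugate are rational and almost
      -- integral, hence integers; these are its trace and norm. The two variants after it treat
      -- ℚ(√q) and ℚ(√r).
      almost-quadratic₁ : ∀ {s t} → IsAlmostIntegral ⟪ s , t , 0ℚ , 0ℚ ⟫ → IsInteger s × IsInteger t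
      almost-quadratic₁ {s} {t} h = quadratic-integer p-squarefree (p₀ , inj₁ p-mod) s t
        (almost-rational⇒int (almost-resp ((2* s , cancel t) , (refl , refl)) (almost-+ h h′)))
        (almost-rational⇒int (almost-resp (K.trans (*≈⊛ ⟪ s , t , 0ℚ , 0ℚ ⟫ ⟪ s , - t , 0ℚ , 0ℚ ⟫)
          ((lem₁ P Q s t , lem₂ Q s t) , (lem₃ P s t , lem₄ s t))) (almost-* h h′)))
        where
        h′ : IsAlmostIntegral ⟪ s , - t , 0ℚ , 0ℚ ⟫
        h′ = almost-conjugate₂ h
        lem₁ : ∀ P Q s t → s * s + P * (t * - t) + Q * (0ℚ * 0ℚ) + P * Q * (0ℚ * 0ℚ) ≡ s * s - P * (t * t)
        lem₁ = solve-∀ ℚ-ring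
        lem₂ : ∀ Q s t → s * - t + t * s + Q * (0ℚ * 0ℚ + 0ℚ * 0ℚ) ≡ 0ℚ
        lem₂ = solve-∀ ℚ-ring
        lem₃ : ∀ P s t → s * 0ℚ + 0ℚ * s + P * (t * 0ℚ + 0ℚ * - t) ≡ 0ℚ
        lem₃ = solve-∀ ℚ-ring
        lem₄ : ∀ s t → s * 0ℚ + 0ℚ * s + (t * 0ℚ + 0ℚ * - t) ≡ 0ℚ
        lem₄ = solve-∀ ℚ-ring

      almost-quadratic₂ : ∀ {s t} → IsAlmostIntegral ⟪ s , 0ℚ , t , 0ℚ ⟫ → IsInteger s × IsInteger t
      almost-quadratic₂ {s} {t} h = quadratic-integer q-squarefree (q₀ , inj₂ q-mod) s t
        (almost-rational⇒int (almost-resp ((2* s , refl) , (cancel t , refl)) (almost-+ h h′)))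
        (almost-rational⇒int (almost-resp (K.trans (*≈⊛ ⟪ s , 0ℚ , t , 0ℚ ⟫ ⟪ s , 0ℚ , - t , 0ℚ ⟫)
          ((lem₁ P Q s t , lem₂ Q s t) , (lem₃ P s t , lem₄ s t))) (almost-* h h′)))
        where
        h′ : IsAlmostIntegral ⟪ s , 0ℚ , - t , 0ℚ ⟫
        h′ = almost-conjugate₁ h
        lem₁ : ∀ P Q s t → s * s + P * (0ℚ * 0ℚ) + Q * (t * - t) + P * Q * (0ℚ * 0ℚ) ≡ s * s - Q * (t * t)
        lem₁ = solve-∀ ℚ-ring
        lem₂ : ∀ Q s t → s * 0ℚ + 0ℚ * s + Q * (t * 0ℚ + 0ℚ * - t) ≡ 0ℚ
        lem₂ = solve-∀ ℚ-ring
        lem₃ : ∀ P s t → s * - t + t * s + P * (0ℚ * 0ℚ + 0ℚ * 0ℚ) ≡ 0ℚ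
        lem₃ = solve-∀ ℚ-ring
        lem₄ : ∀ s t → s * 0ℚ + 0ℚ * s + (0ℚ * - t + t * 0ℚ) ≡ 0ℚ
        lem₄ = solve-∀ ℚ-ring

      almost-quadratic₃ : ∀ {s t} → IsAlmostIntegral ⟪ s , 0ℚ , 0ℚ , t ⟫ → IsInteger s × IsInteger (G * t)
      almost-quadratic₃ {s} {t} h = quadratic-integer r-squarefree (r₀ , inj₁ r-mod) s (G * t)
        (almost-rational⇒int (almost-resp ((2* s , refl) , (refl , cancel t)) (almost-+ h h′)))
        (almost-rational⇒int (almost-resp (K.trans (*≈⊛ ⟪ s , 0ℚ , 0ℚ , t ⟫ ⟪ s , 0ℚ , 0ℚ , - t ⟫)
          ((trans (lem₁ P Q s t) (trans (cong (λ a → s * s - a * (t * t)) PQ≡) (lem₅ R G s t)) , lem₂ Q s t) ,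
            (lem₃ P s t , lem₄ s t))) (almost-* h h′)))
        where
        h′ : IsAlmostIntegral ⟪ s , 0ℚ , 0ℚ , - t ⟫
        h′ = almost-conjugate₁ h
        lem₁ : ∀ P Q s t → s * s + P * (0ℚ * 0ℚ) + Q * (0ℚ * 0ℚ) + P * Q * (t * - t) ≡ s * s - P * Q * (t * t)
        lem₁ = solve-∀ ℚ-ring
        lem₂ : ∀ Q s t → s * 0ℚ + 0ℚ * s + Q * (0ℚ * - t + t * 0ℚ) ≡ 0ℚ
        lem₂ = solve-∀ ℚ-ring
        lem₃ : ∀ P s t → s * 0ℚ + 0ℚ * s + P * (0ℚ * - t + t * 0ℚ) ≡ 0ℚ
        lem₃ = solve-∀ ℚ-ring
        lem₄ : ∀ s t → s * - t + t * s + (0ℚ * 0ℚ + 0ℚ * 0ℚ) ≡ 0ℚ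
        lem₄ = solve-∀ ℚ-ring
        lem₅ : ∀ R G s t → s * s - R * (G * G) * (t * t) ≡ s * s - R * (G * t * (G * t))
        lem₅ = solve-∀ ℚ-ring

    module _ {A B C E w : ℤ} (a b c d : ℚ) (A≡ : ι (+ 2) * a ≡ ι A) (B≡ : ι (+ 2) * b ≡ ι B)
      (C≡ : ι (+ 2) * c ≡ ι C) (E≡ : ι (+ 2) * (G * d) ≡ ι E) where

      private
        form : ℚ → ℚ → ℚ → ℚ → ℚ
        form A B C E = A * A + P * (B * B) - Q * (C * C) - R * (E * E)

        cong₄ : ∀ (f : ℚ → ℚ → ℚ → ℚ → ℚ) →
          f (ι (+ 2) * a) (ι (+ 2) * b) (ι (+ 2) * c) (ι (+ 2) * (G * d)) ≡ f (ι A) (ι B) (ι C) (ι E)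
        cong₄ f = trans (cong₂ (λ A B → f A B (ι (+ 2) * c) (ι (+ 2) * (G * d))) A≡ B≡) (cong₂ (f (ι A) (ι B)) C≡ E≡)

      norm-re-int : a * a + P * (b * b) - Q * (c * c) - P * Q * (d * d) ≡ ι w →
        A ℤ.* A ℤ.+ + p ℤ.* (B ℤ.* B) ℤ.- + q ℤ.* (C ℤ.* C) ℤ.- + (p′ ℕ.* q′) ℤ.* (E ℤ.* E) ≡ + 4 ℤ.* w
      norm-re-int eq = ι-injective (begin
        ι (A ℤ.* A ℤ.+ + p ℤ.* (B ℤ.* B) ℤ.- + q ℤ.* (C ℤ.* C) ℤ.- + (p′ ℕ.* q′) ℤ.* (E ℤ.* E))
          ≡⟨ ι-form A (+ p) B (+ q) C (+ (p′ ℕ.* q′)) E ⟩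
        form (ι A) (ι B) (ι C) (ι E)
          ≡⟨ cong₄ form ⟨
        form (ι (+ 2) * a) (ι (+ 2) * b) (ι (+ 2) * c) (ι (+ 2) * (G * d))
          ≡⟨ lem (ι (+ 2)) P Q R G a b c d ⟩
        ι (+ 2) * ι (+ 2) * (a * a + P * (b * b) - Q * (c * c) - R * (G * G) * (d * d))
          ≡⟨ cong (λ PQ → ι (+ 2) * ι (+ 2) * (a * a + P * (b * b) - Q * (c * c) - PQ * (d * d))) PQ≡ ⟨
        ι (+ 2) * ι (+ 2) * (a * a + P * (b * b) - Q * (c * c) - P * Q * (d * d))
          ≡⟨ cong₂ _*_ (ι-* (+ 2) (+ 2)) (sym eq) ⟨
        ι (+ 4) * ι w
          ≡⟨ ι-* (+ 4) w ⟨
        ι (+ 4 ℤ.* w) ∎)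
        where
        open ≡-Reasoning
        lem : ∀ k P Q R G a b c d →
          k * a * (k * a) + P * (k * b * (k * b)) - Q * (k * c * (k * c)) - R * (k * (G * d) * (k * (G * d)))
          ≡ k * k * (a * a + P * (b * b) - Q * (c * c) - R * (G * G) * (d * d))
        lem = solve-∀ ℚ-ring

      norm-im-int : a * b + b * a - Q * (c * d + d * c) ≡ ι w → A ℤ.* B ℤ.- + q′ ℤ.* (C ℤ.* E) ≡ + 2 ℤ.* w
      norm-im-int eq = ι-injective (begin
        ι (A ℤ.* B ℤ.- + q′ ℤ.* (C ℤ.* E))
          ≡⟨ ι-sub (A ℤ.* B) (+ q′ ℤ.* (C ℤ.* E)) ⟩
        ι (A ℤ.* B) - ι (+ q′ ℤ.* (C ℤ.* E))
          ≡⟨ cong₂ _-_ (ι-* A B) (trans (ι-* (+ q′) (C ℤ.* E)) (cong (λ x → Q′ * x) (ι-* C E))) ⟩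
        ι A * ι B - Q′ * (ι C * ι E)
          ≡⟨ cong₄ (λ A B C E → A * B - Q′ * (C * E)) ⟨
        ι (+ 2) * a * (ι (+ 2) * b) - Q′ * (ι (+ 2) * c * (ι (+ 2) * (G * d)))
          ≡⟨ lem₁ (ι (+ 2)) Q′ G a b c d ⟩
        ι (+ 2) * (ι (+ 2) * (a * b - G * Q′ * (c * d)))
          ≡⟨ cong (λ x → ι (+ 2) * x) (2* (a * b - G * Q′ * (c * d))) ⟨
        ι (+ 2) * (a * b - G * Q′ * (c * d) + (a * b - G * Q′ * (c * d)))
          ≡⟨ cong (λ x → ι (+ 2) * x) (lem₂ (G * Q′) a b c d) ⟩
        ι (+ 2) * (a * b + b * a - G * Q′ * (c * d + d * c))
          ≡⟨ cong (λ Q → ι (+ 2) * (a * b + b * a - Q * (c * d + d * c))) Q≡ ⟨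
        ι (+ 2) * (a * b + b * a - Q * (c * d + d * c))
          ≡⟨ cong (λ x → ι (+ 2) * x) eq ⟩
        ι (+ 2) * ι w
          ≡⟨ ι-* (+ 2) w ⟨
        ι (+ 2 ℤ.* w) ∎)
        where
        open ≡-Reasoning
        lem₁ : ∀ k q G a b c d → k * a * (k * b) - q * (k * c * (k * (G * d))) ≡ k * (k * (a * b - G * q * (c * d)))
        lem₁ = solve-∀ ℚ-ring
        lem₂ : ∀ Q a b c d → a * b - Q * (c * d) + (a * b - Q * (c * d)) ≡ a * b + b * a - Q * (c * d + d * c)
        lem₂ = solve-∀ ℚ-ring

    assemble : ∀ {a b c d} → IsInteger (ι (+ 2) * a) → IsInteger (ι (+ 2) * b) → IsInteger (ι (+ 2) * c) →
      IsInteger (ι (+ 2) * (G * d)) →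
      IsInteger (a * a + P * (b * b) - Q * (c * c) - P * Q * (d * d)) →
        IsInteger (a * b + b * a - Q * (c * d + d * c)) →
      Coordinates ⟪ a , b , c , d ⟫
    assemble {a} {b} {c} {d} (A , A≡) (B , B≡) (C , C≡) (E , E≡) (w₁ , eq₁) (w₂ , eq₂) = from-parity
      (Parity.conclusion {+ p} {+ q} {+
        (p′ ℕ.* q′)} {+ q′} {A} {B} {C} {E} {w₁} {w₂} {p₀} {q₀} {r₀} {u} p-mod q-mod r-mod q′-odd
        (norm-re-int {A} {B} {C} {E} {w₁} a b c d A≡ B≡ C≡ E≡ eq₁)
          (norm-im-int {A} {B} {C} {E} {w₂} a b c d A≡ B≡ C≡ E≡ eq₂))
      where
      from-parity : (∃[ k ] A ≡ + 2 ℤ.* k) × (∃[ k ] C ≡ + 2 ℤ.* k) × (∃[ e ] B ≡ E ℤ.+ + 2 ℤ.* e) →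
        Coordinates ⟪ a , b , c , d ⟫
      from-parity ((X , A≡2X) , (Z , C≡2Z) , (e , B≡E)) = record
        { X = X ; Y = B ; Z = Z ; W = E ; e = e
        ; X≡ = double-int {a} {X} (trans A≡ (cong ι A≡2X))
        ; Y≡ = B≡
        ; Z≡ = double-int {c} {Z} (trans C≡ (cong ι C≡2Z))
        ; W≡ = E≡
        ; Y≡W = B≡E
        }

    module _ {a b c d : ℚ} (h : IsAlmostIntegral ⟪ a , b , c , d ⟫) where

      private
        h₁ : IsAlmostIntegral ⟪ a , b , - c , - d ⟫
        h₁ = almost-conjugate₁ h
        h₂ : IsAlmostIntegral ⟪ a , - b , c , - d ⟫
        h₂ = almost-conjugate₂ h
        h₃ : IsAlmostIntegral ⟪ a , - b , - c , - - d ⟫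
        h₃ = almost-conjugate₁ h₂

      -- The traces to the three quadratic subfields show that no denominator exceeds 2 in the
      -- coordinates on 1, √p, √q, √r; the relative norm to ℚ(√p) supplies the congruences deciding
      -- which halves occur.
      trace₁ : IsInteger (ι (+ 2) * a) × IsInteger (ι (+ 2) * b)
      trace₁ = almost-quadratic₁ (almost-resp ((2* a , 2* b) , (cancel c , cancel d)) (almost-+ h h₁))

      trace₂ : IsInteger (ι (+ 2) * a) × IsInteger (ι (+ 2) * c)
      trace₂ = almost-quadratic₂ (almost-resp ((2* a , cancel b) , (2* c , cancel d)) (almost-+ h h₂))

      trace₃ : IsInteger (ι (+ 2) * a) × IsInteger (G * (ι (+ 2) * d))
      trace₃ = almost-quadratic₃ (almost-resp ((2* a , cancel b) , (cancel c , lem d)) (almost-+ h h₃))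
        where
        lem : ∀ d → d + - - d ≡ ι (+ 2) * d
        lem = solve-∀ ℚ-ring

      norm : IsInteger (a * a + P * (b * b) - Q * (c * c) - P * Q * (d * d)) × IsInteger
        (a * b + b * a - Q * (c * d + d * c))
      norm = almost-quadratic₁ {s} {t} (almost-resp {x K.* x₁} {⟪ s , t , 0ℚ , 0ℚ ⟫}
        (K.trans {x K.* x₁} {x ⊛ x₁} {⟪ s , t , 0ℚ , 0ℚ ⟫} (*≈⊛ x x₁) ((lem₁ P Q a b c d , lem₂ Q a b c d) ,
          (lem₃ P a b c d , lem₄ a b c d)))
        (almost-* {x} {x₁} h h₁))
        where
        x x₁ : K.Carrier
        x = ⟪ a , b , c , d ⟫
        x₁ = ⟪ a , b , - c , - d ⟫
        s t : ℚ
        s = a * a + P * (b * b) - Q * (c * c) - P * Q * (d * d)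
        t = a * b + b * a - Q * (c * d + d * c)
        lem₁ : ∀ P Q a b c d →
          a * a + P * (b * b) + Q * (c * - c) + P * Q * (d * - d) ≡ a * a + P * (b * b) - Q * (c * c) - P * Q * (d * d)
        lem₁ = solve-∀ ℚ-ring
        lem₂ : ∀ Q a b c d → a * b + b * a + Q * (c * - d + d * - c) ≡ a * b + b * a - Q * (c * d + d * c)
        lem₂ = solve-∀ ℚ-ring
        lem₃ : ∀ P a b c d → a * - c + c * a + P * (b * - d + d * b) ≡ 0ℚ
        lem₃ = solve-∀ ℚ-ring
        lem₄ : ∀ a b c d → a * - d + d * a + (b * - c + c * b) ≡ 0ℚ
        lem₄ = solve-∀ ℚ-ring

    opaque
      coordinates : ∀ x → IsIntegral K x → Coordinates x
      coordinates ⟪ a , b , c , d ⟫ integral = assemble (proj₁ (trace₁ h)) (proj₂ (trace₁ h)) (proj₂ (trace₂ h))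
        (subst IsInteger (lem (ι (+ 2)) G d) (proj₂ (trace₃ h))) (proj₁ (norm h)) (proj₂ (norm h))
        where
        h : IsAlmostIntegral ⟪ a , b , c , d ⟫
        h = integral⇒almost denominator integral
        lem : ∀ k G d → G * (k * d) ≡ k * (G * d)
        lem = solve-∀ ℚ-ring

  -- Rational estimates and Cauchy sequences.

  0≤+ : ∀ {a b} → 0ℚ ≤ a → 0ℚ ≤ b → 0ℚ ≤ a + b
  0≤+ = ℚ.+-mono-≤

  0≤* : ∀ {a b} → 0ℚ ≤ a → 0ℚ ≤ b → 0ℚ ≤ a * b
  0≤* {a} {b} 0≤a 0≤b = subst (_≤ a * b) (ℚ.*-zeroʳ a) (ℚ.*-monoˡ-≤-nonNeg a {{ℚ.nonNegative 0≤a}} 0≤b)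

  slackℚ : ∀ {a b} → a ≤ b → 0ℚ ≤ b - a
  slackℚ {a} {b} a≤b = subst (_≤ b - a) (ℚ.+-inverseʳ a) (ℚ.+-monoˡ-≤ (- a) a≤b)

  unslackℚ : ∀ {a b} → 0ℚ ≤ b - a → a ≤ b
  unslackℚ {a} {b} h = subst₂ _≤_ (ℚ.+-identityˡ a) (lem a b) (ℚ.+-monoˡ-≤ a h)
    where
    lem : ∀ a b → b - a + a ≡ b
    lem = solve-∀ ℚ-ring

  refuteℚ : ∀ {e d} → 0ℚ ≤ e → e ≡ - d → 0ℚ < d → ⊥
  refuteℚ {e} {d} 0≤e refl 0<d =
    ℚ.<-irrefl refl (ℚ.<-≤-trans 0<d (unslackℚ (subst (0ℚ ≤_) (sym (ℚ.+-identityˡ (- d))) 0≤e)))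

  ≤-byContradiction : ∀ {a b} → (b < a → ⊥) → a ≤ b
  ≤-byContradiction = ℚ.≮⇒≥

  p≤∣p∣ : ∀ p → p ≤ ∣ p ∣
  p≤∣p∣ p = [ (λ eq → ℚ.≤-reflexive (sym eq)) , (λ eq →
    unslackℚ (subst (0ℚ ≤_) (cong (λ a → ∣ p ∣ + a) eq) (0≤+ (ℚ.0≤∣p∣ p) (ℚ.0≤∣p∣ p)))) ]′
    (ℚ.∣p∣≡p∨∣p∣≡-p p)

  ∣∣<⇒≤ : ∀ {a b} → ∣ a ∣ < b → a ≤ b
  ∣∣<⇒≤ {a} h = ℚ.≤-trans (p≤∣p∣ a) (ℚ.<⇒≤ h)

  ∣∣<⇒-≤ : ∀ {a b} → ∣ a ∣ < b → - a ≤ b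
  ∣∣<⇒-≤ {a} h = ∣∣<⇒≤ (subst (_< _) (sym (ℚ.∣-p∣≡∣p∣ a)) h)

  ι-≤ : ∀ {a b} → a ℤ.≤ b → ι a ≤ ι b
  ι-≤ {a} {b} h = subst₂ _≤_ (sym (ι-normal a)) (sym (ι-normal b)) (ℚ.*≤* (ℤ.*-monoʳ-≤-nonNeg 1ℤ h))

  ι-cancel-≤ : ∀ {a b} → ι a ≤ ι b → a ℤ.≤ b
  ι-cancel-≤ {a} {b} h =
    subst₂ ℤ._≤_ (ℤ.*-identityʳ a) (ℤ.*-identityʳ b) (ℚ.drop-*≤* (subst₂ _≤_ (ι-normal a) (ι-normal b) h))

  reciprocal : ∀ k → ∃[ δ ] (0ℚ < δ × ι (+ suc k) * δ ≡ 1ℚ)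
  reciprocal k = ℚ.1/ c , ℚ.positive⁻¹ (ℚ.1/ c) {{ℚ.1/pos⇒pos c}} , ℚ.*-inverseʳ c
    where
    c : ℚ
    c = ι (+ suc k)
    instance
      c-pos : ℚ.Positive c
      c-pos = subst ℚ.Positive (sym (ι-normal (+ suc k))) _
      c≢0 : ℚ.NonZero c
      c≢0 = ℚ.pos⇒nonZero c

  0<½ : 0ℚ < ½
  0<½ = ℚ.positive⁻¹ ½

  ≈ℝ-trans : ∀ x y z → x ≈ℝ y → y ≈ℝ z → x ≈ℝ z
  ≈ℝ-trans x y z f g ε 0<ε = M ℕ.⊔ N , λ n ≤n → begin-strict
    ∣ seq x n - seq z n ∣ ≡⟨ cong ∣_∣ (lem (seq x n) (seq y n) (seq z n)) ⟩
    ∣ (seq x n - seq y n) + (seq y n - seq z n) ∣ ≤⟨ ℚ.∣p+q∣≤∣p∣+∣q∣ (seq x n - seq y n) (seq y n - seq z n) ⟩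
    ∣ seq x n - seq y n ∣ + ∣ seq y n - seq z n ∣ <⟨ ℚ.+-mono-< (proj₂ f′ n (ℕ.m⊔n≤o⇒m≤o M N ≤n))
      (proj₂ g′ n (ℕ.m⊔n≤o⇒n≤o M N ≤n)) ⟩
    ½ * ε + ½ * ε ≡⟨ lem₂ ε ⟩
    ε ∎
    where
    open ℚ.≤-Reasoning
    0<ε/2 : 0ℚ < ½ * ε
    0<ε/2 = subst (_< ½ * ε) (ℚ.*-zeroʳ ½) (ℚ.*-monoʳ-<-pos ½ 0<ε)
    f′ : ∃[ N ] (∀ n → N ℕ.≤ n → ∣ seq x n - seq y n ∣ < ½ * ε)
    f′ = f (½ * ε) 0<ε/2
    g′ : ∃[ N ] (∀ n → N ℕ.≤ n → ∣ seq y n - seq z n ∣ < ½ * ε)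
    g′ = g (½ * ε) 0<ε/2
    M N : ℕ
    M = proj₁ f′
    N = proj₁ g′
    lem : ∀ x y z → x - z ≡ (x - y) + (y - z)
    lem = solve-∀ ℚ-ring
    lem₂ : ∀ ε → ½ * ε + ½ * ε ≡ ε
    lem₂ ε = trans (sym (ℚ.*-distribʳ-+ ε ½ ½)) (ℚ.*-identityˡ ε)

  +ℝ-congˡ : ∀ x y z → y ≈ℝ z → (x +ℝ y) ≈ℝ (x +ℝ z)
  +ℝ-congˡ x y z f ε 0<ε = proj₁ (f ε 0<ε) , λ n ≤n →
    subst (_< ε) (cong ∣_∣ (lem (seq x n) (seq y n) (seq z n))) (proj₂ (f ε 0<ε) n ≤n)
    where
    lem : ∀ x y z → y - z ≡ (x + y) - (x + z)
    lem = solve-∀ ℚ-ring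

  +ℝ-congʳ : ∀ x y z → y ≈ℝ z → (y +ℝ x) ≈ℝ (z +ℝ x)
  +ℝ-congʳ x y z f ε 0<ε = proj₁ (f ε 0<ε) , λ n ≤n →
    subst (_< ε) (cong ∣_∣ (lem (seq x n) (seq y n) (seq z n))) (proj₂ (f ε 0<ε) n ≤n)
    where
    lem : ∀ x y z → y - z ≡ (y + x) - (z + x)
    lem = solve-∀ ℚ-ring

  -- Since κ ≥ 1, c bounds √r itself. If c² < r, then r ≥ c² + 1, and this unit gap is contradicted
  -- at a single index of the sequence beyond all three thresholds.
  ceiling-square : ∀ {r c κ} √r → 1 ℕ.≤ κ → IsSqrt (ratℝ (natℚ r)) √r → IsCeiling (ratℝ (natℚ κ) *ℝ √r) c →
    r ℕ.≤ c ℕ.* c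
  ceiling-square {r} {c} {κ} √r 1≤κ (0≤s , s²≈r) (_ , κs≤c) = ℕ.≮⇒≥ λ c²<r → refuteℚ
    (0≤+ (0≤+ (slackℚ (∣∣<⇒-≤ close)) (0≤* (slackℚ S≤C+ε) 0≤C+ε+S)) (0≤+ (slackℚ (large c²<r)) (0≤* (ℚ.<⇒≤ 0<ε) 0≤1-ε)))
    (trans (lem C S R ε) (trans (cong (λ a → a - 1ℚ + - ε) relation) (ℚ.+-identityˡ (- ε)))) 0<ε
    where
    ε C S R k : ℚ
    -- The choice ε = 1 / (2 c + 3) gives (c + ε)² + ε < c² + (2 c + 3) ε = c² + 1.
    ε = proj₁ (reciprocal (2 ℕ.* c ℕ.+ 2))
    0<ε : 0ℚ < ε
    0<ε = proj₁ (proj₂ (reciprocal (2 ℕ.* c ℕ.+ 2)))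
    C = ι (+ c)
    R = ι (+ r)
    k = ι (+ κ)
    i₁ i₂ i₃ i : ℕ
    i₁ = proj₁ (0≤s ε 0<ε)
    i₂ = proj₁ (s²≈r ε 0<ε)
    i₃ = proj₁ (κs≤c ε 0<ε)
    i = i₁ ℕ.⊔ (i₂ ℕ.⊔ i₃)
    S = seq √r i
    0≤S+ε : 0ℚ ≤ S + ε
    0≤S+ε = proj₂ (0≤s ε 0<ε) i (ℕ.m≤m⊔n i₁ (i₂ ℕ.⊔ i₃))
    close : ∣ S * S - R ∣ < ε
    close = proj₂ (s²≈r ε 0<ε) i (ℕ.≤-trans (ℕ.m≤m⊔n i₂ i₃) (ℕ.m≤n⊔m i₁ (i₂ ℕ.⊔ i₃)))
    bound : k * S ≤ C + ε
    bound = proj₂ (κs≤c ε 0<ε) i (ℕ.≤-trans (ℕ.m≤n⊔m i₂ i₃) (ℕ.m≤n⊔m i₁ (i₂ ℕ.⊔ i₃)))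
    relation : (ι (+ 2) * C + ι (+ 3)) * ε ≡ 1ℚ
    relation = trans (cong (_* ε) (trans (cong (_+ ι (+ 3)) (sym (ι-* (+ 2) (+ c))))
      (trans (sym (ι-+ (+ 2 ℤ.* + c) (+ 3)))
      (cong ι (trans (cong (ℤ._+ + 3) (sym (ℤ.pos-* 2 c))) (cong +_ (ℕ.+-suc (2 ℕ.* c) 2)))))))
      (proj₂ (proj₂ (reciprocal (2 ℕ.* c ℕ.+ 2))))
    0≤C : 0ℚ ≤ C
    0≤C = ι-≤ {+ 0} {+ c} (ℤ.+≤+ z≤n)
    0≤ε : 0ℚ ≤ ε
    0≤ε = ℚ.<⇒≤ 0<ε
    0≤1-ε : 0ℚ ≤ 1ℚ - ε
    0≤1-ε = subst (0ℚ ≤_) (trans (lem₁ C ε) (cong (_- ε) relation))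
      (0≤* (0≤+ (0≤* (ι-≤ {+ 0} {+ 2} (ℤ.+≤+ z≤n)) 0≤C) (ι-≤ {+ 0} {+ 2} (ℤ.+≤+ z≤n))) 0≤ε)
      where
      lem₁ : ∀ C ε → (ι (+ 2) * C + ι (+ 2)) * ε ≡ (ι (+ 2) * C + ι (+ 3)) * ε - ε
      lem₁ = solve-∀ ℚ-ring
    S≤C+ε : S ≤ C + ε
    S≤C+ε = ≤-byContradiction λ C+ε<S → ℚ.<-irrefl refl (ℚ.<-≤-trans C+ε<S (ℚ.≤-trans
      (unslackℚ (subst (0ℚ ≤_) (lem₁ k S) (0≤* (slackℚ (ι-≤ {+ 1} {+ κ} (ℤ.+≤+ 1≤κ))) (ℚ.≤-trans (0≤+ 0≤C 0≤ε)
        (ℚ.<⇒≤ C+ε<S))))) bound))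
      where
      lem₁ : ∀ k S → (k - 1ℚ) * S ≡ k * S - S
      lem₁ = solve-∀ ℚ-ring
    0≤C+ε+S : 0ℚ ≤ C + ε + S
    0≤C+ε+S = subst (0ℚ ≤_) (lem₁ C S ε) (0≤+ 0≤C 0≤S+ε)
      where
      lem₁ : ∀ C S ε → C + (S + ε) ≡ C + ε + S
      lem₁ = solve-∀ ℚ-ring
    large : c ℕ.* c ℕ.< r → C * C + 1ℚ ≤ R
    large c²<r = subst (_≤ R)
      (trans (cong ι (trans (cong (ℤ._+_ 1ℤ) (ℤ.pos-* c c)) (ℤ.+-comm 1ℤ (+ c ℤ.* + c))))
      (trans (ι-+ (+ c ℤ.* + c) 1ℤ) (cong (_+ 1ℚ) (ι-* (+ c) (+ c)))))
      (ι-≤ {+ suc (c ℕ.* c)} {+ r} (ℤ.+≤+ c²<r))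
    lem : ∀ C S R ε → (ε - - (S * S - R)) + (C + ε - S) * (C + ε + S) + ((R - (C * C + 1ℚ)) + ε * (1ℚ - ε))
      ≡ (ι (+ 2) * C + ι (+ 3)) * ε - 1ℚ + - ε
    lem = solve-∀ ℚ-ring

  ≡⇒≈ℝ : ∀ x y → (∀ n → seq x n ≡ seq y n) → x ≈ℝ y
  ≡⇒≈ℝ x y h ε 0<ε = 0 , λ n _ →
    subst (_< ε) (sym (trans (cong (λ a → ∣ a - seq y n ∣) (h n)) (cong ∣_∣ (ℚ.+-inverseʳ (seq y n))))) 0<ε

  -- The totally positive integer n + b √D.

  module Element (D n b : ℕ) (above : b ℕ.* b ℕ.* D ℕ.< n ℕ.* n) where

    open Quadratic D
    open CommutativeRing F using (_≈_; rawRing) renaming (Carrier to A; _+_ to _+F_; _*_ to _*F_; 1# to 1F; 0# to 0F)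
    open CommutativeRing F using () renaming (refl to ≈-refl; sym to ≈-sym; trans to ≈-trans)

    α β : A
    α = ι (+ n) +√ ι (+ b)
    β = 0ℚ +√ ι (+ b)

    M : ℕ
    M = b ℕ.* b ℕ.* D

    α≈ : α ≈ (n ·F 1F) +F β
    α≈ = trans (sym (ℚ.+-identityʳ (ι (+ n)))) (cong (λ a → a + 0ℚ) (sym (proj₁ (·F1 n))))
       , trans (sym (ℚ.+-identityˡ (ι (+ b)))) (cong (λ a → a + ι (+ b)) (sym (proj₂ (·F1 n))))

    β²≈ : (β *F β) ≈ (M ·F 1F)
    β²≈ = trans (cong (λ d →
      0ℚ * 0ℚ + d * (ι (+ b) * ι (+ b))) (·1≡ι D)) (trans (lem (ι (+ D)) (ι (+ b)))
      (trans (sym M≡) (sym (proj₁ (·F1 M)))))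
        , trans (lem₂ (ι (+ b))) (sym (proj₂ (·F1 M)))
      where
      lem : ∀ d b → 0ℚ * 0ℚ + d * (b * b) ≡ b * b * d
      lem = solve-∀ ℚ-ring
      lem₂ : ∀ b → 0ℚ * b + b * 0ℚ ≡ 0ℚ
      lem₂ = solve-∀ ℚ-ring
      M≡ : ι (+ M) ≡ ι (+ b) * ι (+ b) * ι (+ D)
      M≡ = trans (cong ι (trans (ℤ.pos-* (b ℕ.* b) D) (cong (ℤ._* + D) (ℤ.pos-* b b))))
        (trans (ι-* (+ b ℤ.* + b) (+ D)) (cong (_* ι (+ D)) (ι-* (+ b) (+ b))))

    -- An embedding is given only as a ring monomorphism, so all that is known of σ(b √D) is that
    -- its square is b² D. The sign is never determined: n² > b² D makes n + s positive for either
    -- root s.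
    totally-positive : TotallyPositive F α
    totally-positive σ mono = δ , 0<δ , i₁ ℕ.⊔ i₂ , λ i ≤i →
      positive (seq (σ β) i) (seq (σ α) i) (proj₂ near-α i (ℕ.m⊔n≤o⇒m≤o i₁ i₂ ≤i))
        (proj₂ near-β i (ℕ.m⊔n≤o⇒n≤o i₁ i₂ ≤i))
      where
      open IsRingMonomorphism mono
      nat-image : ∀ n → σ (n ·F 1F) ≈ℝ ratℝ (ι (+ n))
      nat-image zero    = 0#-homo
      nat-image (suc n) = ≈ℝ-trans (σ (suc n ·F 1F)) (σ 1F +ℝ σ (n ·F 1F)) (ratℝ (ι (+ suc n))) (+-homo 1F (n ·F 1F))
        (≈ℝ-trans (σ 1F +ℝ σ (n ·F 1F)) (ratℝ 1ℚ +ℝ σ (n ·F 1F)) (ratℝ (ι (+ suc n)))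
          (+ℝ-congʳ (σ (n ·F 1F)) (σ 1F) (ratℝ 1ℚ) 1#-homo)
        (≈ℝ-trans (ratℝ 1ℚ +ℝ σ (n ·F 1F)) (ratℝ 1ℚ +ℝ ratℝ (ι (+ n))) (ratℝ (ι (+ suc n)))
          (+ℝ-congˡ (ratℝ 1ℚ) (σ (n ·F 1F)) (ratℝ (ι (+ n))) (nat-image n))
          (≡⇒≈ℝ (ratℝ 1ℚ +ℝ ratℝ (ι (+ n))) (ratℝ (ι (+ suc n))) (λ _ → sym (ι-+ (+ 1) (+ n))))))
      image-α : σ α ≈ℝ (ratℝ (ι (+ n)) +ℝ σ β)
      image-α = ≈ℝ-trans (σ α) (σ ((n ·F 1F) +F β)) (ratℝ (ι (+ n)) +ℝ σ β) (⟦⟧-cong α≈)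
        (≈ℝ-trans (σ ((n ·F 1F) +F β)) (σ (n ·F 1F) +ℝ σ β) (ratℝ (ι (+ n)) +ℝ σ β) (+-homo (n ·F 1F) β)
          (+ℝ-congʳ (σ β) (σ (n ·F 1F)) (ratℝ (ι (+ n))) (nat-image n)))
      ≈ℝ-sym : ∀ x y → x ≈ℝ y → y ≈ℝ x
      ≈ℝ-sym x y f ε 0<ε = proj₁ (f ε 0<ε) , λ n ≤n → subst (_< ε)
        (trans (sym (ℚ.∣-p∣≡∣p∣ (seq x n - seq y n))) (cong ∣_∣ (lem (seq x n) (seq y n)))) (proj₂ (f ε 0<ε) n ≤n)
        where
        lem : ∀ x y → - (x - y) ≡ y - x
        lem = solve-∀ ℚ-ring
      image-β : (σ β *ℝ σ β) ≈ℝ ratℝ (ι (+ M))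
      image-β = ≈ℝ-trans (σ β *ℝ σ β) (σ (β *F β)) (ratℝ (ι (+ M))) (≈ℝ-sym (σ (β *F β)) (σ β *ℝ σ β) (*-homo β β))
        (≈ℝ-trans (σ (β *F β)) (σ (M ·F 1F)) (ratℝ (ι (+ M))) (⟦⟧-cong β²≈) (nat-image M))
      N δ : ℚ
      N = ι (+ n)
      0<n : 0 ℕ.< n
      0<n = ℕ.n≢0⇒n>0 λ { refl → ℕ.n≮0 above }
      -- With 8 n δ = 1 one has (n - 2 δ)² = n² - 1/2 + 4 δ², while s² is within 1/2 of b² D ≤ n² -
      -- 1.
      δ = proj₁ (reciprocal (ℕ.pred (8 ℕ.* n)))
      0<δ : 0ℚ < δ
      0<δ = proj₁ (proj₂ (reciprocal (ℕ.pred (8 ℕ.* n))))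
      relation : ι (+ 8) * N * δ ≡ 1ℚ
      relation = trans (cong (_* δ) (trans (sym (ι-* (+ 8) (+ n))) (cong ι (trans (sym (ℤ.pos-* 8 n))
        (cong +_ (sym (ℕ.suc-pred (8 ℕ.* n) {{ℕ.m*n≢0 8 n {{_}} {{ℕ.>-nonZero 0<n}}}})))))))
        (proj₂ (proj₂ (reciprocal (ℕ.pred (8 ℕ.* n)))))
      near-α : ∃[ i ] (∀ j → i ℕ.≤ j → ∣ seq (σ α) j - (N + seq (σ β) j) ∣ < δ)
      near-α = image-α δ 0<δ
      near-β : ∃[ i ] (∀ j → i ℕ.≤ j → ∣ seq (σ β) j * seq (σ β) j - ι (+ M) ∣ < ½)
      near-β = image-β ½ 0<½
      i₁ i₂ : ℕ
      i₁ = proj₁ near-α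
      i₂ = proj₁ near-β
      0≤δ : 0ℚ ≤ δ
      0≤δ = ℚ.<⇒≤ 0<δ
      1≤N : 1ℚ ≤ N
      1≤N = ι-≤ {+ 1} {+ n} (ℤ.+≤+ 0<n)
      0≤ι : ∀ k → 0ℚ ≤ ι (+ k)
      0≤ι k = ι-≤ {+ 0} {+ k} (ℤ.+≤+ z≤n)
      2δ≤N : 0ℚ ≤ N - (δ + δ)
      2δ≤N = subst (0ℚ ≤_) (trans (lem N δ) (trans (cong (λ a → N - 1ℚ + (a - (δ + δ))) relation) (lem₂ N δ)))
        (0≤+ (slackℚ 1≤N) (0≤+ (0≤* (0≤* (0≤ι 8) (slackℚ 1≤N)) 0≤δ) (0≤* (0≤ι 6) 0≤δ)))
        where
        lem : ∀ N δ → N - 1ℚ + (ι (+ 8) * (N - 1ℚ) * δ + ι (+ 6) * δ) ≡ N - 1ℚ + (ι (+ 8) * N * δ - (δ + δ))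
        lem = solve-∀ ℚ-ring
        lem₂ : ∀ N δ → N - 1ℚ + (1ℚ - (δ + δ)) ≡ N - (δ + δ)
        lem₂ = solve-∀ ℚ-ring
      M-bound : 0ℚ ≤ N * N - ι (+ M) - 1ℚ
      M-bound = subst (0ℚ ≤_) (trans (cong₂ (λ a b →
        a - b) (trans (cong ι (ℤ.pos-* n n)) (ι-* (+ n) (+ n))) (ι-+ 1ℤ (+ M))) (lem (N * N) (ι (+ M))))
        (slackℚ (ι-≤ {+ suc M} {+ (n ℕ.* n)} (ℤ.+≤+ above)))
        where
        lem : ∀ a b → a - (1ℚ + b) ≡ a - b - 1ℚ
        lem = solve-∀ ℚ-ring
      -- If n + s < 2 δ for s ≈ ± b √D, then s² > (n - 2 δ)² > n² - 1/2.
      positive : ∀ s y → ∣ y - (N + s) ∣ < δ → ∣ s * s - ι (+ M) ∣ < ½ → 0ℚ + δ ≤ y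
      positive s y y≈ s²≈ = unslackℚ (subst (0ℚ ≤_) (lem s y N δ) (0≤+ (slackℚ (∣∣<⇒-≤ y≈)) (slackℚ 2δ≤N+s)))
        where
        lem : ∀ s y N δ → (δ - - (y - (N + s))) + (N + s - (δ + δ)) ≡ y - (0ℚ + δ)
        lem = solve-∀ ℚ-ring
        2δ≤N+s : δ + δ ≤ N + s
        2δ≤N+s = ≤-byContradiction λ small → refuteℚ
          (0≤+ (0≤+ (slackℚ (∣∣<⇒≤ s²≈)) M-bound)
            (0≤* (slackℚ (ℚ.<⇒≤ small)) (0≤+ (slackℚ (ℚ.<⇒≤ small)) (0≤+ 2δ≤N 2δ≤N))))
          (trans (lem₁ s N δ (ι (+ M))) (trans (cong (λ a →
            ½ * a - ½ - (δ + δ) * (δ + δ)) relation) (ℚ.+-identityˡ (- ((δ + δ) * (δ + δ))))))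
          (0<square (δ + δ) (ℚ.+-mono-< 0<δ 0<δ))
          where
          0<square : ∀ a → 0ℚ < a → 0ℚ < a * a
          0<square a 0<a = subst (_< a * a) (ℚ.*-zeroʳ a) (ℚ.*-monoʳ-<-pos a {{ℚ.positive 0<a}} 0<a)
          lem₁ : ∀ s N δ M → (½ - (s * s - M)) + (N * N - M - 1ℚ) +
            ((δ + δ - (N + s)) * ((δ + δ - (N + s)) + ((N - (δ + δ)) + (N - (δ + δ)))))
            ≡ ½ * (ι (+ 8) * N * δ) - ½ - (δ + δ) * (δ + δ)
          lem₁ = solve-∀ ℚ-ring

    fromℤ-coordinates : ∀ z → re (fromℤ F z) ≡ ι z × im (fromℤ F z) ≡ 0ℚ
    fromℤ-coordinates (+ n)    = ·F1 n
    fromℤ-coordinates -[1+ n ] =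
      trans (cong -_ (proj₁ (·F1 (suc n)))) (sym (ι-neg (+ suc n))) , cong -_ (proj₂ (·F1 (suc n)))

    multiple-coordinates : ∀ m → re (m ·F α) ≡ ι (+ m) * ι (+ n) × im (m ·F α) ≡ ι (+ m) * ι (+ b)
    multiple-coordinates zero    = sym (ℚ.*-zeroˡ (ι (+ n))) , sym (ℚ.*-zeroˡ (ι (+ b)))
    multiple-coordinates (suc m) =
        trans (cong (λ a → ι (+ n) + a) (proj₁ (multiple-coordinates m))) (trans (lem (ι (+ m)) (ι (+ n)))
          (cong (λ a → a * ι (+ n)) (sym (ι-+ (+ 1) (+ m)))))
      , trans (cong (λ a → ι (+ b) + a) (proj₂ (multiple-coordinates m))) (trans (lem (ι (+ m)) (ι (+ b)))
        (cong (λ a → a * ι (+ b)) (sym (ι-+ (+ 1) (+ m)))))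
      where
      lem : ∀ m n → n + m * n ≡ (1ℚ + m) * n
      lem = solve-∀ ℚ-ring

    -- α is a root of X² - 2 n X + (n² - b² D).
    integral : IsIntegral F α
    integral = 2 , coefficient , trans (values (λ d r₀ i₀ r₁ i₁ →
      RE d r₀ i₀ r₁ i₁)) (trans (lem₁ N B (ι (+ D))) refl) , trans (values IM) (lem₂ N B (ι (+ D)))
      where
      c₀ c₁ : ℤ
      c₀ = + n ℤ.* + n ℤ.- + b ℤ.* + b ℤ.* + D
      c₁ = ℤ.- (+ 2 ℤ.* + n)
      coefficient : Fin 2 → ℤ
      coefficient zero    = c₀
      coefficient (suc _) = c₁
      N B : ℚ
      N = ι (+ n)
      B = ι (+ b)
      RE IM : ℚ → ℚ → ℚ → ℚ → ℚ → ℚ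
      RE d r₀ i₀ r₁ i₁ = N * (N * 1ℚ + d * (B * 0ℚ)) + d * (B * (N * 0ℚ + B * 1ℚ))
        + (r₀ * 1ℚ + d * (i₀ * 0ℚ) + (r₁ * (N * 1ℚ + d * (B * 0ℚ)) + d * (i₁ * (N * 0ℚ + B * 1ℚ)) + 0ℚ))
      IM d r₀ i₀ r₁ i₁ = N * (N * 0ℚ + B * 1ℚ) + B * (N * 1ℚ + d * (B * 0ℚ))
        + (r₀ * 0ℚ + i₀ * 1ℚ + (r₁ * (N * 0ℚ + B * 1ℚ) + i₁ * (N * 1ℚ + d * (B * 0ℚ)) + 0ℚ))
      c₀≡ : ι c₀ ≡ N * N - B * B * ι (+ D)
      c₀≡ = trans (ι-sub (+ n ℤ.* + n) (+ b ℤ.* + b ℤ.* + D)) (cong₂ _-_ (ι-* (+ n) (+ n))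
        (trans (ι-* (+ b ℤ.* + b) (+ D)) (cong (_* ι (+ D)) (ι-* (+ b) (+ b)))))
      c₁≡ : ι c₁ ≡ - (ι (+ 2) * N)
      c₁≡ = trans (ι-neg (+ 2 ℤ.* + n)) (cong -_ (ι-* (+ 2) (+ n)))
      values : ∀ (f : ℚ → ℚ → ℚ → ℚ → ℚ → ℚ) →
        f (D ·ℚ 1ℚ) (re (fromℤ F c₀)) (im (fromℤ F c₀)) (re (fromℤ F c₁)) (im (fromℤ F c₁))
          ≡ f (ι (+ D)) (N * N - B * B * ι (+ D)) 0ℚ (- (ι (+ 2) * N)) 0ℚ
      values f = cong₅ (·1≡ι D) (trans (proj₁ (fromℤ-coordinates c₀)) c₀≡) (proj₂ (fromℤ-coordinates c₀))
        (trans (proj₁ (fromℤ-coordinates c₁)) c₁≡) (proj₂ (fromℤ-coordinates c₁))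
        where
        cong₅ : ∀ {a a′ b b′ c c′ d d′ e e′} → a ≡ a′ → b ≡ b′ → c ≡ c′ → d ≡ d′ → e ≡ e′ →
          f a b c d e ≡ f a′ b′ c′ d′ e′
        cong₅ refl refl refl refl refl = refl
      lem₁ : ∀ N B d → N * (N * 1ℚ + d * (B * 0ℚ)) + d * (B * (N * 0ℚ + B * 1ℚ))
        + ((N * N - B * B * d) * 1ℚ + d * (0ℚ * 0ℚ) + (- (ι (+ 2) * N) * (N * 1ℚ + d * (B * 0ℚ)) + d *
          (0ℚ * (N * 0ℚ + B * 1ℚ)) + 0ℚ)) ≡ 0ℚ
      lem₁ = solve-∀ ℚ-ring
      lem₂ : ∀ N B d → N * (N * 0ℚ + B * 1ℚ) + B * (N * 1ℚ + d * (B * 0ℚ))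
        + ((N * N - B * B * d) * 0ℚ + 0ℚ * 1ℚ + (- (ι (+ 2) * N) * (N * 0ℚ + B * 1ℚ) + 0ℚ *
          (N * 1ℚ + d * (B * 0ℚ)) + 0ℚ)) ≡ 0ℚ
      lem₂ = solve-∀ ℚ-ring

    multiple-in-𝒪⁺ : ∀ m → multiple𝒪⁺ F m (m ·F α)
    multiple-in-𝒪⁺ m = α , (integral , totally-positive) , (refl , refl)

  -- Square-free numbers and clearing fractions.

  squarefree-divisor : ∀ {a b} → a ℕ.∣ b → SquareFree b → SquareFree a
  squarefree-divisor a∣b sf d d²∣a = sf d (ℕ.∣-trans d²∣a a∣b)

  reduced : ∀ m n → n ≢ 0 → ∃[ m₁ ] ∃[ n₁ ] (m ≡ gcd m n ℕ.* m₁ × n ≡ gcd m n ℕ.* n₁ × Coprime m₁ n₁)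
  reduced m n n≢0 = m ℕ./ gcd m n , n ℕ./ gcd m n , sym (ℕ.m*[n/m]≡n (GCD.gcd[m,n]∣m m n)) , sym
    (ℕ.m*[n/m]≡n (GCD.gcd[m,n]∣n m n))
    , Coprime.coprime-/gcd m n
    where
    instance
      gcd≢0 : ℕ.NonZero (gcd m n)
      gcd≢0 = ℕ.≢-nonZero (GCD.gcd[m,n]≢0 m n (inj₂ n≢0))

  squarefree⇒≢0 : ∀ {a} → SquareFree a → a ≢ 0
  squarefree⇒≢0 sf refl with sf 2 (ℕ.divides 0 refl)
  ... | ()

  -- Write d = e d₁ and a = e a₁ with e = gcd(d, a). Cancelling one e leaves d₁² dividing a₁ b, and
  -- d₁ is prime to a₁, so d₁² divides b and d₁ = 1. Thus d divides a, is prime to b, and d² divides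
  -- a.
  squarefree-* : ∀ {a b} → Coprime a b → SquareFree a → SquareFree b → SquareFree (a ℕ.* b)
  squarefree-* {a} {b} a⊥b sfa sfb d d²∣ab =
    sfa d (Coprime.coprime-divisor d²⊥b (subst (d ℕ.* d ℕ.∣_) (ℕ.*-comm a b) d²∣ab))
    where
    e d₁ a₁ : ℕ
    e = gcd d a
    d₁ = proj₁ (reduced d a (squarefree⇒≢0 sfa))
    a₁ = proj₁ (proj₂ (reduced d a (squarefree⇒≢0 sfa)))
    d≡ : d ≡ e ℕ.* d₁
    d≡ = proj₁ (proj₂ (proj₂ (reduced d a (squarefree⇒≢0 sfa))))
    a≡ : a ≡ e ℕ.* a₁
    a≡ = proj₁ (proj₂ (proj₂ (proj₂ (reduced d a (squarefree⇒≢0 sfa)))))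
    d₁⊥a₁ : Coprime d₁ a₁
    d₁⊥a₁ = proj₂ (proj₂ (proj₂ (proj₂ (reduced d a (squarefree⇒≢0 sfa)))))
    instance
      e≢0 : ℕ.NonZero e
      e≢0 = ℕ.≢-nonZero (GCD.gcd[m,n]≢0 d a (inj₂ (squarefree⇒≢0 sfa)))
    d₁²∣a₁b : d₁ ℕ.* d₁ ℕ.∣ a₁ ℕ.* b
    d₁²∣a₁b = ℕ.∣-trans (ℕ.divides e refl) (ℕ.*-cancelˡ-∣ e (subst₂ ℕ._∣_
      (trans (cong₂ ℕ._*_ d≡ d≡) (trans (ℕ.*-assoc e d₁ (e ℕ.* d₁)) (cong (e ℕ.*_) (swap d₁ e d₁))))
      (trans (cong (ℕ._* b) a≡) (ℕ.*-assoc e a₁ b)) d²∣ab))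
      where
      swap : ∀ x y z → x ℕ.* (y ℕ.* z) ≡ y ℕ.* (x ℕ.* z)
      swap x y z = trans (sym (ℕ.*-assoc x y z)) (trans (cong (ℕ._* z) (ℕ.*-comm x y)) (ℕ.*-assoc y x z))
    d₁≡1 : d₁ ≡ 1
    d₁≡1 = sfb d₁ (Coprime.coprime-divisor (Coprime.sym (coprime-*ʳ (Coprime.sym d₁⊥a₁) (Coprime.sym d₁⊥a₁)))
      d₁²∣a₁b)
    d∣a : d ℕ.∣ a
    d∣a = subst (ℕ._∣ a) (sym (trans d≡ (trans (cong (e ℕ.*_) d₁≡1) (ℕ.*-identityʳ e)))) (GCD.gcd[m,n]∣n d a)
    b⊥d : Coprime b d
    b⊥d (x∣b , x∣d) = a⊥b (ℕ.∣-trans x∣d d∣a , x∣b)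
    d²⊥b : Coprime (d ℕ.* d) b
    d²⊥b = Coprime.sym (coprime-*ʳ b⊥d b⊥d)

  fraction : ∀ a k → (+ a / suc k) * ι (+ suc k) ≡ ι (+ a)
  fraction a k = trans (cong ((+ a / suc k) *_) (ι-normal (+ suc k))) (trans
    (ℚ.toℚᵘ-injective {_} {intℚ (+ a)} (ℚᵘ.≃-trans (ℚ.toℚᵘ-homo-* (+ a / suc k) (intℚ (+ suc k)))
      (ℚᵘ.≃-trans (ℚᵘ.*-congʳ (ℚ.toℚᵘ-fromℚᵘ (mkℚᵘ (+ a) k))) (*≡* (lem (+ a) (+ suc k))))))
    (sym (ι-normal (+ a))))
    where
    lem : ∀ u v → u ℤ.* v ℤ.* 1ℤ ≡ u ℤ.* (v ℤ.* 1ℤ)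
    lem = ℤsolve-∀

  module _ (p q : ℕ) where

    open Field p q
    open RawSemiringOps (RawRing.rawSemiring K.rawRing) using () renaming (sum to sumK)

    coordinate-sum : ∀ (φ : K.Carrier → ℚ) → φ K.0# ≡ 0ℚ → (∀ x y → φ (x K.+ y) ≡ φ x + φ y) →
      ∀ {l} (f : Fin l → K.Carrier) (z : Fin l → ℤ) → (∀ i → ι (+ 4) * φ (f i) ≡ ι (z i)) →
      ι (+ 4) * φ (sumK f) ≡ ι (sum z)
    coordinate-sum φ φ-0 φ-+ {zero}  f z h = trans (cong (λ a → ι (+ 4) * a) φ-0) refl
    coordinate-sum φ φ-0 φ-+ {suc l} f z h = begin
      ι (+ 4) * φ (f zero K.+ sumK (λ i → f (suc i)))
        ≡⟨ cong (λ a → ι (+ 4) * a) (φ-+ (f zero) (sumK (λ i → f (suc i)))) ⟩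
      ι (+ 4) * (φ (f zero) + φ (sumK (λ i → f (suc i))))
        ≡⟨ ℚ.*-distribˡ-+ (ι (+ 4)) (φ (f zero)) (φ (sumK (λ i → f (suc i)))) ⟩
      ι (+ 4) * φ (f zero) + ι (+ 4) * φ (sumK (λ i → f (suc i)))
        ≡⟨ cong₂ _+_ (h zero) (coordinate-sum φ φ-0 φ-+ (λ i → f (suc i)) (λ i → z (suc i)) (λ i → h (suc i))) ⟩
      ι (z zero) + ι (sum (λ i → z (suc i)))
        ≡⟨ ι-+ (z zero) (sum (λ i → z (suc i))) ⟨
      ι (z zero ℤ.+ sum (λ i → z (suc i))) ∎
      where open ≡-Reasoning

  admissible-nat : ∀ {D m} → 0ℤ ℤ.< m → (m ℤ.+ + 8) ℤ.* (m ℤ.+ + 8) ℤ.≤ + 4 ℤ.* D → NonSquare D →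
    ∃[ b ] ∃[ n ] Admissible D m (+ b) (+ n)
  admissible-nat 0<m big nonsquare with admissible 0<m big nonsquare
  ... | + b , + n , G = b , n , G
  ... | + b , -[1+ n ] , G with Admissible.0<n G
  ...   | ()
  admissible-nat 0<m big nonsquare | -[1+ b ] , n , G with Admissible.0<b G
  ...   | ()

  pos-above : ∀ {b n D} {D′ : ℤ} → + D ≡ D′ → + b ℤ.* + b ℤ.* D′ ℤ.< + n ℤ.* + n → b ℕ.* b ℕ.* D ℕ.< n ℕ.* n
  pos-above {b} {n} {D} refl h = ℤ.drop‿+<+ (subst₂ ℤ._<_
    (trans (cong (ℤ._* + D) (sym (ℤ.pos-* b b))) (sym (ℤ.pos-* (b ℕ.* b) D))) (sym (ℤ.pos-* n n)) h)

  -- Comparison of coordinates in a sum of squares of integers of K.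

  module Multiples {p q g p′ q′ m c : ℕ} (p≡ : p ≡ g ℕ.* p′) (q≡ : q ≡ g ℕ.* q′) (p′⊥q′ : Coprime p′ q′)
    (p-squarefree : SquareFree p) (q-squarefree : SquareFree q) {p₀ q₀ r₀ g₁ q₁ : ℤ}
    (p-mod : + p ≡ + 4 ℤ.* p₀ ℤ.+ + 2) (q-mod : + q ≡ + 4 ℤ.* q₀ ℤ.+ + 3) (r-mod : + (p′ ℕ.* q′) ≡ + 4 ℤ.* r₀ ℤ.+ + 2)
    (g-odd : + g ≡ + 2 ℤ.* g₁ ℤ.+ 1ℤ) (q′-odd : + q′ ≡ + 2 ℤ.* q₁ ℤ.+ 1ℤ)
    (p<q : p ℕ.< q) (q<r : q ℕ.< p′ ℕ.* q′) (1≤m : 1 ℕ.≤ m) (1≤c : 1 ℕ.≤ c)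
    (4mc≤r : 4 ℕ.* m ℕ.* c ℕ.≤ p′ ℕ.* q′) (r≤c² : p′ ℕ.* q′ ℕ.≤ c ℕ.* c)
    (p-large : (+ m ℤ.+ + 8) ℤ.* (+ m ℤ.+ + 8) ℤ.≤ + 4 ℤ.* + p) (q-large : (+ m ℤ.+ + 8) ℤ.*
      (+ m ℤ.+ + 8) ℤ.≤ + 4 ℤ.* + q)
    where

    p≡ℤ : + p ≡ + g ℤ.* + p′
    p≡ℤ = trans (cong +_ p≡) (ℤ.pos-* g p′)

    q≡ℤ : + q ≡ + g ℤ.* + q′
    q≡ℤ = trans (cong +_ q≡) (ℤ.pos-* g q′)

    r≡ℤ : + (p′ ℕ.* q′) ≡ + p′ ℤ.* + q′
    r≡ℤ = ℤ.pos-* p′ q′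

    p′<q′ : p′ ℕ.< q′
    p′<q′ = ℕ.*-cancelˡ-< g p′ q′ (subst₂ ℕ._<_ p≡ q≡ p<q)

    p≢0 : g ℕ.* p′ ≢ 0
    p≢0 eq = squarefree⇒≢0 p-squarefree (trans p≡ eq)

    0<g : 0 ℕ.< g
    0<g = ℕ.n≢0⇒n>0 λ { refl → p≢0 refl }

    0<p′ : 0 ℕ.< p′
    0<p′ = ℕ.n≢0⇒n>0 λ { refl → p≢0 (ℕ.*-zeroʳ g) }

    open Core {+ g} {+ p′} {+ q′} {+ m} {+ c} (ℤ.+<+ 0<g) (ℤ.+<+ 0<p′) (ℤ.+<+ p′<q′) (ℤ.+<+ 1≤m) (ℤ.+<+ 1≤c)
      (subst₂ ℤ._≤_ (trans (ℤ.pos-* (4 ℕ.* m) c) (cong (ℤ._* + c) (ℤ.pos-* 4 m))) r≡ℤ (ℤ.+≤+ 4mc≤r))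
      (subst₂ ℤ._≤_ r≡ℤ (ℤ.pos-* c c) (ℤ.+≤+ r≤c²))
      (subst₂ ℤ._<_ q≡ℤ r≡ℤ (ℤ.+<+ q<r))

    open Integral {p} {q} {g} {p′} {q′} p≡ q≡ p-squarefree q-squarefree
      (squarefree-* p′⊥q′ (squarefree-divisor (ℕ.divides g p≡) p-squarefree)
        (squarefree-divisor (ℕ.divides g q≡) q-squarefree))
      {p₀} {q₀} {r₀} {q₁} p-mod q-mod r-mod q′-odd

    module Square {x : K.Carrier} (x-coordinates : Coordinates x) where

      open Coordinates x-coordinates

      private
        a b c′ d k : ℚ
        a = re (re x)
        b = im (re x)
        c′ = re (im x)
        d = im (im x)
        k = ι (+ 2)

      square-1 : ι (+ 4) * re (re (x K.* x)) ≡ ι (+ 4 ℤ.* (X ℤ.* X) ℤ.+ + g ℤ.* + p′ ℤ.* (Y ℤ.* Y)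
        ℤ.+ (+ 4 ℤ.* (+ g ℤ.* + q′ ℤ.* (Z ℤ.* Z)) ℤ.+ + p′ ℤ.* + q′ ℤ.* (W ℤ.* W)))
      square-1 = begin
        ι (+ 4) * re (re (x K.* x))
          ≡⟨ cong₂ _*_ (ι-* (+ 2) (+ 2)) (proj₁ (proj₁ (*≈⊛ x x))) ⟩
        k * k * (a * a + P * (b * b) + Q * (c′ * c′) + P * Q * (d * d))
          ≡⟨ cong (λ PQ → k * k * (a * a + P * (b * b) + Q * (c′ * c′) + PQ * (d * d))) PQ≡ ⟩
        k * k * (a * a + P * (b * b) + Q * (c′ * c′) + R * (G * G) * (d * d))
          ≡⟨ lem k P Q R G a b c′ d ⟩
        k * k * (a * a) + P * (k * b * (k * b)) + (k * k * (Q * (c′ * c′)) + R * (k * (G * d) * (k * (G * d))))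
          ≡⟨ cong₂ (λ a b → k * k * (a * a) + P * (b * b) + (k * k * (Q * (c′ * c′)) + R *
            (k * (G * d) * (k * (G * d))))) X≡ Y≡ ⟩
        k * k * (ι X * ι X) + P * (ι Y * ι Y) + (k * k * (Q * (c′ * c′)) + R * (k * (G * d) * (k * (G * d))))
          ≡⟨ cong₂ (λ c d → k * k * (ι X * ι X) + P * (ι Y * ι Y) + (k * k * (Q * (c * c)) + R * (d * d))) Z≡ W≡ ⟩
        k * k * (ι X * ι X) + P * (ι Y * ι Y) + (k * k * (Q * (ι Z * ι Z)) + R * (ι W * ι W))
          ≡⟨ cong₂ _+_ (cong₂ _+_ (ι-*² (+ 4) X) (term p≡ℤ Y))
            (cong₂ _+_ (trans (ι-* (+ 4) (+ g ℤ.* + q′ ℤ.* (Z ℤ.* Z))) (cong (λ z →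
            ι (+ 4) * z) (term q≡ℤ Z))) (term r≡ℤ W)) ⟨
        ι (+ 4 ℤ.* (X ℤ.* X)) + ι (+ g ℤ.* + p′ ℤ.* (Y ℤ.* Y)) + (ι (+ 4 ℤ.* (+ g ℤ.* + q′ ℤ.* (Z ℤ.* Z))) + ι
          (+ p′ ℤ.* + q′ ℤ.* (W ℤ.* W)))
          ≡⟨ cong₂ _+_ (ι-+ (+ 4 ℤ.* (X ℤ.* X)) (+ g ℤ.* + p′ ℤ.* (Y ℤ.* Y)))
               (ι-+ (+ 4 ℤ.* (+ g ℤ.* + q′ ℤ.* (Z ℤ.* Z))) (+ p′ ℤ.* + q′ ℤ.* (W ℤ.* W))) ⟨
        ι (+ 4 ℤ.* (X ℤ.* X) ℤ.+ + g ℤ.* + p′ ℤ.* (Y ℤ.* Y)) + ι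
          (+ 4 ℤ.* (+ g ℤ.* + q′ ℤ.* (Z ℤ.* Z)) ℤ.+ + p′ ℤ.* + q′ ℤ.* (W ℤ.* W))
          ≡⟨ ι-+ (+ 4 ℤ.* (X ℤ.* X) ℤ.+ + g ℤ.* + p′ ℤ.* (Y ℤ.* Y))
            (+ 4 ℤ.* (+ g ℤ.* + q′ ℤ.* (Z ℤ.* Z)) ℤ.+ + p′ ℤ.* + q′ ℤ.* (W ℤ.* W)) ⟨
        ι (+ 4 ℤ.* (X ℤ.* X) ℤ.+ + g ℤ.* + p′ ℤ.* (Y ℤ.* Y) ℤ.+
          (+ 4 ℤ.* (+ g ℤ.* + q′ ℤ.* (Z ℤ.* Z)) ℤ.+ + p′ ℤ.* + q′ ℤ.* (W ℤ.* W))) ∎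
        where
        open ≡-Reasoning
        term : ∀ {h h′} → + h ≡ h′ → ∀ y → ι (h′ ℤ.* (y ℤ.* y)) ≡ ι (+ h) * (ι y * ι y)
        term {h} refl y = ι-*² (+ h) y
        lem : ∀ k P Q R G a b c d → k * k * (a * a + P * (b * b) + Q * (c * c) + R * (G * G) * (d * d))
          ≡ k * k * (a * a) + P * (k * b * (k * b)) + (k * k * (Q * (c * c)) + R * (k * (G * d) * (k * (G * d))))
        lem = solve-∀ ℚ-ring

      double : ∀ s → s + s ≡ k * s
      double = solve-∀ ℚ-ring

      square-√p : ι (+ 4) * im (re (x K.* x)) ≡ ι (+ 4 ℤ.* (X ℤ.* Y) ℤ.+ + 4 ℤ.* (+ q′ ℤ.* (Z ℤ.* W)))
      square-√p = begin
        ι (+ 4) * im (re (x K.* x))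
          ≡⟨ cong (λ s → ι (+ 4) * s) (proj₂ (proj₁ (*≈⊛ x x))) ⟩
        ι (+ 4) * (a * b + b * a + Q * (c′ * d + d * c′))
          ≡⟨ cong (λ Q → ι (+ 4) * (a * b + b * a + Q * (c′ * d + d * c′))) Q≡ ⟩
        ι (+ 4) * (a * b + b * a + G * Q′ * (c′ * d + d * c′))
          ≡⟨ cong (λ s → ι (+ 4) * s) (lem₁ (G * Q′) a b c′ d) ⟩
        ι (+ 4) * (a * b + G * Q′ * (c′ * d) + (a * b + G * Q′ * (c′ * d)))
          ≡⟨ cong (λ s → ι (+ 4) * s) (double (a * b + G * Q′ * (c′ * d))) ⟩
        ι (+ 4) * (k * (a * b + G * Q′ * (c′ * d)))
          ≡⟨ lem₂ (ι (+ 4)) k G Q′ a b c′ d ⟩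
        ι (+ 4) * (a * (k * b)) + ι (+ 4) * (Q′ * (c′ * (k * (G * d))))
          ≡⟨ cong₂ (λ a b → ι (+ 4) * (a * b) + ι (+ 4) * (Q′ * (c′ * (k * (G * d))))) X≡ Y≡ ⟩
        ι (+ 4) * (ι X * ι Y) + ι (+ 4) * (Q′ * (c′ * (k * (G * d))))
          ≡⟨ cong₂ (λ c d → ι (+ 4) * (ι X * ι Y) + ι (+ 4) * (Q′ * (c * d))) Z≡ W≡ ⟩
        ι (+ 4) * (ι X * ι Y) + ι (+ 4) * (Q′ * (ι Z * ι W))
          ≡⟨ cong₂ _+_ (trans (ι-* (+ 4) (X ℤ.* Y)) (cong (λ s → ι (+ 4) * s) (ι-* X Y)))
               (trans (ι-* (+ 4) (+ q′ ℤ.* (Z ℤ.* W))) (cong (λ s →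
                 ι (+ 4) * s) (trans (ι-* (+ q′) (Z ℤ.* W)) (cong (λ s → Q′ * s) (ι-* Z W))))) ⟨
        ι (+ 4 ℤ.* (X ℤ.* Y)) + ι (+ 4 ℤ.* (+ q′ ℤ.* (Z ℤ.* W)))
          ≡⟨ ι-+ (+ 4 ℤ.* (X ℤ.* Y)) (+ 4 ℤ.* (+ q′ ℤ.* (Z ℤ.* W))) ⟨
        ι (+ 4 ℤ.* (X ℤ.* Y) ℤ.+ + 4 ℤ.* (+ q′ ℤ.* (Z ℤ.* W))) ∎
        where
        open ≡-Reasoning
        lem₁ : ∀ Q a b c d → a * b + b * a + Q * (c * d + d * c) ≡ a * b + Q * (c * d) + (a * b + Q * (c * d))
        lem₁ = solve-∀ ℚ-ring
        lem₂ : ∀ j k G q a b c d →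
          j * (k * (a * b + G * q * (c * d))) ≡ j * (a * (k * b)) + j * (q * (c * (k * (G * d))))
        lem₂ = solve-∀ ℚ-ring

      square-√q : ι (+ 4) * re (im (x K.* x)) ≡ ι (+ 8 ℤ.* (X ℤ.* Z) ℤ.+ + 2 ℤ.* (+ p′ ℤ.* (Y ℤ.* W)))
      square-√q = begin
        ι (+ 4) * re (im (x K.* x))
          ≡⟨ cong₂ _*_ (ι-* (+ 2) (+ 2)) (proj₁ (proj₂ (*≈⊛ x x))) ⟩
        k * k * (a * c′ + c′ * a + P * (b * d + d * b))
          ≡⟨ cong (λ P → k * k * (a * c′ + c′ * a + P * (b * d + d * b))) P≡ ⟩
        k * k * (a * c′ + c′ * a + G * ι (+ p′) * (b * d + d * b))
          ≡⟨ cong (λ s → k * k * s) (lem₁ (G * ι (+ p′)) a b c′ d) ⟩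
        k * k * (a * c′ + G * ι (+ p′) * (b * d) + (a * c′ + G * ι (+ p′) * (b * d)))
          ≡⟨ cong (λ s → k * k * s) (double (a * c′ + G * ι (+ p′) * (b * d))) ⟩
        k * k * (k * (a * c′ + G * ι (+ p′) * (b * d)))
          ≡⟨ lem₂ k G (ι (+ p′)) a b c′ d ⟩
        k * (k * k) * (a * c′) + k * (ι (+ p′) * (k * b * (k * (G * d))))
          ≡⟨ cong₂ (λ a c → k * (k * k) * (a * c) + k * (ι (+ p′) * (k * b * (k * (G * d))))) X≡ Z≡ ⟩
        k * (k * k) * (ι X * ι Z) + k * (ι (+ p′) * (k * b * (k * (G * d))))
          ≡⟨ cong₂ (λ b d → k * (k * k) * (ι X * ι Z) + k * (ι (+ p′) * (b * d))) Y≡ W≡ ⟩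
        k * (k * k) * (ι X * ι Z) + k * (ι (+ p′) * (ι Y * ι W))
          ≡⟨ cong₂ _+_ (trans (ι-* (+ 8) (X ℤ.* Z)) (cong₂ _*_ (trans (ι-* (+ 2) (+ 4)) (cong (λ s →
            k * s) (ι-* (+ 2) (+ 2)))) (ι-* X Z)))
               (trans (ι-* (+ 2) (+ p′ ℤ.* (Y ℤ.* W))) (cong (λ s →
                 k * s) (trans (ι-* (+ p′) (Y ℤ.* W)) (cong (λ s → ι (+ p′) * s) (ι-* Y W))))) ⟨
        ι (+ 8 ℤ.* (X ℤ.* Z)) + ι (+ 2 ℤ.* (+ p′ ℤ.* (Y ℤ.* W)))
          ≡⟨ ι-+ (+ 8 ℤ.* (X ℤ.* Z)) (+ 2 ℤ.* (+ p′ ℤ.* (Y ℤ.* W))) ⟨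
        ι (+ 8 ℤ.* (X ℤ.* Z) ℤ.+ + 2 ℤ.* (+ p′ ℤ.* (Y ℤ.* W))) ∎
        where
        open ≡-Reasoning
        lem₁ : ∀ P a b c d → a * c + c * a + P * (b * d + d * b) ≡ a * c + P * (b * d) + (a * c + P * (b * d))
        lem₁ = solve-∀ ℚ-ring
        lem₂ : ∀ k G p a b c d →
          k * k * (k * (a * c + G * p * (b * d))) ≡ k * (k * k) * (a * c) + k * (p * (k * b * (k * (G * d))))
        lem₂ = solve-∀ ℚ-ring

    private
      0<m : 0ℤ ℤ.< + m
      0<m = ℤ.+<+ 1≤m

      scaled : ∀ {s t z} (h : ι (+ 4) * s ≡ ι z) → s ≡ ι (+ m) * ι (+ t) → z ≡ + 4 ℤ.* + m ℤ.* + t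
      scaled {s} {t} {z} h eq = ι-injective (begin
        ι z ≡⟨ h ⟨
        ι (+ 4) * s ≡⟨ cong (λ s → ι (+ 4) * s) eq ⟩
        ι (+ 4) * (ι (+ m) * ι (+ t)) ≡⟨ ℚ.*-assoc (ι (+ 4)) (ι (+ m)) (ι (+ t)) ⟨
        ι (+ 4) * ι (+ m) * ι (+ t) ≡⟨ cong (λ s → s * ι (+ t)) (ι-* (+ 4) (+ m)) ⟨
        ι (+ 4 ℤ.* + m) * ι (+ t) ≡⟨ ι-* (+ 4 ℤ.* + m) (+ t) ⟨
        ι (+ 4 ℤ.* + m ℤ.* + t) ∎)
        where open ≡-Reasoning

    module Sums {l} (a : Fin l → K.Carrier) (integral : ∀ i → IsIntegral K (a i)) where

      open RawSemiringOps (RawRing.rawSemiring K.rawRing) using () renaming (sum to sumK)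

      coordinate : ∀ i → Coordinates (a i)
      coordinate i = coordinates (a i) (integral i)

      X Y Z W e : Fin l → ℤ
      X i = Coordinates.X (coordinate i)
      Y i = Coordinates.Y (coordinate i)
      Z i = Coordinates.Z (coordinate i)
      W i = Coordinates.W (coordinate i)
      e i = Coordinates.e (coordinate i)

      Y≡W : ∀ i → Y i ≡ W i ℤ.+ + 2 ℤ.* e i
      Y≡W i = Coordinates.Y≡W (coordinate i)

      squares : K.Carrier
      squares = sumK (λ i → a i K.* a i)

      sum-1 : ι (+ 4) * re (re squares) ≡ ι (sum (λ i → + 4 ℤ.* (X i ℤ.* X i) ℤ.+ + g ℤ.* + p′ ℤ.* (Y i ℤ.* Y i)
        ℤ.+ (+ 4 ℤ.* (+ g ℤ.* + q′ ℤ.* (Z i ℤ.* Z i)) ℤ.+ + p′ ℤ.* + q′ ℤ.* (W i ℤ.* W i))))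
      sum-1 = coordinate-sum p q (λ x → re (re x)) refl (λ _ _ → refl) (λ i → a i K.* a i) _ (λ i →
        Square.square-1 (coordinate i))

      sum-√p : ι (+ 4) * im (re squares) ≡ ι (sum (λ i → + 4 ℤ.* (X i ℤ.* Y i) ℤ.+ + 4 ℤ.* (+ q′ ℤ.* (Z i ℤ.* W i))))
      sum-√p = coordinate-sum p q (λ x → im (re x)) refl (λ _ _ → refl) (λ i → a i K.* a i) _ (λ i →
        Square.square-√p (coordinate i))

      sum-√q : ι (+ 4) * re (im squares) ≡ ι (sum (λ i → + 8 ℤ.* (X i ℤ.* Z i) ℤ.+ + 2 ℤ.* (+ p′ ℤ.* (Y i ℤ.* W i))))
      sum-√q = coordinate-sum p q (λ x → re (im x)) refl (λ _ _ → refl) (λ i → a i K.* a i) _ (λ i →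
        Square.square-√q (coordinate i))

    not-all₁ : ¬ (∀ β → multiple𝒪⁺ ℚ⟨√ p ⟩ m β → IsSumOfIntegralSquares ℚ⟨√ p ,√ q ⟩ (ι₁ β))
    not-all₁ all = contradict (admissible-nat 0<m (subst (λ d →
      (+ m ℤ.+ + 8) ℤ.* (+ m ℤ.+ + 8) ℤ.≤ + 4 ℤ.* d) p≡ℤ p-large) p-nonsquare)
      where
      p-nonsquare : NonSquare (+ g ℤ.* + p′)
      p-nonsquare = subst NonSquare p≡ℤ (nonsquare (p₀ , inj₁ p-mod))
      contradict : ∃[ b ] ∃[ n ] Admissible (+ g ℤ.* + p′) (+ m) (+ b) (+ n) → ⊥
      contradict (b , n , G) = refuted (all (m ·F α) (multiple-in-𝒪⁺ m))
        where
        above : b ℕ.* b ℕ.* p ℕ.< n ℕ.* n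
        above = pos-above {b} {n} p≡ℤ (Admissible.b√D<n G)
        open Quadratic p using (_·F_)
        open Element p n b above using (α; multiple-coordinates; multiple-in-𝒪⁺)
        refuted : IsSumOfIntegralSquares ℚ⟨√ p ,√ q ⟩ (ι₁ (m ·F α)) → ⊥
        refuted (l , a , integral , eq) = First.absurd p-nonsquare G X Y Z W e Y≡W
          (scaled sum-1 (trans (sym (proj₁ (proj₁ eq))) (proj₁ (multiple-coordinates m))))
          (scaled sum-√p (trans (sym (proj₂ (proj₁ eq))) (proj₂ (multiple-coordinates m))))
          where open Sums a integral

    not-all₂ : ¬ (∀ β → multiple𝒪⁺ ℚ⟨√ q ⟩ m β → IsSumOfIntegralSquares ℚ⟨√ p ,√ q ⟩ (ι₂ β))
    not-all₂ all = contradict (admissible-nat 0<m (subst (λ d →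
      (+ m ℤ.+ + 8) ℤ.* (+ m ℤ.+ + 8) ℤ.≤ + 4 ℤ.* d) q≡ℤ q-large) q-nonsquare)
      where
      q-nonsquare : NonSquare (+ g ℤ.* + q′)
      q-nonsquare = subst NonSquare q≡ℤ (nonsquare (q₀ , inj₂ q-mod))
      contradict : ∃[ b ] ∃[ n ] Admissible (+ g ℤ.* + q′) (+ m) (+ b) (+ n) → ⊥
      contradict (b , n , G) = refuted (all (m ·F α) (multiple-in-𝒪⁺ m))
        where
        above : b ℕ.* b ℕ.* q ℕ.< n ℕ.* n
        above = pos-above {b} {n} q≡ℤ (Admissible.b√D<n G)
        open Quadratic q using (_·F_)
        open Element q n b above using (α; multiple-coordinates; multiple-in-𝒪⁺)
        refuted : IsSumOfIntegralSquares ℚ⟨√ p ,√ q ⟩ (ι₂ (m ·F α)) → ⊥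
        refuted (l , a , integral , eq) = Second.absurd {g₁ = g₁} {q₁ = q₁} g-odd q′-odd
          (subst (λ d → (+ m ℤ.+ + 8) ℤ.* (+ m ℤ.+ + 8) ℤ.≤ + 4 ℤ.* d) p≡ℤ p-large) q-nonsquare G X Y Z W e Y≡W
          (scaled sum-1 (trans (sym (proj₁ (proj₁ eq))) (proj₁ (multiple-coordinates m))))
          (scaled sum-√q (trans (sym (proj₁ (proj₂ eq))) (proj₂ (multiple-coordinates m))))
          where open Sums a integral

  -- Translation of the hypotheses into integer congruences and inequalities.

  odd-factor : ∀ {a b c x} → a ℤ.* b ≡ c → c ≡ + 4 ℤ.* x ℤ.+ + 3 → ∃[ k ] a ≡ + 2 ℤ.* k ℤ.+ 1ℤ
  odd-factor {a} {b} {c} {x} eq c≡ = [ (λ (k , a≡) → ⊥-elim (even≢odd (k ℤ.* b) (+ 2 ℤ.* x ℤ.+ 1ℤ)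
      (trans (lem₁ k b) (trans (cong (ℤ._* b) (sym a≡)) (trans eq (trans c≡ (lem₂ x))))))) , (λ odd →
        odd) ]′ (even-or-odd a)
    where
    lem₁ : ∀ k b → + 2 ℤ.* (k ℤ.* b) ≡ + 2 ℤ.* k ℤ.* b
    lem₁ = ℤsolve-∀
    lem₂ : ∀ x → + 4 ℤ.* x ℤ.+ + 3 ≡ + 2 ℤ.* (+ 2 ℤ.* x ℤ.+ 1ℤ) ℤ.+ 1ℤ
    lem₂ = ℤsolve-∀

  -- As g is odd, g² ≡ 1 mod 4.
  product-mod-4 : ∀ {p q g p′ q′ p₀ q₀ g₁} → p ≡ g ℤ.* p′ → q ≡ g ℤ.* q′ → p ≡ + 4 ℤ.* p₀ ℤ.+ + 2 →
    q ≡ + 4 ℤ.* q₀ ℤ.+ + 3 →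
    g ≡ + 2 ℤ.* g₁ ℤ.+ 1ℤ → ∃[ r₀ ] p′ ℤ.* q′ ≡ + 4 ℤ.* r₀ ℤ.+ + 2
  product-mod-4 {p} {q} {g} {p′} {q′} {p₀} {q₀} {g₁} p≡ q≡ p-mod q-mod g-odd =
    + 4 ℤ.* p₀ ℤ.* q₀ ℤ.+ + 3 ℤ.* p₀ ℤ.+ + 2 ℤ.* q₀ ℤ.+ 1ℤ ℤ.- p′ ℤ.* q′ ℤ.* (g₁ ℤ.* g₁ ℤ.+ g₁) ,
    trans (lem₁ (p′ ℤ.* q′) g₁) (trans (cong (λ s →
      s ℤ.- + 4 ℤ.* (p′ ℤ.* q′ ℤ.* (g₁ ℤ.* g₁ ℤ.+ g₁))) total) (lem₂ p₀ q₀ (p′ ℤ.* q′ ℤ.* (g₁ ℤ.* g₁ ℤ.+ g₁))))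
    where
    total : p′ ℤ.* q′ ℤ.* ((+ 2 ℤ.* g₁ ℤ.+ 1ℤ) ℤ.* (+ 2 ℤ.* g₁ ℤ.+ 1ℤ)) ≡ (+ 4 ℤ.* p₀ ℤ.+ + 2) ℤ.* (+ 4 ℤ.* q₀ ℤ.+ + 3)
    total = trans (cong (λ g → p′ ℤ.* q′ ℤ.* (g ℤ.* g)) (sym g-odd)) (trans (lem g p′ q′)
      (cong₂ ℤ._*_ (trans (sym p≡) p-mod) (trans (sym q≡) q-mod)))
      where
      lem : ∀ g p q → p ℤ.* q ℤ.* (g ℤ.* g) ≡ g ℤ.* p ℤ.* (g ℤ.* q)
      lem = ℤsolve-∀
    lem₁ : ∀ r g → r ≡ r ℤ.* ((+ 2 ℤ.* g ℤ.+ 1ℤ) ℤ.* (+ 2 ℤ.* g ℤ.+ 1ℤ)) ℤ.- + 4 ℤ.* (r ℤ.* (g ℤ.* g ℤ.+ g))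
    lem₁ = ℤsolve-∀
    lem₂ : ∀ p q s → (+ 4 ℤ.* p ℤ.+ + 2) ℤ.* (+ 4 ℤ.* q ℤ.+ + 3) ℤ.- + 4 ℤ.* s
      ≡ + 4 ℤ.* (+ 4 ℤ.* p ℤ.* q ℤ.+ + 3 ℤ.* p ℤ.+ + 2 ℤ.* q ℤ.+ 1ℤ ℤ.- s) ℤ.+ + 2
    lem₂ = ℤsolve-∀

  fraction-bound : ∀ m r k .{{_ : ℕ.NonZero k}} → natℚ m ≤ + r / k → m ℕ.* k ℕ.≤ r
  fraction-bound m r (suc k) h =
    ℤ.drop‿+≤+ (subst (ℤ._≤ + r) (sym (ℤ.pos-* m (suc k))) (ι-cancel-≤ {+ m ℤ.* + suc k} {+ r}
    (subst₂ _≤_ (sym (ι-* (+ m) (+ suc k))) (fraction r k)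
      (ℚ.*-monoʳ-≤-nonNeg (ι (+ suc k)) {{ℚ.nonNegative (ι-≤ {+ 0} {+ suc k} (ℤ.+≤+ z≤n))}} h))))

  minimum-bound : ∀ m r p q c .{{_ : ℕ.NonZero c}} →
    natℚ m ≤ (_/_ (+ r) (4 ℕ.* c) {{ℕ.m*n≢0 4 c}} ⊓ natℚ p) ⊓ natℚ q → 4 ℕ.* m ℕ.* c ℕ.≤ r
  minimum-bound m r p q c h = subst (ℕ._≤ r) (swap m c) (fraction-bound m r (4 ℕ.* c) {{ℕ.m*n≢0 4 c}}
    (ℚ.≤-trans h (ℚ.≤-trans (ℚ.p⊓q≤p (x ⊓ natℚ p) (natℚ q)) (ℚ.p⊓q≤p x (natℚ p)))))
    where
    x : ℚ
    x = _/_ (+ r) (4 ℕ.* c) {{ℕ.m*n≢0 4 c}}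
    swap : ∀ m c → m ℕ.* (4 ℕ.* c) ≡ 4 ℕ.* m ℕ.* c
    swap = ℕsolve-∀

  half-square-bound : ∀ m p → (+ m / 2 + natℚ 4) * (+ m / 2 + natℚ 4) ≤ natℚ p →
    (+ m ℤ.+ + 8) ℤ.* (+ m ℤ.+ + 8) ℤ.≤ + 4 ℤ.* + p
  half-square-bound m p h = ι-cancel-≤ (subst₂ _≤_ expand (sym (ι-* (+ 4) (+ p)))
    (ℚ.*-monoˡ-≤-nonNeg (ι (+ 4)) {{ℚ.nonNegative (ι-≤ {+ 0} {+ 4} (ℤ.+≤+ z≤n))}} h))
    where
    x : ℚ
    x = + m / 2
    lem : ∀ k x j → k * k * ((x + j) * (x + j)) ≡ (x * k + j * k) * (x * k + j * k)
    lem = solve-∀ ℚ-ring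
    expand : ι (+ 4) * ((x + ι (+ 4)) * (x + ι (+ 4))) ≡ ι ((+ m ℤ.+ + 8) ℤ.* (+ m ℤ.+ + 8))
    expand = begin
      ι (+ 4) * ((x + ι (+ 4)) * (x + ι (+ 4)))
        ≡⟨ cong (λ k → k * ((x + ι (+ 4)) * (x + ι (+ 4)))) (ι-* (+ 2) (+ 2)) ⟩
      ι (+ 2) * ι (+ 2) * ((x + ι (+ 4)) * (x + ι (+ 4)))
        ≡⟨ lem (ι (+ 2)) x (ι (+ 4)) ⟩
      (x * ι (+ 2) + ι (+ 4) * ι (+ 2)) * (x * ι (+ 2) + ι (+ 4) * ι (+ 2))
        ≡⟨ cong (λ y → y * y) (cong₂ _+_ (fraction m 1) (sym (ι-* (+ 4) (+ 2)))) ⟩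
      (ι (+ m) + ι (+ 8)) * (ι (+ m) + ι (+ 8))
        ≡⟨ cong (λ y → y * y) (ι-+ (+ m) (+ 8)) ⟨
      ι (+ m ℤ.+ + 8) * ι (+ m ℤ.+ + 8)
        ≡⟨ ι-* (+ m ℤ.+ + 8) (+ m ℤ.+ + 8) ⟨
      ι ((+ m ℤ.+ + 8) ℤ.* (+ m ℤ.+ + 8)) ∎
      where open ≡-Reasoning

  not-all-multiples : ∀ {p q g p′ q′ m c} → SquareFree p → SquareFree q → p ℕ.% 4 ≡ 2 → q ℕ.% 4 ≡ 3 →
    p ≡ g ℕ.* p′ → q ≡ g ℕ.* q′ → Coprime p′ q′ → p ℕ.< q → q ℕ.< p′ ℕ.* q′ → 1 ℕ.≤ m → 1 ℕ.≤ c →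
    4 ℕ.* m ℕ.* c ℕ.≤ p′ ℕ.* q′ → p′ ℕ.* q′ ℕ.≤ c ℕ.* c →
    (+ m ℤ.+ + 8) ℤ.* (+ m ℤ.+ + 8) ℤ.≤ + 4 ℤ.* + p → (+ m ℤ.+ + 8) ℤ.* (+ m ℤ.+ + 8) ℤ.≤ + 4 ℤ.* + q →
    (¬ (∀ β → multiple𝒪⁺ ℚ⟨√ p ⟩ m β → IsSumOfIntegralSquares ℚ⟨√ p ,√ q ⟩ (ι₁ β)))
    × (¬ (∀ β → multiple𝒪⁺ ℚ⟨√ q ⟩ m β → IsSumOfIntegralSquares ℚ⟨√ p ,√ q ⟩ (ι₂ β)))
  not-all-multiples {p} {q} {g} {p′} {q′} {m} {c} sfp sfq p%4 q%4 p≡ q≡ p′⊥q′ p<q q<r 1≤m 1≤c 4mc≤r r≤c² p-large q-large = not-all₁ , not-all₂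
    where
    p-mod : ∃[ p₀ ] + p ≡ + 4 ℤ.* p₀ ℤ.+ + 2
    p-mod = mod-4 2 p%4
    q-mod : ∃[ q₀ ] + q ≡ + 4 ℤ.* q₀ ℤ.+ + 3
    q-mod = mod-4 3 q%4
    p≡ℤ : + p ≡ + g ℤ.* + p′
    p≡ℤ = trans (cong +_ p≡) (ℤ.pos-* g p′)
    q≡ℤ : + q ≡ + g ℤ.* + q′
    q≡ℤ = trans (cong +_ q≡) (ℤ.pos-* g q′)
    g-odd : ∃[ k ] + g ≡ + 2 ℤ.* k ℤ.+ 1ℤ
    g-odd = odd-factor {+ g} {+ q′} {+ q} {proj₁ q-mod} (sym q≡ℤ) (proj₂ q-mod)
    q′-odd : ∃[ k ] + q′ ≡ + 2 ℤ.* k ℤ.+ 1ℤ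
    q′-odd = odd-factor {+ q′} {+ g} {+ q} {proj₁ q-mod} (trans (ℤ.*-comm (+ q′) (+ g)) (sym q≡ℤ)) (proj₂ q-mod)
    r-mod : ∃[ r₀ ] + p′ ℤ.* + q′ ≡ + 4 ℤ.* r₀ ℤ.+ + 2
    r-mod = product-mod-4 {+ p} {+ q} {+ g} {+ p′} {+ q′} {proj₁ p-mod} {proj₁ q-mod} {proj₁ g-odd} p≡ℤ q≡ℤ
      (proj₂ p-mod) (proj₂ q-mod) (proj₂ g-odd)
    open Multiples {p} {q} {g} {p′} {q′} {m} {c} p≡ q≡ p′⊥q′ sfp sfq
      {proj₁ p-mod} {proj₁ q-mod} {proj₁ r-mod} {proj₁ g-odd} {proj₁ q′-odd} (proj₂ p-mod) (proj₂ q-mod)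
        (trans (ℤ.pos-* p′ q′) (proj₂ r-mod)) (proj₂ g-odd) (proj₂ q′-odd)
      p<q q<r 1≤m 1≤c 4mc≤r r≤c² p-large q-large

  cancel-gcd² : ∀ {p q r p′ q′} → p ≢ 0 → p ≡ gcd p q ℕ.* p′ → q ≡ gcd p q ℕ.* q′ →
    r ℕ.* gcd p q ℕ.^ 2 ≡ p ℕ.* q → r ≡ p′ ℕ.* q′
  cancel-gcd² {p} {q} {r} {p′} {q′} p≢0 p≡ q≡ eq = ℕ.*-cancelʳ-≡ r (p′ ℕ.* q′) (g ℕ.* g) {{ℕ.m*n≢0 g g}}
    (trans (cong (r ℕ.*_) (cong (g ℕ.*_) (sym (ℕ.*-identityʳ g))))
      (trans eq (trans (cong₂ ℕ._*_ p≡ q≡) (swap g p′ q′))))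
    where
    g : ℕ
    g = gcd p q
    instance
      g≢0 : ℕ.NonZero g
      g≢0 = ℕ.≢-nonZero (GCD.gcd[m,n]≢0 p q (inj₁ p≢0))
    swap : ∀ a b c → a ℕ.* b ℕ.* (a ℕ.* c) ≡ b ℕ.* c ℕ.* (a ℕ.* a)
    swap = ℕsolve-∀

open import Data.Nat.Base using (NonZero; _+_; _*_; _^_; _%_; _≤_; _<_)
open import Data.Nat.Properties using (m*n≢0)
open import Data.Rational.Base using (_/_; _⊓_)
open IntegersInRationals
open NumberFields

theorem1 :
  (p q r : ℕ) →
  2 ≤ p → 2 ≤ q → SquareFree p → SquareFree q →
  p % 4 ≡ 2 → q % 4 ≡ 3 →
  r * gcd p q ^ 2 ≡ p * q →
  p < q → q < r →
  (m : ℕ) → 1 ≤ m →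
  (κ : ℕ) → 1 ≤ κ →
  (√r : ℝ) → IsSqrt (ratℝ (natℚ r)) √r →
  (c : ℕ) .{{_ : NonZero c}} → IsCeiling (ratℝ (natℚ κ) *ℝ √r) c →
  natℚ m ℚ.≤ (_/_ (+ r) (4 * c) {{m*n≢0 4 c}} ⊓ natℚ p) ⊓ natℚ q →
  (+ m / 2 ℚ.+ natℚ 4) ℚ.* (+ m / 2 ℚ.+ natℚ 4) ℚ.≤ natℚ p →
  (+ m / 2 ℚ.+ natℚ 4) ℚ.* (+ m / 2 ℚ.+ natℚ 4) ℚ.≤ natℚ q →
  (¬ (∀ β → multiple𝒪⁺ ℚ⟨√ p ⟩ m β → IsSumOfIntegralSquares ℚ⟨√ p ,√ q ⟩ (ι₁ β)))
  × (¬ (∀ β → multiple𝒪⁺ ℚ⟨√ q ⟩ m β → IsSumOfIntegralSquares ℚ⟨√ p ,√ q ⟩ (ι₂ β)))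
theorem1 p q r _ _ sfp sfq p%4 q%4 r-def p<q q<r m 1≤m κ 1≤κ √r sqrt c ceil m≤ p-large q-large =
  from-reduced (reduced p q (squarefree⇒≢0 sfq))
  where
  from-reduced : ∃[ p′ ] ∃[ q′ ] (p ≡ gcd p q * p′ × q ≡ gcd p q * q′ × Coprime p′ q′) →
    (¬ (∀ β → multiple𝒪⁺ ℚ⟨√ p ⟩ m β → IsSumOfIntegralSquares ℚ⟨√ p ,√ q ⟩ (ι₁ β)))
    × (¬ (∀ β → multiple𝒪⁺ ℚ⟨√ q ⟩ m β → IsSumOfIntegralSquares ℚ⟨√ p ,√ q ⟩ (ι₂ β)))
  from-reduced (p′ , q′ , p≡ , q≡ , p′⊥q′) =
    not-all-multiples {p} {q} {gcd p q} {p′} {q′} {m} {c} sfp sfq p%4 q%4 p≡ q≡ p′⊥q′ p<q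
    (subst (q <_) r≡ q<r) 1≤m (ℕ.>-nonZero⁻¹ c) (subst (4 * m * c ≤_) r≡ (minimum-bound m r p q c m≤))
    (subst (ℕ._≤ c * c) r≡ (ceiling-square {r} {c} {κ} √r 1≤κ sqrt ceil)) (half-square-bound m p p-large)
      (half-square-bound m q q-large)
    where
    r≡ : r ≡ p′ * q′
    r≡ = cancel-gcd² {p} {q} {r} {p′} {q′} (squarefree⇒≢0 sfp) p≡ q≡ r-def
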